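{- Let $b,r\ge1$ and let $S$ be a standard skew tableau with exactly $b$ rows, each of size $r$. Let $k=\mathrm{stab}(S)$ and let $a\ge 2k-1$ be an integer. Define $R_a(S)$ to be the row-concatenation of $\mathrm{Rect}(S^{(k-1)})$, $S^{(a-2k+2)}+(k-1)br$, and $\mathrm{Rect}^\ast(S^{(k-1)})+(a-k+1)br$. Then $R_a(S)$ is a standard Young tableau of rectangular shape $((ar)^b)$ and $\mathrm{pr}^{br}(R_a(S))=R_a(S)$.
   Context: English notation. A standard skew tableau of size $m$ is a filling of a skew shape with $1,\dots,m$ once each, increasing along rows and down columns. $S+x$ adds $x$ to all entries. $\mathrm{Rect}$ is jeu de taquin rectification (top-left justified). $\mathrm{Rect}^\ast(X)$ for $X$ with at most $b$ rows: place $X$ in a rectangle with $b$ rows and do outer jeu de taquin slides within it until occupied cells are justified against the bottom-right corner (rows determined up to horizontal translation). For $S$ of size $m$ with weakly decreasing row sizes and $j\ge1$, $S^{(j)}$ is the standard skew tableau whose $i$-th row consists of the $i$-th row of $S$ followed immediately to the right by the $i$-th rows of $S+m,\dots,S+(j-1)m$; $S^{(0)}$ is empty. $S$ stabilizes at $j$ if every entry of $[(j-1)m+1,jm]$ lies in the same row of $\mathrm{Rect}(S^{(j)})$ as in $S^{(j)}$; $\mathrm{stab}(S)$ is the least such $j\ge1$. The row-concatenation of fillings $A,B,C$, each regarded as having $b$ rows (possibly empty) indexed top to bottom, is the left-justified array whose $i$-th row lists row $i$ of $A$, then of $B$, then of $C$, left to right. Promotion $\mathrm{pr}$ on a standard tableau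 with $n$ cells: delete $1$; repeatedly move into the empty cell the smaller of its right and lower neighbors (in the shape) until it has neither; put $n+1$ there; subtract $1$ from all entries. -}

module Defs where

open import Data.Nat using (ℕ; zero; suc; _+_; _*_; _∸_; _≤_; _<_; _≤ᵇ_; _<ᵇ_; _<?_; _⊔_)
open import Data.Bool using (Bool; true; false; if_then_else_)
open import Data.Maybe using (Maybe; just; nothing)
open import Data.Product using (_×_; _,_; proj₁; proj₂)
open import Data.List using (List; []; _∷_; _++_; length; map; concatMap; upTo; take; drop; reverse; foldr)
open import Data.Nat.ListAction using (sum)
open import Data.Bool.ListAction using (any)
open import Data.List.Relation.Unary.All using (All)
open import Data.List.Relation.Unary.Linked using (Linked)
open import Data.List.Relation.Binary.Permutation.Propositional using (_↭_)
open import Relation.Binary.PropositionalEquality using (_≡_)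
open import Relation.Nullary using (¬_; yes; no)

-- Skew tableaux (English notation).
-- A row is (offset , entries): the entries occupy columns
-- offset, offset+1, ... of that row.  A skew tableau with b rows is a list
-- of b rows, top to bottom.  Row i of the skew shape λ/μ is encoded by
-- μ_i = offset and λ_i = offset + length entries.

Row : Set
Row = ℕ × List ℕ

SkewTab : Set
SkewTab = List Row

lookupL : List ℕ → ℕ → Maybe ℕ
lookupL []       _       = nothing
lookupL (x ∷ xs) zero    = just x
lookupL (x ∷ xs) (suc n) = lookupL xs n

entryAt : Row → ℕ → Maybe ℕ
entryAt (o , e) c = if o ≤ᵇ c then lookupL e (c ∸ o) else nothing

size : SkewTab → ℕ
size T = sum (map (λ row → length (proj₂ row)) T)

ShapeStep : Row → Row → Set
ShapeStep (o , e) (o' , e') = (o' ≤ o) × (o' + length e' ≤ o + length e)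

ColStep : Row → Row → Set
ColStep r r' = ∀ c x y → entryAt r c ≡ just x → entryAt r' c ≡ just y → x < y

IsStandardSkew : SkewTab → Set
IsStandardSkew T =
  Linked ShapeStep T
  × All (λ row → Linked _<_ (proj₂ row)) T
  × Linked ColStep T
  × (concatMap proj₂ T ↭ map suc (upTo (size T)))

IsRectSYT : ℕ → ℕ → List (List ℕ) → Set
IsRectSYT w b R =
  (length R ≡ b) × All (λ row → length row ≡ w) R × IsStandardSkew (map (λ row → (0 , row)) R)

-- Sliding a hole.
-- State: the hole is in the current row, whose offset is o; pre are the
-- entries to the left of the hole and post those to its right; rest are
-- the rows below.  Repeatedly the smaller of the right and lower
-- neighbours moves into the hole.  When the hole has neither neighbour
-- (so post = []) the list ex is put at the hole's position
-- (ex = [] : the cell leaves the shape (jeu de taquin);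
--  ex = [n+1] : used by promotion).

slide : List ℕ → ℕ → List ℕ → List ℕ → List Row → List Row
slide ex o pre post [] = (o , pre ++ post ++ ex) ∷ []
slide ex o pre post ((o' , es) ∷ rest) = go pre post
  where
  down : List ℕ → ℕ → List ℕ → List Row
  down pre' d post' =
    (o , pre' ++ d ∷ post') ∷
      slide ex o' (take (o + length pre' ∸ o') es) (drop (suc (o + length pre' ∸ o')) es) rest
  choose : List ℕ → List ℕ → Maybe ℕ → List Row
  go : List ℕ → List ℕ → List Row
  choose pre' [] nothing = (o , pre' ++ ex) ∷ (o' , es) ∷ rest
  choose pre' [] (just d) = down pre' d []
  choose pre' (x ∷ post') nothing = go (pre' ++ x ∷ []) post'
  choose pre' (x ∷ post') (just d) with d <? x
  ... | yes _ = down pre' d (x ∷ post')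
  ... | no _  = go (pre' ++ x ∷ []) post'
  go pre' post' = choose pre' post' (entryAt (o' , es) (o + length pre'))

-- one inner jeu de taquin slide, into the inner corner (i , μ_i - 1) where
-- i is the lowest row with μ_i > 0 (this cell is an inner corner of μ)
hasPos : SkewTab → Bool
hasPos = any (λ row → 0 <ᵇ proj₁ row)

jdtStep : SkewTab → SkewTab
jdtStep [] = []
jdtStep ((o , es) ∷ rest) with hasPos rest
... | true  = (o , es) ∷ jdtStep rest
... | false with o
...   | zero  = (zero , es) ∷ rest
...   | suc o' = slide [] o' [] es rest

iter : {A : Set} → ℕ → (A → A) → A → A
iter zero    f x = x
iter (suc n) f x = f (iter n f x)

-- each slide decreases |μ| = sum of offsets by one, so after |μ| slides
-- the shape is straight: this is the jeu de taquin rectification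
Rect : SkewTab → SkewTab
Rect T = iter (sum (map proj₁ T)) jdtStep T

-- Rect*: place T in a rectangle with (length T) rows and width W (the
-- largest λ_i) and perform outer jeu de taquin slides until the cells are
-- justified against the bottom-right corner.  An outer slide (larger of the
-- left/upper neighbours moves into the hole) is exactly an inner slide
-- conjugated by rotating the rectangle by 180 degrees and reversing the
-- order of entries (x ↦ c ∸ x, c larger than every entry); so Rect* is
-- computed as rot ∘ Rect ∘ rot.  Rows are determined up to translation;
-- only the row contents are used below.
rot : ℕ → ℕ → SkewTab → SkewTab
rot W c T = reverse (map (λ row → (W ∸ (proj₁ row + length (proj₂ row)) ,
                                   reverse (map (c ∸_) (proj₂ row)))) T)

RectStar : SkewTab → SkewTab
RectStar T = rot W c (Rect (rot W c T))
  where
  W = foldr _⊔_ 0 (map (λ row → proj₁ row + length (proj₂ row)) T)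
  c = suc (foldr _⊔_ 0 (concatMap proj₂ T))

shift : ℕ → List ℕ → List ℕ
shift x = map (_+ x)

pow : SkewTab → ℕ → SkewTab
pow S j = map (λ row → (proj₁ row , concatMap (λ t → shift (t * size S) (proj₂ row)) (upTo j))) S

rowOf : SkewTab → ℕ → Maybe ℕ
rowOf [] x = nothing
rowOf ((o , es) ∷ rest) x with any (λ y → (y ≤ᵇ x) Data.Bool.∧ (x ≤ᵇ y)) es
... | true  = just 0
... | false with rowOf rest x
...   | nothing = nothing
...   | just i  = just (suc i)

StabilizesAt : SkewTab → ℕ → Set
StabilizesAt S j =
  ∀ x → (j ∸ 1) * size S < x → x ≤ j * size S →
    rowOf (Rect (pow S j)) x ≡ rowOf (pow S j) x

IsStab : SkewTab → ℕ → Set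
IsStab S k = (1 ≤ k) × StabilizesAt S k × (∀ j → 1 ≤ j → j < k → ¬ StabilizesAt S j)

zip3++ : List (List ℕ) → List (List ℕ) → List (List ℕ) → List (List ℕ)
zip3++ (x ∷ xs) (y ∷ ys) (z ∷ zs) = (x ++ y ++ z) ∷ zip3++ xs ys zs
zip3++ _ _ _ = []

rows : SkewTab → List (List ℕ)
rows = map proj₂

Ra : ℕ → ℕ → SkewTab → ℕ → ℕ → List (List ℕ)
Ra b r S k a =
  zip3++ (rows (Rect (pow S (k ∸ 1))))
         (map (shift ((k ∸ 1) * (b * r))) (rows (pow S (a + 2 ∸ 2 * k))))
         (map (shift ((a + 1 ∸ k) * (b * r))) (rows (RectStar (pow S (k ∸ 1)))))

pr : List (List ℕ) → List (List ℕ)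
pr [] = []
pr ([] ∷ rest) = [] ∷ rest
pr ((x ∷ es) ∷ rest) =
  map (λ row → map (_∸ 1) (proj₂ row))
      (slide (suc n ∷ []) 0 [] es (map (λ row → (0 , row)) rest))
  where
  n = sum (map length ((x ∷ es) ∷ rest))

{-# OPTIONS --safe #-}
module Submission where

-- Record a standard filling by its row word, whose t-th letter is the row of
-- the entry t.  A slide changes the row word by crystal operators, so
-- rectification is the passage E to the highest weight word.  Here E is a
-- composite of queues; by their braid relation it is invariant under crystal
-- operators, hence compatible with deleting initial segments, and the shape of
-- E x is invariant under reverse complement x ↦ star x, which is rotation.
--
-- Let w be the row word of S.  Stability at k says E (wᵏ) = E (wᵏ⁻¹) w.  This
-- depends only on shapes, so star w is stable at k as well, and the stable
-- shape turns out to be self-dual.  Hence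
-- R = E (wᵏ⁻¹) wᶜ star (E ((star w)ᵏ⁻¹)) is rectangular.  Cut R into E (wᵏ) and
-- star (E ((star w)ᵃ⁻ᵏ)).  When the letters q of w are promoted away one after
-- the other, comparing shapes shows that the hole leaves the left part in the
-- row complementary to q; rotated by 180 degrees, the same statement for star w
-- says what such holes do to the right part.  After |w| promotions the left part is
-- E (wᵏ⁻¹) and the right part is star (E ((star w)ᵃ⁻ᵏ⁺¹)), which is R again.

open import Defs
open import Data.Nat using (ℕ; s≤s⁻¹; zero; suc; _+_; _*_; _∸_; _≤_; _<_; z≤n; s≤s; _⊔_; _≤ᵇ_; _<ᵇ_; _<?_; _≟_; _≤?_; pred)
open import Data.Nat.Properties
open import Data.Bool using (Bool; true; false; if_then_else_; _∨_; _∧_)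
open import Data.Maybe using (Maybe; just; nothing)
open import Data.Maybe.Properties using (just-injective)
open import Data.Product using (_×_; _,_; proj₁; proj₂; ∃; ∃₂; ∃-syntax)
open import Data.Sum using (_⊎_; inj₁; inj₂)
open import Data.Empty using (⊥; ⊥-elim)
open import Data.Unit using (tt)
open import Data.List using (List; []; _∷_; _++_; [_]; length; map; concatMap; upTo; take; drop; reverse; foldr; replicate)
open import Data.List.Properties
open import Data.Nat.ListAction using (sum)
open import Data.List.Relation.Unary.All as All using (All; []; _∷_)
import Data.List.Relation.Unary.All.Properties as All
open import Data.List.Relation.Binary.Pointwise as Pw using (Pointwise; []; _∷_)
open import Relation.Binary.PropositionalEquality hiding ([_])
open import Relation.Nullary using (yes; no; contradiction)
open import Function using (_∘_)
open import Relation.Binary.Construct.Closure.ReflexiveTransitive using (Star; ε; _◅_; _◅◅_)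
open import Data.List.Relation.Unary.Linked as Linked using (Linked; []; [-]; _∷_)
import Data.List.Relation.Unary.Linked.Properties as Linked
open import Data.List.Relation.Unary.AllPairs using (AllPairs; []; _∷_)
open import Data.List.Relation.Binary.Permutation.Propositional as ↭ using (_↭_)
import Data.List.Relation.Binary.Permutation.Propositional.Properties as Perm
open import Data.Bool.ListAction using (any)

-- Words and crystal operators

-- Taking `E` as a composite of left-to-right transducers, rather than as a choice of highest weight
-- word in a crystal component, gives by inspection that prefixes are rectified independently of
-- what follows and that letters only decrease. Stability thereby becomes a counting condition: a
-- block whose letters can only decrease and whose letter counts persist is unchanged. The point
-- that is not formal is the self-duality of the stable shape. Stability bounds from below the gaps
-- between consecutive rows; any inner shape from which w is a lattice path bounds the top row from
-- above. With the smallest such inner shape the two bounds leave no slack, because the number of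
-- cells is known. With n = b - 1 and k = stab(S) - 1, which is what `k` stands for in the
-- statements about stable words, a is 2k + 1 + c. The hypothesis on a means that at least one plain
-- copy of w stands in the middle, and this is the copy that is promoted away.

Word : Set
Word = List ℕ

is : ℕ → ℕ → ℕ
is zero    zero    = 1
is zero    (suc q) = 0
is (suc j) zero    = 0
is (suc j) (suc q) = is j q

count : ℕ → Word → ℕ
count j []      = 0
count j (q ∷ x) = is j q + count j x

-- The bracketing rule as a queue: the state is the number of letters i
-- still waiting for a letter i+1, and a letter i+1 that arrives at an empty
-- queue is turned into i.
out : ℕ → ℕ → ℕ → ℕ
out zero    d       zero          = zero
out zero    d       (suc (suc q)) = suc (suc q)
out zero    zero    (suc zero)    = zero
out zero    (suc d) (suc zero)    = suc zero
out (suc i) d       zero          = zero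
out (suc i) d       (suc q)       = suc (out i d q)

nxt : ℕ → ℕ → ℕ → ℕ
nxt zero    d       zero          = suc d
nxt zero    d       (suc (suc q)) = d
nxt zero    zero    (suc zero)    = zero
nxt zero    (suc d) (suc zero)    = d
nxt (suc i) d       zero          = d
nxt (suc i) d       (suc q)       = nxt i d q

P : ℕ → ℕ → Word → Word
P i d []      = []
P i d (q ∷ x) = out i d q ∷ P i (nxt i d q) x

end : ℕ → ℕ → Word → ℕ
end i d []      = d
end i d (q ∷ x) = end i (nxt i d q) x

-- Transition between the queue states of the two sides of the braid
-- relation, i.e. (a , b , c) ↦ (b + c ∸ min a c , min a c , a + b ∸ min a c).
data Braid (a b c a' b' c' : ℕ) : Set where
  up   : ∀ e → c ≡ a + e → a' ≡ b + e → b' ≡ a → c' ≡ b → Braid a b c a' b' c'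
  down : ∀ e → a ≡ c + e → a' ≡ b → b' ≡ c → c' ≡ b + e → Braid a b c a' b' c'

BraidStep : ℕ → (a b c a' b' c' : ℕ) → ℕ → Set
BraidStep i a b c a' b' c' q =
  let q₁ = out i a q ; q₂ = out (suc i) b q₁
      r₁ = out (suc i) a' q ; r₂ = out i b' r₁
  in (out i c q₂ ≡ out (suc i) c' r₂) ×
     Braid (nxt i a q) (nxt (suc i) b q₁) (nxt i c q₂)
           (nxt (suc i) a' q) (nxt i b' r₁) (nxt (suc i) c' r₂)

up-step : ∀ a b e q → BraidStep 0 a b (a + e) (b + e) a b q
up-step a b e zero = refl , up e refl refl refl refl
up-step zero b e (suc zero) = refl , up (suc e) refl (sym (+-suc b e)) refl refl
up-step (suc a) b e (suc zero) = refl , up e refl refl refl refl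
up-step zero zero zero (suc (suc zero)) = refl , up zero refl refl refl refl
-- The third queue loses a letter while it is exactly as long as the first, so the minimum of the
-- two passes from a to c.
up-step (suc a) zero zero (suc (suc zero)) rewrite +-identityʳ a =
  refl , down 1 (sym (+-comm a 1)) refl refl refl
up-step a zero (suc e) (suc (suc zero)) rewrite +-suc a e = refl , up e refl refl refl refl
up-step a (suc b) e (suc (suc zero)) = refl , up e refl refl refl refl
up-step a b e (suc (suc (suc q))) = refl , up e refl refl refl refl

down-step : ∀ c b e q → BraidStep 0 (c + e) b c b c (b + e) q
down-step c b e zero = refl , down e refl refl refl refl
down-step zero b zero (suc zero) rewrite +-identityʳ b = refl , up 1 refl (sym (+-comm b 1)) refl refl
down-step zero b (suc e) (suc zero) = refl , down e refl refl refl (+-suc b e)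
down-step (suc c) b e (suc zero) = refl , down e refl refl refl refl
down-step zero zero e (suc (suc zero)) = refl , down e refl refl refl refl
down-step (suc c) zero e (suc (suc zero)) = refl , down (suc e) (sym (+-suc c e)) refl refl refl
down-step c (suc b) e (suc (suc zero)) = refl , down e refl refl refl refl
down-step c b e (suc (suc (suc q))) = refl , down e refl refl refl refl

braid-step : ∀ i {a b c a' b' c'} q → Braid a b c a' b' c' → BraidStep i a b c a' b' c' q
braid-step zero    q       (up e refl refl refl refl)   = up-step _ _ e q
braid-step zero    q       (down e refl refl refl refl) = down-step _ _ e q
braid-step (suc i) zero    r                            = refl , r
braid-step (suc i) (suc q) r                            = let e , r' = braid-step i q r in cong suc e , r'

-- The two sides are transducers, and `Braid` is a bisimulation between their states; it is
-- Lusztig's piecewise linear transition map of type A2. The relation between the final states is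
-- used again for lowest weight words.
braid : ∀ i {a b c a' b' c'} x → Braid a b c a' b' c' →
  let x₁ = P i a x ; x₂ = P (suc i) b x₁
      y₁ = P (suc i) a' x ; y₂ = P i b' y₁
  in (P i c x₂ ≡ P (suc i) c' y₂) ×
     Braid (end i a x) (end (suc i) b x₁) (end i c x₂)
           (end (suc i) a' x) (end i b' y₁) (end (suc i) c' y₂)
braid i []      r = refl , r
braid i (q ∷ x) r =
  let e , r' = braid-step i q r ; es , r'' = braid i x r' in cong₂ _∷_ e es , r''

P-braid : ∀ i x → P i 0 (P (suc i) 0 (P i 0 x)) ≡ P (suc i) 0 (P i 0 (P (suc i) 0 x))
P-braid i x = proj₁ (braid i x (up 0 refl refl refl refl))

far-step : ∀ i k d e q → let j = suc (suc (i + k)) in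
  (out i d (out j e q) ≡ out j e (out i d q)) × (nxt i d (out j e q) ≡ nxt i d q) × (nxt j e (out i d q) ≡ nxt j e q)
far-step zero k d e zero = refl , refl , refl
far-step zero k zero e (suc zero) = refl , refl , refl
far-step zero k (suc d) e (suc zero) = refl , refl , refl
far-step zero k d e (suc (suc q)) = refl , refl , refl
far-step (suc i) k d e zero = refl , refl , refl
far-step (suc i) k d e (suc q) = let a , b , c = far-step i k d e q in cong suc a , b , c

far : ∀ i k d e x → let j = suc (suc (i + k)) in
  (P i d (P j e x) ≡ P j e (P i d x)) × (end i d (P j e x) ≡ end i d x) × (end j e (P i d x) ≡ end j e x)
far i k d e [] = refl , refl , refl
far i k d e (q ∷ x) with far-step i k d e q
... | a , b , c rewrite b | c = let a' , b' , c' = far i k (nxt i d q) (nxt (suc (suc (i + k))) e q) x in cong₂ _∷_ a a' , b' , c'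

-- Composite operators and the highest weight word

C : ℕ → Word → Word
C zero    x = x
C (suc n) x = P n 0 (C n x)

-- The indices applied are 0, 1, ..., n-1, then 0, ..., n-2, and so on down to 0: a reduced word of
-- the longest permutation. Maximal raising along such a word reaches the highest weight.
E : ℕ → Word → Word
E zero    x = x
E (suc n) x = E n (C (suc n) x)

P-far : ∀ {i j} → suc i < j → ∀ d e x → P i d (P j e x) ≡ P j e (P i d x)
P-far {i} i<j d e x with m≤n⇒∃[o]m+o≡n i<j
... | k , refl = proj₁ (far i k d e x)

end-far : ∀ {i j} → suc i < j → ∀ d e x → (end i d (P j e x) ≡ end i d x) × (end j e (P i d x) ≡ end j e x)
end-far {i} i<j d e x with m≤n⇒∃[o]m+o≡n i<j
... | k , refl = proj₂ (far i k d e x)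

idem-step : ∀ i d e q → d ≤ e → (out i e (out i d q) ≡ out i d q) × nxt i d q ≤ nxt i e (out i d q)
idem-step zero d e zero d≤e = refl , s≤s d≤e
idem-step zero zero e (suc zero) d≤e = refl , z≤n
idem-step zero (suc d) (suc e) (suc zero) (s≤s d≤e) = refl , d≤e
idem-step zero d e (suc (suc q)) d≤e = refl , d≤e
idem-step (suc i) d e zero d≤e = refl , d≤e
idem-step (suc i) d e (suc q) d≤e = let a , b = idem-step i d e q d≤e in cong suc a , b

-- The second queue may run ahead of the first, since every turned letter enters it as a waiting i;
-- a longer queue turns fewer letters.
P-idem : ∀ i {d e} x → d ≤ e → P i e (P i d x) ≡ P i d x
P-idem i [] d≤e = refl
P-idem i {d} {e} (q ∷ x) d≤e =
  let a , b = idem-step i d e q d≤e in cong₂ _∷_ a (P-idem i x b)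

C-far : ∀ {n j} → n < j → ∀ d x → C n (P j d x) ≡ P j d (C n x)
C-far {zero}  n<j d x = refl
C-far {suc n} n<j d x = trans (cong (P n 0) (C-far (<-trans (n<1+n n) n<j) d x)) (P-far n<j 0 d (C n x))

-- The operator commutes with all factors of `C n` except its neighbours, where one braid relation
-- lowers its index.
C-P : ∀ {n j} → suc j < n → ∀ x → C n (P (suc j) 0 x) ≡ P j 0 (C n x)
C-P {suc n} {j} (s≤s j<n) x with m≤n⇒m<n∨m≡n j<n
... | inj₁ j+1<n = trans (cong (P n 0) (C-P j+1<n x)) (sym (P-far j+1<n 0 0 (C n x)))
... | inj₂ refl  = trans (cong (λ z → P (suc j) 0 (P j 0 z)) (C-far (n<1+n j) 0 x))
                         (sym (P-braid j (C j x)))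

C-P₀ : ∀ n x → C (suc n) (P 0 0 x) ≡ C (suc n) x
C-P₀ zero    x = P-idem 0 x z≤n
C-P₀ (suc n) x = cong (P (suc n) 0) (C-P₀ n x)

-- Each factor of `E` that `P i` crosses lowers its index by one, until index 0 is absorbed by
-- idempotence.
E-P : ∀ {n i} → i < n → ∀ x → E n (P i 0 x) ≡ E n x
E-P {suc n} {zero}  i<n       x = cong (E n) (C-P₀ n x)
E-P {suc n} {suc i} (s≤s i<n) x = trans (cong (E n) (C-P (s≤s i<n) x)) (E-P i<n (C (suc n) x))

E-far : ∀ {n j} → n < j → ∀ x → E n (P j 0 x) ≡ P j 0 (E n x)
E-far {zero}  n<j x = refl
E-far {suc n} n<j x = trans (cong (E n) (C-far n<j 0 x)) (E-far (<-trans (n<1+n n) n<j) (C (suc n) x))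

C-C : ∀ n j → j ≤ n → ∀ x → C (suc n) (C (suc j) x) ≡ C j (C (suc n) x)
C-C n zero    j≤n x = C-P₀ n x
C-C n (suc j) j≤n x = trans (C-P (s≤s j≤n) (C (suc j) x)) (cong (P j 0) (C-C n j (≤-trans (n≤1+n j) j≤n) x))

-- The operator commutes with the inner `E n` and completes the next factor to a second copy of
-- `C (suc (suc n))`; `C-C` cuts that copy back to the original factor.
P-E-last : ∀ n x → P n 0 (E (suc n) x) ≡ E (suc n) x
P-E-last zero    x = P-idem 0 x z≤n
P-E-last (suc n) x = begin
  P (suc n) 0 (E n (C (suc n) (C (suc (suc n)) x)))  ≡⟨ E-far (n<1+n n) _ ⟨
  E n (C (suc (suc n)) (C (suc (suc n)) x))          ≡⟨ cong (E n) (C-C (suc n) (suc n) ≤-refl x) ⟩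
  E n (C (suc n) (C (suc (suc n)) x))                ∎
  where open ≡-Reasoning

P-E : ∀ {n i} → i < n → ∀ x → P i 0 (E n x) ≡ E n x
P-E {suc n} (s≤s i≤n) x with m≤n⇒m<n∨m≡n i≤n
... | inj₁ i<n  = P-E i<n (C (suc n) x)
... | inj₂ refl = P-E-last n x

-- Counting letters

is-refl : ∀ i → is i i ≡ 1
is-refl zero    = refl
is-refl (suc i) = is-refl i

is-suc : ∀ i → is i (suc i) ≡ 0
is-suc zero    = refl
is-suc (suc i) = is-suc i

is-pred : ∀ i → is (suc i) i ≡ 0
is-pred zero    = refl
is-pred (suc i) = is-pred i

is-≢ : ∀ {j q} → j ≢ q → is j q ≡ 0
is-≢ {zero}  {zero}  j≢q = contradiction refl j≢q
is-≢ {zero}  {suc q} j≢q = refl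
is-≢ {suc j} {zero}  j≢q = refl
is-≢ {suc j} {suc q} j≢q = is-≢ (j≢q ∘ cong suc)

is-1 : ∀ {j q} → is j q ≡ 1 → j ≡ q
is-1 {zero}  {zero}  e = refl
is-1 {suc j} {suc q} e = cong suc (is-1 e)

is-≤1 : ∀ j q → is j q ≤ 1
is-≤1 zero    zero    = ≤-refl
is-≤1 zero    (suc q) = z≤n
is-≤1 (suc j) zero    = z≤n
is-≤1 (suc j) (suc q) = is-≤1 j q

count-++ : ∀ j x y → count j (x ++ y) ≡ count j x + count j y
count-++ j []      y = refl
count-++ j (q ∷ x) y = trans (cong (is j q +_) (count-++ j x y)) (sym (+-assoc (is j q) _ _))

-- out i d q is the fourth and nxt i d q the fifth index.
data View (i : ℕ) : (d q o d' : ℕ) → Set where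
  low   : ∀ {d} → View i d i i (suc d)
  high  : ∀ {d} → View i (suc d) (suc i) (suc i) d
  turn  : View i 0 (suc i) i 0
  other : ∀ {d q} → is i q ≡ 0 → is (suc i) q ≡ 0 → View i d q q d

view-suc : ∀ {i d q o d'} → View i d q o d' → View (suc i) d (suc q) (suc o) d'
view-suc low         = low
view-suc high        = high
view-suc turn        = turn
view-suc (other a b) = other a b

view : ∀ i d q → View i d q (out i d q) (nxt i d q)
view zero    d       zero          = low
view zero    d       (suc (suc q)) = other refl refl
view zero    zero    (suc zero)    = turn
view zero    (suc d) (suc zero)    = high
view (suc i) d       zero          = other refl refl
view (suc i) d       (suc q)       = view-suc (view i d q)

view-≡ : ∀ {i d q o d'} → View i d q o d' → out i d q ≡ o × nxt i d q ≡ d'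
view-≡ {zero}  low  = refl , refl
view-≡ {zero}  high = refl , refl
view-≡ {zero}  turn = refl , refl
view-≡ {zero} {q = suc (suc q)} (other a b) = refl , refl
view-≡ {suc i} low  = let a , b = view-≡ {i} low in cong suc a , b
view-≡ {suc i} high = let a , b = view-≡ {i} high in cong suc a , b
view-≡ {suc i} turn = let a , b = view-≡ {i} turn in cong suc a , b
view-≡ {suc i} {q = zero}  (other a b) = refl , refl
view-≡ {suc i} {q = suc q} (other a b) = let c , d = view-≡ {i} (other a b) in cong suc c , d

-- Both sides equal d plus the number of letters i of x plus the number of letters i+1 that meet an
-- empty queue.
balance : ∀ i d x → count i (P i d x) + d ≡ end i d x + count (suc i) x
balance i d [] = sym (+-identityʳ d)
balance i d (q ∷ x) with out i d q | nxt i d q | view i d q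
... | _ | _ | low rewrite is-refl i | is-pred i = trans (sym (+-suc _ d)) (balance i (suc d) x)
... | _ | _ | high {d'} rewrite is-refl i | is-suc i =
  trans (+-suc _ d') (trans (cong suc (balance i d' x)) (sym (+-suc _ _)))
... | _ | _ | turn rewrite is-refl i = trans (cong suc (balance i 0 x)) (sym (+-suc _ _))
... | _ | _ | other a b rewrite a | b = balance i d x

count-P-+ : ∀ i d x → count i (P i d x) + count (suc i) (P i d x) ≡ count i x + count (suc i) x
count-P-+ i d [] = refl
count-P-+ i d (q ∷ x) with out i d q | nxt i d q | view i d q
... | _ | _ | low rewrite is-refl i | is-pred i = cong suc (count-P-+ i (suc d) x)
... | _ | _ | high {d'} rewrite is-refl i | is-suc i =
  trans (+-suc _ _) (trans (cong suc (count-P-+ i d' x)) (sym (+-suc _ _)))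
... | _ | _ | turn rewrite is-refl i | is-suc i | is-pred i =
  trans (cong suc (count-P-+ i 0 x)) (sym (+-suc _ _))
... | _ | _ | other a b rewrite a | b = count-P-+ i d x

count-P-other : ∀ {i j} → j ≢ i → j ≢ suc i → ∀ d x → count j (P i d x) ≡ count j x
count-P-other j≢i j≢1+i d [] = refl
count-P-other {i} {j} j≢i j≢1+i d (q ∷ x) with out i d q | nxt i d q | view i d q
... | _ | d' | low = cong (is j i +_) (count-P-other j≢i j≢1+i d' x)
... | _ | d' | high = cong (is j (suc i) +_) (count-P-other j≢i j≢1+i d' x)
... | _ | d' | turn = cong₂ _+_ (trans (is-≢ j≢i) (sym (is-≢ j≢1+i))) (count-P-other j≢i j≢1+i d' x)
... | _ | d' | other a b = cong (is j q +_) (count-P-other j≢i j≢1+i d' x)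

count-P-≤ : ∀ i d x → count i x ≤ count i (P i d x)
count-P-≤ i d [] = z≤n
count-P-≤ i d (q ∷ x) with out i d q | nxt i d q | view i d q
... | _ | d' | low = +-monoʳ-≤ (is i i) (count-P-≤ i d' x)
... | _ | d' | high = +-monoʳ-≤ (is i (suc i)) (count-P-≤ i d' x)
... | _ | d' | turn = +-mono-≤ (subst (_≤ is i i) (sym (is-suc i)) z≤n) (count-P-≤ i d' x)
... | _ | d' | other a b = +-monoʳ-≤ (is i q) (count-P-≤ i d' x)

-- Concatenation, monotonicity of the queues, and prefix and suffix criteria

P-++ : ∀ i d x y → P i d (x ++ y) ≡ P i d x ++ P i (end i d x) y
P-++ i d []      y = refl
P-++ i d (q ∷ x) y = cong (out i d q ∷_) (P-++ i (nxt i d q) x y)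

end-++ : ∀ i d x y → end i d (x ++ y) ≡ end i (end i d x) y
end-++ i d []      y = refl
end-++ i d (q ∷ x) y = end-++ i (nxt i d q) x y

nxt-mono : ∀ i q {d e} → d ≤ e → nxt i d q ≤ nxt i e q
nxt-mono zero    zero          d≤e         = s≤s d≤e
nxt-mono zero    (suc (suc q)) d≤e         = d≤e
nxt-mono zero    (suc zero)    z≤n         = z≤n
nxt-mono zero    (suc zero)    (s≤s d≤e)   = d≤e
nxt-mono (suc i) zero          d≤e         = d≤e
nxt-mono (suc i) (suc q)       d≤e         = nxt-mono i q d≤e

end-mono : ∀ i x {d e} → d ≤ e → end i d x ≤ end i e x
end-mono i []      d≤e = d≤e
end-mono i (q ∷ x) d≤e = end-mono i x (nxt-mono i q d≤e)

out-fix-mono : ∀ i q {d e} → d ≤ e → out i d q ≡ q → out i e q ≡ q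
out-fix-mono i q {d} {e} d≤e eq with out i d q | nxt i d q | view i d q
... | _ | _ | low       = proj₁ (view-≡ low)
... | _ | _ | other a b = proj₁ (view-≡ {i} (other a b))
out-fix-mono i .(suc i) (s≤s d≤e) eq | _ | _ | high = proj₁ (view-≡ {i} high)
out-fix-mono i .(suc i) d≤e eq | _ | _ | turn = contradiction (sym eq) 1+n≢n

P-fix-mono : ∀ i x {d e} → d ≤ e → P i d x ≡ x → P i e x ≡ x
P-fix-mono i []      d≤e eq = refl
P-fix-mono i (q ∷ x) {d} {e} d≤e eq = let a , b = ∷-injective eq in
  cong₂ _∷_ (out-fix-mono i q d≤e a) (P-fix-mono i x (nxt-mono i q d≤e) b)

++-split : ∀ (x : Word) {x' y y'} → length x ≡ length x' → x ++ y ≡ x' ++ y' → x ≡ x' × y ≡ y'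
++-split []      {[]}     l e = refl , e
++-split (q ∷ x) {q' ∷ x'} l e = let a , b = ∷-injective e ; c , d = ++-split x (suc-injective l) b
                                  in cong₂ _∷_ a c , d

length-P : ∀ i d x → length (P i d x) ≡ length x
length-P i d []      = refl
length-P i d (q ∷ x) = cong suc (length-P i (nxt i d q) x)

P-fix-prefix : ∀ i d x y → P i d (x ++ y) ≡ x ++ y → P i d x ≡ x
P-fix-prefix i d x y e = proj₁ (++-split (P i d x) (length-P i d x) (trans (sym (P-++ i d x y)) e))

-- To be fixed is never to offer a letter i+1 to an empty queue, which is the lattice condition on
-- prefixes with d as head start of row i. `count⇒P-fix` is the converse.
P-fix⇒count : ∀ i d x y → P i d (x ++ y) ≡ x ++ y → count (suc i) x ≤ count i x + d
P-fix⇒count i d x y e = subst (count (suc i) x ≤_) eq (m≤n+m _ (end i d x))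
  where
  eq : end i d x + count (suc i) x ≡ count i x + d
  eq = trans (sym (balance i d x)) (cong (λ z → count i z + d) (P-fix-prefix i d x y e))

count⇒P-fix : ∀ i d z → (∀ x y → z ≡ x ++ y → count (suc i) x ≤ count i x + d) → P i d z ≡ z
count⇒P-fix i d [] h = refl
count⇒P-fix i d (q ∷ z) h with out i d q | nxt i d q | view i d q
... | _ | _ | low = cong (i ∷_) (count⇒P-fix i (suc d) z λ x y e →
  subst₂ _≤_ (cong (_+ count (suc i) x) (is-pred i)) (trans (cong (λ k → k + count i x + d) (is-refl i)) (sym (+-suc _ d)))
    (h (i ∷ x) y (cong (i ∷_) e)))
... | _ | _ | high {d'} = cong (suc i ∷_) (count⇒P-fix i d' z λ x y e →
  s≤s⁻¹ (subst₂ _≤_ (cong (_+ count (suc i) x) (is-refl i)) (trans (cong (λ k → k + count i x + suc d') (is-suc i)) (+-suc _ d'))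
    (h (suc i ∷ x) y (cong (suc i ∷_) e))))
... | _ | _ | turn = ⊥-elim (1+n≰n (subst₂ _≤_ (cong (_+ 0) (is-refl i)) (cong (λ k → k + 0 + 0) (is-suc i)) (h (suc i ∷ []) z refl)))
... | _ | _ | other a b = cong (q ∷_) (count⇒P-fix i d z λ x y e →
  subst₂ _≤_ (cong (_+ count (suc i) x) b) (cong (λ k → k + count i x + d) a) (h (q ∷ x) y (cong (q ∷_) e)))

-- If the final queue is empty, every i has been met by a later i+1. This is the condition dual to
-- the one on prefixes, with `count⇒end` as converse.
end⇒count : ∀ i x y → end i 0 (x ++ y) ≡ 0 → count i y ≤ count (suc i) y
end⇒count i x y e = begin
  count i y                    ≤⟨ count-P-≤ i 0 y ⟩
  count i (P i 0 y)            ≡⟨ +-identityʳ _ ⟨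
  count i (P i 0 y) + 0        ≡⟨ balance i 0 y ⟩
  end i 0 y + count (suc i) y  ≡⟨ cong (_+ count (suc i) y) eq ⟩
  count (suc i) y              ∎
  where
  open ≤-Reasoning
  eq : end i 0 y ≡ 0
  eq = n≤0⇒n≡0 (≤-trans (end-mono i y z≤n) (≤-reflexive (trans (sym (end-++ i 0 x y)) e)))

count⇒end : ∀ i d z → d + count i z ≤ count (suc i) z →
  (∀ x y → z ≡ x ++ y → count i y ≤ count (suc i) y) → end i d z ≡ 0
count⇒end i d [] f h = n≤0⇒n≡0 (m+n≤o⇒m≤o d f)
count⇒end i d (q ∷ z) f h with out i d q | nxt i d q | view i d q
... | _ | _ | low = count⇒end i (suc d) z
  (subst₂ _≤_ (trans (cong (λ k → d + (k + count i z)) (is-refl i)) (+-suc d _)) (cong (_+ count (suc i) z) (is-pred i)) f)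
  (λ x y e → h (i ∷ x) y (cong (i ∷_) e))
... | _ | _ | high {d'} = count⇒end i d' z
  (s≤s⁻¹ (subst₂ _≤_ (cong (λ k → suc d' + (k + count i z)) (is-suc i)) (cong (_+ count (suc i) z) (is-refl i)) f))
  (λ x y e → h (suc i ∷ x) y (cong (suc i ∷_) e))
... | _ | _ | turn = count⇒end i 0 z (h (suc i ∷ []) z refl)
  (λ x y e → h (suc i ∷ x) y (cong (suc i ∷_) e))
... | _ | _ | other a b = count⇒end i d z
  (subst₂ _≤_ (cong (λ k → d + (k + count i z)) a) (cong (_+ count (suc i) z) b) f)
  (λ x y e → h (q ∷ x) y (cong (q ∷_) e))

-- Crystal edges

-- The raised letter is the last unmatched i+1: `A` leaves no i waiting, and `B` has no unmatched
-- i+1. With one condition on each side the definition is self-dual under reverse complement.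
data Edge (i : ℕ) : Word → Word → Set where
  edge : ∀ A {B} → end i 0 A ≡ 0 → P i 0 B ≡ B → Edge i (A ++ suc i ∷ B) (A ++ i ∷ B)

Steps : ℕ → Word → Word → Set
Steps n = Star (λ x y → ∃[ i ] i < n × Edge i x y)

-- From the empty queue left by `A`, a turned letter keeps the queue empty and a genuine i makes it
-- 1. As `B` has no unmatched i+1 even for the empty queue, it comes out unchanged both times.
P-edge : ∀ {i x y} → Edge i x y → P i 0 x ≡ P i 0 y
P-edge {i} (edge A {B} e p) = begin
  P i 0 (A ++ suc i ∷ B)                                                  ≡⟨ P-++ i 0 A _ ⟩
  P i 0 A ++ P i (end i 0 A) (suc i ∷ B)                                  ≡⟨ cong (λ d → P i 0 A ++ P i d (suc i ∷ B)) e ⟩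
  P i 0 A ++ out i 0 (suc i) ∷ P i (nxt i 0 (suc i)) B                    ≡⟨ cong₂ (λ o d → P i 0 A ++ o ∷ P i d B) (proj₁ (view-≡ {i} turn)) (proj₂ (view-≡ {i} turn)) ⟩
  P i 0 A ++ i ∷ P i 0 B                                                  ≡⟨ cong (λ z → P i 0 A ++ i ∷ z) (trans p (sym (P-fix-mono i B z≤n p))) ⟩
  P i 0 A ++ i ∷ P i 1 B                                                  ≡⟨ cong₂ (λ o d → P i 0 A ++ o ∷ P i d B) (proj₁ (view-≡ {i} {d = 0} low)) (proj₂ (view-≡ {i} {d = 0} low)) ⟨
  P i 0 A ++ P i 0 (i ∷ B)                                                ≡⟨ cong (λ d → P i 0 A ++ P i d (i ∷ B)) e ⟨
  P i 0 A ++ P i (end i 0 A) (i ∷ B)                                      ≡⟨ P-++ i 0 A _ ⟨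
  P i 0 (A ++ i ∷ B)                                                      ∎
  where open ≡-Reasoning

E-edge : ∀ {n i x y} → i < n → Edge i x y → E n x ≡ E n y
E-edge {n} i<n r = trans (sym (E-P i<n _)) (trans (cong (E n) (P-edge r)) (E-P i<n _))

E-steps : ∀ {n x y} → Steps n x y → E n x ≡ E n y
E-steps ε                     = refl
E-steps ((i , i<n , r) ◅ rs) = trans (E-edge i<n r) (E-steps rs)

-- An edge tolerates no unmatched i+1 to its right, so the letters must be turned from right to
-- left: the tail is treated first and the present letter last.
steps-P′ : ∀ {n i} → i < n → ∀ A d x → end i 0 A ≡ d → Steps n (A ++ x) (A ++ P i d x)
steps-P′ i<n A d [] e = ε
steps-P′ {n} {i} i<n A d (q ∷ x) e = subst (λ z → Steps n z (A ++ P i d (q ∷ x))) (++-assoc A [ q ] x) (go (view i d q))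
  where
  end-snoc : end i 0 (A ++ [ q ]) ≡ nxt i d q
  end-snoc = trans (end-++ i 0 A [ q ]) (cong (λ d → nxt i d q) e)
  ih : Steps n ((A ++ [ q ]) ++ x) ((A ++ [ q ]) ++ P i (nxt i d q) x)
  ih = steps-P′ i<n (A ++ [ q ]) (nxt i d q) x end-snoc
  ih′ : Steps n ((A ++ [ q ]) ++ x) (A ++ q ∷ P i (nxt i d q) x)
  ih′ = subst (Steps n _) (++-assoc A [ q ] _) ih
  go : ∀ {o d'} → View i d q o d' → Steps n ((A ++ [ q ]) ++ x) (A ++ out i d q ∷ P i (nxt i d q) x)
  go v with view-≡ v
  go low         | o≡ , _ = subst (λ o → Steps n ((A ++ [ q ]) ++ x) (A ++ o ∷ P i (nxt i d q) x)) (sym o≡) ih′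
  go high        | o≡ , _ = subst (λ o → Steps n ((A ++ [ q ]) ++ x) (A ++ o ∷ P i (nxt i d q) x)) (sym o≡) ih′
  go (other a b) | o≡ , _ = subst (λ o → Steps n ((A ++ [ q ]) ++ x) (A ++ o ∷ P i (nxt i d q) x)) (sym o≡) ih′
  go turn        | o≡ , d≡ = subst (λ o → Steps n ((A ++ [ q ]) ++ x) (A ++ o ∷ P i (nxt i d q) x)) (sym o≡)
    (ih′ ◅◅ (i , i<n , edge A e (P-idem i x (≤-reflexive d≡))) ◅ ε)

steps-P : ∀ {n i} → i < n → ∀ x → Steps n x (P i 0 x)
steps-P i<n x = steps-P′ i<n [] 0 x refl

steps-C : ∀ {n} m → m ≤ n → ∀ x → Steps n x (C m x)
steps-C zero    m≤n x = ε
steps-C (suc m) m≤n x = steps-C m (≤-trans (n≤1+n m) m≤n) x ◅◅ steps-P m≤n (C m x)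

steps-E′ : ∀ {n} m → m ≤ n → ∀ x → Steps n x (E m x)
steps-E′ zero    m≤n x = ε
steps-E′ (suc m) m≤n x = steps-C (suc m) m≤n x ◅◅ steps-E′ m (≤-trans (n≤1+n m) m≤n) (C (suc m) x)

steps-E : ∀ n x → Steps n x (E n x)
steps-E n = steps-E′ n ≤-refl

Highest : ℕ → Word → Set
Highest n x = ∀ {i} → i < n → P i 0 x ≡ x

E-highest : ∀ n x → Highest n (E n x)
E-highest n x i<n = P-E i<n x

C-fix : ∀ n {x} → Highest n x → C n x ≡ x
C-fix zero    h = refl
C-fix (suc n) h = trans (cong (P n 0) (C-fix n λ i<n → h (<-trans i<n (n<1+n n)))) (h (n<1+n n))

E-fix : ∀ n {x} → Highest n x → E n x ≡ x
E-fix zero    h = refl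
E-fix (suc n) h = trans (cong (E n) (C-fix (suc n) h)) (E-fix n λ i<n → h (<-trans i<n (n<1+n n)))

-- Shortening `A` from the left can only shorten its final queue, which is already empty; once the
-- cut passes the changed letter the two words coincide.
edge-drop : ∀ {i x y} j → Edge i x y → drop j x ≡ drop j y ⊎ Edge i (drop j x) (drop j y)
edge-drop zero    r                    = inj₂ r
edge-drop (suc j) (edge [] e p)        = inj₁ refl
edge-drop {i} (suc j) (edge (a ∷ A) e p) = edge-drop j
  (edge A (n≤0⇒n≡0 (≤-trans (end-mono i A z≤n) (≤-reflexive e))) p)

E-drop : ∀ n j {x y} → Steps n x y → E n (drop j x) ≡ E n (drop j y)
E-drop n j ε = refl
E-drop n j ((i , i<n , r) ◅ rs) with edge-drop j r
... | inj₁ e  = trans (cong (E n) e) (E-drop n j rs)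
... | inj₂ r′ = trans (E-edge i<n r′) (E-drop n j rs)

E-drop-E : ∀ n j x → E n (drop j (E n x)) ≡ E n (drop j x)
E-drop-E n j x = sym (E-drop n j (steps-E n x))

-- The operators act from left to right and only decrease letters

length-C : ∀ n x → length (C n x) ≡ length x
length-C zero    x = refl
length-C (suc n) x = trans (length-P n 0 (C n x)) (length-C n x)

length-E : ∀ n x → length (E n x) ≡ length x
length-E zero    x = refl
length-E (suc n) x = trans (length-E n (C (suc n) x)) (length-C (suc n) x)

take-P : ∀ i d j x → take j (P i d x) ≡ P i d (take j x)
take-P i d zero    x       = refl
take-P i d (suc j) []      = refl
take-P i d (suc j) (q ∷ x) = cong (out i d q ∷_) (take-P i (nxt i d q) j x)

take-C : ∀ n j x → take j (C n x) ≡ C n (take j x)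
take-C zero    j x = refl
take-C (suc n) j x = trans (take-P n 0 j (C n x)) (cong (P n 0) (take-C n j x))

take-E : ∀ n j x → take j (E n x) ≡ E n (take j x)
take-E zero    j x = refl
take-E (suc n) j x = trans (take-E n j (C (suc n) x)) (cong (E n) (take-C (suc n) j x))

_⊑_ : Word → Word → Set
_⊑_ = Pointwise _≤_

⊑-refl : ∀ {x} → x ⊑ x
⊑-refl = Pw.refl ≤-refl

⊑-trans : ∀ {x y z} → x ⊑ y → y ⊑ z → x ⊑ z
⊑-trans = Pw.transitive ≤-trans

P-⊑ : ∀ i d x → P i d x ⊑ x
P-⊑ i d [] = []
P-⊑ i d (q ∷ x) with out i d q | nxt i d q | view i d q
... | _ | d' | low       = ≤-refl ∷ P-⊑ i d' x
... | _ | d' | high      = ≤-refl ∷ P-⊑ i d' x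
... | _ | d' | turn      = n≤1+n i ∷ P-⊑ i d' x
... | _ | d' | other a b = ≤-refl ∷ P-⊑ i d' x

C-⊑ : ∀ n x → C n x ⊑ x
C-⊑ zero    x = ⊑-refl
C-⊑ (suc n) x = ⊑-trans (P-⊑ n 0 (C n x)) (C-⊑ n x)

E-⊑ : ∀ n x → E n x ⊑ x
E-⊑ zero    x = ⊑-refl
E-⊑ (suc n) x = ⊑-trans (E-⊑ n (C (suc n) x)) (C-⊑ (suc n) x)

⊑-++ : ∀ x {x' y y'} → length x ≡ length x' → (x ++ y) ⊑ (x' ++ y') → x ⊑ x' × y ⊑ y'
⊑-++ []      {[]}     l e       = [] , e
⊑-++ (q ∷ x) {_ ∷ x'} l (a ∷ e) = let c , d = ⊑-++ x (suc-injective l) e in a ∷ c , d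

⊑-antisym : ∀ {x y} → x ⊑ y → y ⊑ x → x ≡ y
⊑-antisym []      []        = refl
⊑-antisym (a ∷ p) (b ∷ p') = cong₂ _∷_ (≤-antisym a b) (⊑-antisym p p')

⊑-sum : ∀ {x y} → x ⊑ y → sum x ≤ sum y
⊑-sum []      = z≤n
⊑-sum (a ∷ p) = +-mono-≤ a (⊑-sum p)

⊑-sum-≡ : ∀ {x y} → x ⊑ y → sum x ≡ sum y → x ≡ y
⊑-sum-≡ [] e = refl
⊑-sum-≡ {q ∷ x} {q' ∷ y} (a ∷ p) e = cong₂ _∷_ q≡ (⊑-sum-≡ p (+-cancelˡ-≡ q _ _ (trans e (cong (_+ sum y) (sym q≡)))))
  where
  q≡ : q ≡ q'
  q≡ = ≤-antisym a (+-cancelʳ-≤ (sum y) q' q (≤-trans (≤-reflexive (sym e)) (+-monoʳ-≤ q (⊑-sum p))))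

take-length-++ : ∀ (x : Word) {y} → take (length x) (x ++ y) ≡ x
take-length-++ []      = refl
take-length-++ (q ∷ x) = cong (q ∷_) (take-length-++ x)

drop-length-++ : ∀ (x : Word) {y} → drop (length x) (x ++ y) ≡ y
drop-length-++ []      = refl
drop-length-++ (q ∷ x) = drop-length-++ x

E-++ : ∀ n x y → ∃[ z ] E n (x ++ y) ≡ E n x ++ z × z ⊑ y
E-++ n x y = drop (length x) (E n (x ++ y)) , eq , proj₂ (⊑-++ (E n x) (length-E n x) (subst (_⊑ (x ++ y)) eq (E-⊑ n (x ++ y))))
  where
  open ≡-Reasoning
  t = drop (length x) (E n (x ++ y))
  eq : E n (x ++ y) ≡ E n x ++ drop (length x) (E n (x ++ y))
  eq = begin
    E n (x ++ y)                                                            ≡⟨ take++drop≡id (length x) _ ⟨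
    take (length x) (E n (x ++ y)) ++ drop (length x) (E n (x ++ y))        ≡⟨ cong (_++ t) (take-E n (length x) (x ++ y)) ⟩
    E n (take (length x) (x ++ y)) ++ drop (length x) (E n (x ++ y))        ≡⟨ cong (λ z → E n z ++ t) (take-length-++ x) ⟩
    E n x ++ drop (length x) (E n (x ++ y))                                 ∎

⊑-bound : ∀ {n x y} → x ⊑ y → All (_≤ n) y → All (_≤ n) x
⊑-bound []      []       = []
⊑-bound (a ∷ p) (b ∷ bs) = ≤-trans a b ∷ ⊑-bound p bs

E-bound : ∀ n {x} → All (_≤ n) x → All (_≤ n) (E n x)
E-bound n = ⊑-bound (E-⊑ n _)

-- Reverse complement

star : ℕ → Word → Word
star n x = reverse (map (n ∸_) x)

star-++ : ∀ n x y → star n (x ++ y) ≡ star n y ++ star n x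
star-++ n x y = trans (cong reverse (map-++ (n ∸_) x y)) (reverse-++ (map (n ∸_) x) (map (n ∸_) y))

star-∷ : ∀ n q x → star n (q ∷ x) ≡ star n x ++ [ n ∸ q ]
star-∷ n q x = unfold-reverse (n ∸ q) (map (n ∸_) x)

length-star : ∀ n x → length (star n x) ≡ length x
length-star n x = trans (length-reverse (map (n ∸_) x)) (length-map (n ∸_) x)

star-bound : ∀ n x → All (_≤ n) (star n x)
star-bound n [] = []
star-bound n (q ∷ x) rewrite star-∷ n q x = All.++⁺ (star-bound n x) (m∸n≤m n q ∷ [])

star-involutive : ∀ n {x} → All (_≤ n) x → star n (star n x) ≡ x
star-involutive n [] = refl
star-involutive n {q ∷ x} (b ∷ bs) = begin
  star n (star n (q ∷ x))             ≡⟨ cong (star n) (star-∷ n q x) ⟩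
  star n (star n x ++ [ n ∸ q ])      ≡⟨ star-++ n (star n x) [ n ∸ q ] ⟩
  (n ∸ (n ∸ q)) ∷ star n (star n x)   ≡⟨ cong₂ _∷_ (m∸[m∸n]≡n b) (star-involutive n bs) ⟩
  q ∷ x                               ∎
  where open ≡-Reasoning

is-∸ : ∀ n {j q} → j ≤ n → q ≤ n → is j (n ∸ q) ≡ is (n ∸ j) q
is-∸ n {j} {q} j≤n q≤n with j ≟ n ∸ q
... | yes refl = trans (is-refl j) (sym (trans (cong (λ k → is k q) (m∸[m∸n]≡n q≤n)) (is-refl q)))
... | no j≢ = trans (is-≢ j≢) (sym (is-≢ {n ∸ j} {q} λ e → j≢ (trans (sym (m∸[m∸n]≡n j≤n)) (cong (n ∸_) e))))

count-star : ∀ n {j x} → j ≤ n → All (_≤ n) x → count j (star n x) ≡ count (n ∸ j) x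
count-star n j≤n [] = refl
count-star n {j} {q ∷ x} j≤n (b ∷ bs) = begin
  count j (star n (q ∷ x))                  ≡⟨ cong (count j) (star-∷ n q x) ⟩
  count j (star n x ++ [ n ∸ q ])           ≡⟨ count-++ j (star n x) _ ⟩
  count j (star n x) + (is j (n ∸ q) + 0)   ≡⟨ cong₂ _+_ (count-star n j≤n bs) (trans (+-identityʳ _) (is-∸ n {j} {q} j≤n b)) ⟩
  count (n ∸ j) x + is (n ∸ j) q            ≡⟨ +-comm (count (n ∸ j) x) _ ⟩
  is (n ∸ j) q + count (n ∸ j) x            ∎
  where open ≡-Reasoning

star-split : ∀ n {x} → All (_≤ n) x → ∀ y z → star n x ≡ y ++ z → x ≡ star n z ++ star n y
star-split n bs y z e = trans (sym (star-involutive n bs)) (trans (cong (star n) e) (star-++ n y z))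

suc-∸-suc : ∀ {i n} → i < n → suc (n ∸ suc i) ≡ n ∸ i
suc-∸-suc i<n = sym (+-∸-assoc 1 i<n)

∸suc< : ∀ {i n} → i < n → n ∸ suc i < n
∸suc< {i} {n} i<n = ≤-trans (≤-reflexive (suc-∸-suc i<n)) (m∸n≤m n i)

count-star-i : ∀ {n i z} → i < n → All (_≤ n) z → let k = n ∸ suc i in
  count k (star n z) ≡ count (suc i) z × count (suc k) (star n z) ≡ count i z
count-star-i {n} {i} {z} i<n b =
  trans (count-star n (<⇒≤ (∸suc< i<n)) b) (cong (λ j → count j z) (m∸[m∸n]≡n i<n)) ,
  trans (count-star n (∸suc< i<n) b) (cong (λ j → count j z) (trans (cong (n ∸_) (suc-∸-suc i<n)) (m∸[m∸n]≡n (<⇒≤ i<n))))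

-- `star` exchanges prefixes with suffixes and the rows i, i+1 with k+1, k, so the prefix criterion
-- for `B` is the suffix criterion for its image.
end-star : ∀ {n i B} → i < n → All (_≤ n) B → P i 0 B ≡ B → end (n ∸ suc i) 0 (star n B) ≡ 0
end-star {n} {i} {B} i<n bB p = count⇒end k 0 (star n B) (low≤ [] (star n B) refl) low≤
  where
  k = n ∸ suc i
  low≤ : ∀ y z → star n B ≡ y ++ z → count k z ≤ count (suc k) z
  low≤ y z eq = subst₂ _≤_ (trans (sym (proj₁ cnt)) (cong (count k) zz)) (trans (trans (+-identityʳ _) (sym (proj₂ cnt))) (cong (count (suc k)) zz))
                (P-fix⇒count i 0 (star n z) (star n y) (trans (cong (P i 0) (sym B≡)) (trans p B≡)))
    where
    B≡ = star-split n bB y z eq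
    cnt = count-star-i i<n (star-bound n z)
    zz : star n (star n z) ≡ z
    zz = star-involutive n (All.++⁻ʳ y (subst (All (_≤ n)) eq (star-bound n B)))

fix-star : ∀ {n i A} → i < n → All (_≤ n) A → end i 0 A ≡ 0 → P (n ∸ suc i) 0 (star n A) ≡ star n A
fix-star {n} {i} {A} i<n bA e = count⇒P-fix k 0 (star n A) λ y z eq →
  let A≡ = star-split n bA y z eq
      cnt = count-star-i i<n (star-bound n y)
      yy = star-involutive n (All.++⁻ˡ y (subst (All (_≤ n)) eq (star-bound n A)))
  in subst₂ _≤_ (trans (sym (proj₂ cnt)) (cong (count (suc k)) yy)) (trans (trans (sym (proj₁ cnt)) (cong (count k) yy)) (sym (+-identityʳ _)))
     (end⇒count i (star n z) (star n y) (trans (cong (end i 0) (sym A≡)) e))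
  where k = n ∸ suc i

-- Complementing makes the decreased letter an increased one, so source and target change places;
-- this is harmless because `E` is constant along edges in both directions.
edge-star : ∀ {n i x y} → i < n → All (_≤ n) x → Edge i x y → Edge (n ∸ suc i) (star n y) (star n x)
edge-star {n} {i} i<n bs (edge A {B} e p) = subst₂ (Edge k) (sym y≡) (sym x≡)
  (edge (star n B) (end-star i<n (All.tail (All.++⁻ʳ A bs)) p) (fix-star i<n (All.++⁻ˡ A bs) e))
  where
  k = n ∸ suc i
  x≡ : star n (A ++ suc i ∷ B) ≡ star n B ++ k ∷ star n A
  x≡ = trans (star-++ n A (suc i ∷ B)) (trans (cong (_++ star n A) (star-∷ n (suc i) B)) (++-assoc (star n B) _ _))
  y≡ : star n (A ++ i ∷ B) ≡ star n B ++ suc k ∷ star n A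
  y≡ = trans (star-++ n A (i ∷ B)) (trans (cong (_++ star n A) (trans (star-∷ n i B) (cong (λ z → star n B ++ [ z ]) (sym (suc-∸-suc i<n))))) (++-assoc (star n B) _ _))

edge-bound : ∀ {n i x y} → i < n → All (_≤ n) x → Edge i x y → All (_≤ n) y
edge-bound i<n bs (edge A e p) = All.++⁺ (All.++⁻ˡ A bs) (<⇒≤ i<n ∷ All.tail (All.++⁻ʳ A bs))

E-star-steps : ∀ {n x y} → All (_≤ n) x → Steps n x y → E n (star n y) ≡ E n (star n x)
E-star-steps bs ε = refl
E-star-steps {n} bs ((i , i<n , r) ◅ rs) =
  trans (E-star-steps (edge-bound i<n bs r) rs) (E-edge (∸suc< i<n) (edge-star i<n bs r))

E-star-E : ∀ n {x} → All (_≤ n) x → E n (star n (E n x)) ≡ E n (star n x)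
E-star-E n {x} bs = E-star-steps bs (steps-E n x)

-- Lowest weight words

Lowest : ℕ → Word → Set
Lowest n y = ∀ {i} → i < n → end i 0 y ≡ 0

-- The only change `P i` makes is from i+1, a letter that lengthens queue i+1, to i, a letter that
-- this queue ignores.
nxt-out-≤ : ∀ i q {d e f} → d ≤ e → nxt (suc i) d (out i f q) ≤ nxt (suc i) e q
nxt-out-≤ zero    zero          d≤e = d≤e
nxt-out-≤ zero    (suc zero) {f = zero}  d≤e = m≤n⇒m≤1+n d≤e
nxt-out-≤ zero    (suc zero) {f = suc f} d≤e = s≤s d≤e
nxt-out-≤ zero    (suc (suc q)) d≤e = nxt-mono 1 (suc (suc q)) d≤e
nxt-out-≤ (suc i) zero          d≤e = d≤e
nxt-out-≤ (suc i) (suc q)       d≤e = nxt-out-≤ i q d≤e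

end-P-≤ : ∀ i x {d e f} → d ≤ e → end (suc i) d (P i f x) ≤ end (suc i) e x
end-P-≤ i []      d≤e = d≤e
end-P-≤ i (q ∷ x) d≤e = end-P-≤ i x (nxt-out-≤ i q d≤e)

end-C-far : ∀ m {j} → m < j → ∀ d x → end j d (C m x) ≡ end j d x
end-C-far zero    m<j d x = refl
end-C-far (suc m) m<j d x = trans (proj₂ (end-far m<j 0 d (C m x))) (end-C-far m (<-trans (n<1+n m) m<j) d x)

end-C-tail : ∀ {i} m → suc (suc i) ≤ m → ∀ d x → end i d (C m x) ≡ end i d (C (suc (suc i)) x)
end-C-tail (suc m) i≤m d x with m≤n⇒m<n∨m≡n (s≤s⁻¹ i≤m)
... | inj₁ i<m  = trans (proj₁ (end-far i<m d 0 (C m x))) (end-C-tail m i<m d x)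
... | inj₂ refl = refl

lowest-stage : ∀ {n y} → Lowest n y → ∀ i → i < n → end i 0 (C i y) ≡ 0
lowest-stage l zero    i<n = l i<n
lowest-stage {y = y} l (suc i) i<n = n≤0⇒n≡0
  (≤-trans (end-P-≤ i (C i y) z≤n) (≤-reflexive (trans (end-C-far i (n<1+n i) 0 y) (l i<n))))

braid-zero : ∀ {a b c a' b' c'} → Braid a b c a' b' c' → a ≡ 0 → b ≡ 0 → a' ≡ 0 → c ≡ 0
braid-zero (up e refl a'≡ _ _) refl refl refl = sym a'≡
braid-zero {c = c} (down e a≡ _ _ _) refl _ _ = m+n≡0⇒m≡0 c (sym a≡)

-- Operators beyond `P (suc i)` do not touch the letters i and i+1, so the queue in question is the
-- third one on the left of the braid relation started at `C i y`. The first two queues there and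
-- the first one on the right end empty, and then so does the third.
lowest-C : ∀ {n y} → Lowest (suc n) y → Lowest n (C (suc n) y)
lowest-C {n} {y} l {i} i<n = trans (end-C-tail (suc n) (s≤s i<n) 0 y)
  (braid-zero (proj₂ (braid i (C i y) (up 0 refl refl refl refl)))
    (lowest-stage l i (m<n⇒m<1+n i<n)) (lowest-stage l (suc i) (s≤s i<n))
    (trans (end-C-far i (n<1+n i) 0 y) (l (s≤s i<n))))

count-P-swap : ∀ i x → end i 0 x ≡ 0 → count i (P i 0 x) ≡ count (suc i) x × count (suc i) (P i 0 x) ≡ count i x
count-P-swap i x e = a , +-cancelˡ-≡ (count (suc i) x) _ _
  (trans (cong (_+ count (suc i) (P i 0 x)) (sym a)) (trans (count-P-+ i 0 x) (+-comm (count i x) _)))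
  where
  a : count i (P i 0 x) ≡ count (suc i) x
  a = trans (sym (+-identityʳ _)) (trans (balance i 0 x) (cong (_+ count (suc i) x) e))

count-C : ∀ {n y} → Lowest n y → ∀ m → m ≤ n →
  (∀ j → j < m → count j (C m y) ≡ count (suc j) y) × (count m (C m y) ≡ count 0 y) × (∀ j → m < j → count j (C m y) ≡ count j y)
count-C l zero m≤n = (λ _ ()) , refl , λ _ _ → refl
count-C {y = y} l (suc m) m<n with count-C l m (<⇒≤ m<n)
... | below , at , above = below′ , trans (proj₂ sw) at ,
  λ j m<j → trans (count-P-other (>⇒≢ (<-trans (n<1+n m) m<j)) (>⇒≢ m<j) 0 (C m y)) (above j (<-trans (n<1+n m) m<j))
  where
  sw = count-P-swap m (C m y) (lowest-stage l m m<n)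
  below′ : ∀ j → j < suc m → count j (C (suc m) y) ≡ count (suc j) y
  below′ j j≤m with m≤n⇒m<n∨m≡n (s≤s⁻¹ j≤m)
  ... | inj₁ j<m  = trans (count-P-other (<⇒≢ j<m) (<⇒≢ (m<n⇒m<1+n j<m)) 0 (C m y)) (below j j<m)
  ... | inj₂ refl = trans (proj₁ sw) (above (suc m) (n<1+n m))

count-C-other : ∀ n {j} → n < j → ∀ x → count j (C n x) ≡ count j x
count-C-other zero    n<j x = refl
count-C-other (suc n) n<j x = trans (count-P-other (>⇒≢ (<-trans (n<1+n n) n<j)) (>⇒≢ n<j) 0 (C n x)) (count-C-other n (<-trans (n<1+n n) n<j) x)

count-E-other : ∀ n {j} → n < j → ∀ x → count j (E n x) ≡ count j x
count-E-other zero    n<j x = refl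
count-E-other (suc n) n<j x = trans (count-E-other n (<-trans (n<1+n n) n<j) (C (suc n) x)) (count-C-other (suc n) n<j x)

-- On a lowest weight word all queues of E end empty, so each P acts on the
-- letter counts as an adjacent transposition.
count-E-lowest : ∀ n {y j} → Lowest n y → j ≤ n → count j (E n y) ≡ count (n ∸ j) y
count-E-lowest zero    l z≤n = refl
count-E-lowest (suc n) {y} {j} l j≤n with m≤n⇒m<n∨m≡n j≤n
... | inj₂ refl = trans (count-E-other n (n<1+n n) (C (suc n) y))
  (trans (proj₁ (proj₂ (count-C l (suc n) ≤-refl))) (cong (λ k → count k y) (sym (n∸n≡0 n))))
... | inj₁ (s≤s j≤n′) = trans (count-E-lowest n (lowest-C l) j≤n′)
  (trans (proj₁ (count-C l (suc n) ≤-refl) (n ∸ j) (s≤s (m∸n≤m n j))) (cong (λ k → count k y) (sym (+-∸-assoc 1 j≤n′))))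

star-lowest : ∀ n {x} → All (_≤ n) x → Highest n x → Lowest n (star n x)
star-lowest n {x} bs h {i} i<n = subst (λ k → end k 0 (star n x) ≡ 0)
  (trans (cong (n ∸_) (suc-∸-suc i<n)) (m∸[m∸n]≡n (<⇒≤ i<n))) (end-star (∸suc< i<n) bs (h (∸suc< i<n)))

-- The star of h is the lowest weight word belonging to `E n x`. Applying `star` to h reverses the
-- counts, and `E` on a lowest weight word reverses them back.
count-E-star : ∀ n {x j} → All (_≤ n) x → j ≤ n → count j (E n (star n x)) ≡ count j (E n x)
count-E-star n {x} {j} bs j≤n = sym (begin
  count j (E n x)                          ≡⟨ cong (λ z → count j (E n z)) (star-involutive n bs) ⟨
  count j (E n (star n (star n x)))        ≡⟨ cong (count j) (E-star-E n (star-bound n x)) ⟨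
  count j (E n (star n h))                 ≡⟨ count-E-lowest n (star-lowest n bh (E-highest n (star n x))) j≤n ⟩
  count (n ∸ j) (star n h)                 ≡⟨ count-star n (m∸n≤m n j) bh ⟩
  count (n ∸ (n ∸ j)) h                    ≡⟨ cong (λ k → count k h) (m∸[m∸n]≡n j≤n) ⟩
  count j h                                ∎)
  where
  open ≡-Reasoning
  h = E n (star n x)
  bh = E-bound n (star-bound n x)

-- Stabilization

_^^_ : Word → ℕ → Word
w ^^ zero  = []
w ^^ suc j = w ++ w ^^ j

^^-+ : ∀ w i j → w ^^ (i + j) ≡ w ^^ i ++ w ^^ j
^^-+ w zero    j = refl
^^-+ w (suc i) j = trans (cong (w ++_) (^^-+ w i j)) (sym (++-assoc w (w ^^ i) (w ^^ j)))

^^-snoc : ∀ w j → w ^^ suc j ≡ w ^^ j ++ w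
^^-snoc w j = trans (cong (w ^^_) (sym (+-comm j 1))) (trans (^^-+ w j 1) (cong (w ^^ j ++_) (++-identityʳ w)))

^^-bound : ∀ {n w} j → All (_≤ n) w → All (_≤ n) (w ^^ j)
^^-bound zero    b = []
^^-bound (suc j) b = All.++⁺ b (^^-bound j b)

star-^^ : ∀ n w j → star n (w ^^ j) ≡ star n w ^^ j
star-^^ n w zero    = refl
star-^^ n w (suc j) = trans (star-++ n w (w ^^ j)) (trans (cong (_++ star n w) (star-^^ n w j)) (sym (^^-snoc (star n w) j)))

length-^^ : ∀ w j → length (w ^^ j) ≡ j * length w
length-^^ w zero    = refl
length-^^ w (suc j) = trans (length-++ w) (cong (length w +_) (length-^^ w j))

count-^^ : ∀ i w j → count i (w ^^ j) ≡ j * count i w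
count-^^ i w zero    = refl
count-^^ i w (suc j) = trans (count-++ i w (w ^^ j)) (cong (count i w +_) (count-^^ i w j))

drop-++ˡ : ∀ m (x : Word) {y} → m ≤ length x → drop m (x ++ y) ≡ drop m x ++ y
drop-++ˡ zero    x       m≤ = refl
drop-++ˡ (suc m) (q ∷ x) m≤ = drop-++ˡ m x (s≤s⁻¹ m≤)

-- Operators only decrease letters, so the last block is bounded above by its
-- input w and below by the outcome of rectifying once more without s.
sandwich : ∀ n s {y w} → E n (y ++ w) ≡ E n y ++ w → E n (s ++ y ++ w) ≡ E n (s ++ y) ++ w
sandwich n s {y} {w} h with E-++ n (s ++ y) w
... | z , e , z⊑w = trans (cong (E n) (sym (++-assoc s y w))) (trans e (cong (E n (s ++ y) ++_) (⊑-antisym z⊑w w⊑z)))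
  where
  open ≡-Reasoning
  m = length s
  len : length s ≤ length (E n (s ++ y))
  len = ≤-trans (m≤m+n m (length y)) (≤-reflexive (sym (trans (length-E n (s ++ y)) (length-++ s))))
  eq : E n (drop m (E n (s ++ y)) ++ z) ≡ E n y ++ w
  eq = begin
    E n (drop m (E n (s ++ y)) ++ z)      ≡⟨ cong (E n) (drop-++ˡ m (E n (s ++ y)) len) ⟨
    E n (drop m (E n (s ++ y) ++ z))      ≡⟨ cong (λ v → E n (drop m v)) e ⟨
    E n (drop m (E n ((s ++ y) ++ w)))    ≡⟨ E-drop-E n m ((s ++ y) ++ w) ⟩
    E n (drop m ((s ++ y) ++ w))          ≡⟨ cong (λ v → E n (drop m v)) (++-assoc s y w) ⟩
    E n (drop m (s ++ y ++ w))            ≡⟨ cong (E n) (drop-length-++ s) ⟩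
    E n (y ++ w)                          ≡⟨ h ⟩
    E n y ++ w                            ∎
  len′ : length (E n y) ≡ length (drop m (E n (s ++ y)))
  len′ = begin
    length (E n y)                        ≡⟨ length-E n y ⟩
    length y                              ≡⟨ cong length (drop-length-++ s) ⟨
    length (drop m (s ++ y))              ≡⟨ length-drop m (s ++ y) ⟩
    length (s ++ y) ∸ m                   ≡⟨ cong (_∸ m) (length-E n (s ++ y)) ⟨
    length (E n (s ++ y)) ∸ m             ≡⟨ length-drop m (E n (s ++ y)) ⟨
    length (drop m (E n (s ++ y)))        ∎
  w⊑z : w ⊑ z
  w⊑z = proj₂ (⊑-++ (E n y) len′ (subst (_⊑ (drop m (E n (s ++ y)) ++ z)) eq (E-⊑ n (drop m (E n (s ++ y)) ++ z))))

-- The last of j + 1 copies of w keeps its rows, so for row words of skew tableaux this is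
-- stabilization at j + 1.
Stable : ℕ → Word → ℕ → Set
Stable n w j = E n (w ^^ j ++ w) ≡ E n (w ^^ j) ++ w

stable-+ : ∀ n w j i → Stable n w j → Stable n w (i + j)
stable-+ n w j zero    h = h
stable-+ n w j (suc i) h = trans (cong (E n) (++-assoc w (w ^^ (i + j)) w)) (sandwich n w (stable-+ n w j i h))

E-stable : ∀ n w j i → Stable n w j → E n (w ^^ (j + i)) ≡ E n (w ^^ j) ++ w ^^ i
E-stable n w j zero    h = trans (cong (λ k → E n (w ^^ k)) (+-identityʳ j)) (sym (++-identityʳ _))
E-stable n w j (suc i) h = begin
  E n (w ^^ (j + suc i))            ≡⟨ cong (λ k → E n (w ^^ k)) (trans (+-suc j i) (cong suc (+-comm j i))) ⟩
  E n (w ^^ suc (i + j))            ≡⟨ cong (E n) (^^-snoc w (i + j)) ⟩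
  E n (w ^^ (i + j) ++ w)           ≡⟨ stable-+ n w j i h ⟩
  E n (w ^^ (i + j)) ++ w           ≡⟨ cong (λ k → E n (w ^^ k) ++ w) (+-comm i j) ⟩
  E n (w ^^ (j + i)) ++ w           ≡⟨ cong (_++ w) (E-stable n w j i h) ⟩
  (E n (w ^^ j) ++ w ^^ i) ++ w     ≡⟨ ++-assoc (E n (w ^^ j)) (w ^^ i) w ⟩
  E n (w ^^ j) ++ w ^^ i ++ w       ≡⟨ cong (E n (w ^^ j) ++_) (^^-snoc w i) ⟨
  E n (w ^^ j) ++ w ^^ suc i        ∎
  where open ≡-Reasoning

-- Letter sums from letter counts

weighted : ℕ → (ℕ → ℕ) → ℕ
weighted zero    c = 0
weighted (suc n) c = suc n * c (suc n) + weighted n c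

weighted-cong : ∀ n {c c'} → (∀ j → j ≤ n → c j ≡ c' j) → weighted n c ≡ weighted n c'
weighted-cong zero    h = refl
weighted-cong (suc n) h = cong₂ _+_ (cong (suc n *_) (h (suc n) ≤-refl)) (weighted-cong n λ j j≤n → h j (m≤n⇒m≤1+n j≤n))

weighted-+ : ∀ n c c' → weighted n (λ j → c j + c' j) ≡ weighted n c + weighted n c'
weighted-+ zero    c c' = refl
weighted-+ (suc n) c c' = trans (cong₂ _+_ (*-distribˡ-+ (suc n) (c (suc n)) (c' (suc n))) (weighted-+ n c c'))
  (interchange (suc n * c (suc n)) _ _ _)
  where open import Algebra.Properties.CommutativeSemigroup +-commutativeSemigroup using (interchange)

weighted-is-< : ∀ n {q} → n < q → weighted n (λ j → is j q) ≡ 0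
weighted-is-< zero    n<q = refl
weighted-is-< (suc n) n<q = cong₂ _+_ (trans (cong (suc n *_) (is-≢ (<⇒≢ n<q))) (*-zeroʳ (suc n))) (weighted-is-< n (<-trans (n<1+n n) n<q))

weighted-is : ∀ n {q} → q ≤ n → weighted n (λ j → is j q) ≡ q
weighted-is zero    z≤n = refl
weighted-is (suc n) {q} q≤n with m≤n⇒m<n∨m≡n q≤n
... | inj₁ q<n  = cong₂ _+_ (trans (cong (suc n *_) (is-≢ (>⇒≢ q<n))) (*-zeroʳ (suc n))) (weighted-is n (s≤s⁻¹ q<n))
... | inj₂ refl = trans (cong₂ _+_ (trans (cong (suc n *_) (is-refl (suc n))) (*-identityʳ (suc n))) (weighted-is-< n (n<1+n n))) (+-identityʳ (suc n))

sum-weighted : ∀ n {x} → All (_≤ n) x → sum x ≡ weighted n (λ j → count j x)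
sum-weighted n [] = sym (zeros n)
  where
  zeros : ∀ n → weighted n (λ j → 0) ≡ 0
  zeros zero    = refl
  zeros (suc n) = cong₂ _+_ (*-zeroʳ (suc n)) (zeros n)
sum-weighted n {q ∷ x} (b ∷ bs) = trans (cong₂ _+_ (sym (weighted-is n b)) (sum-weighted n bs)) (sym (weighted-+ n _ _))

-- Equal counts force equal letter sums, and a pointwise decrease that keeps the sum is none.
⊑-count-≡ : ∀ {n x y} → All (_≤ n) y → x ⊑ y → (∀ j → j ≤ n → count j x ≡ count j y) → x ≡ y
⊑-count-≡ {n} by p h = ⊑-sum-≡ p
  (trans (sum-weighted n (⊑-bound p by)) (trans (weighted-cong n h) (sym (sum-weighted n by))))

-- The last block keeps its letter counts because the shapes for w and star w
-- agree, and a decrease of letters that keeps the counts is trivial.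
stable-star : ∀ n w j {r} → All (_≤ n) w → (∀ i → i ≤ n → count i w ≡ r) → Stable n w j → Stable n (star n w) j
stable-star n w j {r} bw bal h with E-++ n (star n w ^^ j) (star n w)
... | z , e , z⊑ = trans e (cong (E n (star n w ^^ j) ++_) (⊑-count-≡ (star-bound n w) z⊑ cnt))
  where
  open ≡-Reasoning
  w* = star n w
  cntE : ∀ i k → i ≤ n → count i (E n (w* ^^ k)) ≡ count i (E n (w ^^ k))
  cntE i k i≤n = trans (cong (λ v → count i (E n v)) (sym (star-^^ n w k))) (count-E-star n (^^-bound k bw) i≤n)
  cnt : ∀ i → i ≤ n → count i z ≡ count i w*
  cnt i i≤n = +-cancelˡ-≡ (count i (E n (w* ^^ j))) _ _ (begin
    count i (E n (w* ^^ j)) + count i z   ≡⟨ count-++ i (E n (w* ^^ j)) z ⟨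
    count i (E n (w* ^^ j) ++ z)          ≡⟨ cong (count i) e ⟨
    count i (E n (w* ^^ j ++ w*))         ≡⟨ cong (λ v → count i (E n v)) (^^-snoc w* j) ⟨
    count i (E n (w* ^^ suc j))           ≡⟨ cntE i (suc j) i≤n ⟩
    count i (E n (w ^^ suc j))            ≡⟨ cong (λ v → count i (E n v)) (^^-snoc w j) ⟩
    count i (E n (w ^^ j ++ w))           ≡⟨ cong (count i) h ⟩
    count i (E n (w ^^ j) ++ w)           ≡⟨ count-++ i (E n (w ^^ j)) w ⟩
    count i (E n (w ^^ j)) + count i w    ≡⟨ cong₂ _+_ (sym (cntE i j i≤n)) (trans (bal i i≤n) (sym (trans (count-star n i≤n bw) (bal (n ∸ i) (m∸n≤m n i))))) ⟩
    count i (E n (w* ^^ j)) + count i w*  ∎)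

-- Lattice paths and sliding holes

Weight : Set
Weight = ℕ → ℕ

bump : Weight → ℕ → Weight
bump h q j = h j + is j q

Dominant : ℕ → Weight → Set
Dominant n h = ∀ {i} → i < n → h (suc i) ≤ h i

Valid : ℕ → Weight → Word → Set
Valid n h x = ∀ y z → x ≡ y ++ z → Dominant n (λ j → h j + count j y)

Empty : Weight
Empty _ = 0

dominant-cong : ∀ {n g h} → (∀ j → j ≤ n → g j ≡ h j) → Dominant n g → Dominant n h
dominant-cong e d i<n = subst₂ _≤_ (e _ i<n) (e _ (<⇒≤ i<n)) (d i<n)

valid-cong : ∀ {n g h x} → (∀ j → j ≤ n → g j ≡ h j) → Valid n g x → Valid n h x
valid-cong e v y z eq = dominant-cong (λ j j≤n → cong (_+ count j y) (e j j≤n)) (v y z eq)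

valid-here : ∀ {n h x} → Valid n h x → Dominant n h
valid-here v = dominant-cong (λ j _ → +-identityʳ _) (v [] _ refl)

valid-tail : ∀ {n h q x} → Valid n h (q ∷ x) → Valid n (bump h q) x
valid-tail {h = h} {q} v y z e = dominant-cong (λ j _ → sym (+-assoc (h j) (is j q) _)) (v (q ∷ y) z (cong (q ∷_) e))

valid-∷ : ∀ {n h q x} → Dominant n h → Valid n (bump h q) x → Valid n h (q ∷ x)
valid-∷ d v []      z e = dominant-cong (λ j _ → sym (+-identityʳ _)) d
valid-∷ {h = h} {q} d v (r ∷ y) z e with ∷-injective e
... | refl , e′ = dominant-cong (λ j _ → +-assoc (h j) (is j q) _) (v y z e′)

valid-[] : ∀ {n h} → Dominant n h → Valid n h []
valid-[] d [] z e = dominant-cong (λ j _ → sym (+-identityʳ _)) d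

valid-++ : ∀ {n h} x {y} → Valid n h x → Valid n (λ j → h j + count j x) y → Valid n h (x ++ y)
valid-++ {h = h} [] v v' = valid-cong (λ j _ → +-identityʳ (h j)) v'
valid-++ {h = h} (q ∷ x) v v' = valid-∷ (valid-here v)
  (valid-++ x (valid-tail v) (valid-cong (λ j _ → sym (+-assoc (h j) (is j q) _)) v'))

valid-prefix : ∀ {n h} x {y} → Valid n h (x ++ y) → Valid n h x
valid-prefix x {y} v u z e = v u (z ++ y) (trans (cong (_++ y) e) (++-assoc u z y))

highest⇒valid : ∀ {n x} → Highest n x → Valid n Empty x
highest⇒valid {n} {x} h y z refl {i} i<n = ≤-trans (P-fix⇒count i 0 y z (h i<n)) (≤-reflexive (+-identityʳ _))

valid⇒highest : ∀ {n x} → Valid n Empty x → Highest n x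
valid⇒highest {n} {x} v {i} i<n = count⇒P-fix i 0 x λ y z e → ≤-trans (v y z e i<n) (≤-reflexive (sym (+-identityʳ _)))

-- Pass h p B B′ p′: jeu de taquin through the entries with row word B, the
-- hole entering in row p and leaving in row p′, where h is the shape to the
-- left of the hole and of B.  The hole drops to row p+1 when the rows p and
-- p+1 of that shape are equally long and the next entry lies in row p+1.
data Pass : Weight → ℕ → Word → Word → ℕ → Set where
  done : ∀ {h p} → Pass h p [] [] p
  turn : ∀ {h p B B' p'} → h (suc p) ≡ h p → Pass (bump h p) (suc p) B B' p' → Pass h p (suc p ∷ B) (p ∷ B') p'
  keep : ∀ {h p q B B' p'} → (q ≡ suc p → h (suc p) < h p) → Pass (bump h q) p B B' p' → Pass h p (q ∷ B) (q ∷ B') p'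

bump-comm : ∀ h p q j → bump (bump h p) q j ≡ bump (bump h q) p j
bump-comm h p q j = trans (+-assoc (h j) _ _) (trans (cong (h j +_) (+-comm (is j p) _)) (sym (+-assoc (h j) _ _)))

bump-at : ∀ h q → bump h q q ≡ suc (h q)
bump-at h q = trans (cong (h q +_) (is-refl q)) (+-comm (h q) 1)

bump-off : ∀ h {q j} → j ≢ q → bump h q j ≡ h j
bump-off h {q} {j} j≢q = trans (cong (h j +_) (is-≢ j≢q)) (+-identityʳ (h j))

-- A cell in row q can only violate dominance against row q-1. If that row contains the hole, the
-- side condition of `keep` gives the room; otherwise the shape with the hole's cell filled already
-- does.
dominant-keep : ∀ {n h p q} → Dominant n h → Dominant n (bump (bump h p) q) →
  (q ≡ suc p → h (suc p) < h p) → Dominant n (bump h q)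
dominant-keep {n} {h} {p} {q} d d2 k {i} i<n with q ≟ suc i
... | no q≢ = ≤-trans (≤-reflexive (bump-off h (≢-sym q≢))) (≤-trans (d i<n) (m≤m+n (h i) _))
... | yes refl with i ≟ p
...   | yes refl = subst₂ _≤_ (sym (bump-at h (suc i))) (sym (bump-off h (<⇒≢ (n<1+n i)))) (k refl)
...   | no i≢p = ≤-trans (+-monoˡ-≤ _ (m≤m+n (h (suc i)) (is (suc i) p)))
                 (≤-trans (d2 i<n) (≤-reflexive (cong (_+ is i (suc i)) (bump-off h i≢p))))

pass-exists : ∀ n {h p} B → Dominant n h → Valid n (bump h p) B → All (_≤ n) B → ∃₂ λ B' p' → Pass h p B B' p'
pass-exists n [] d v b = _ , _ , done
pass-exists n {h} {p} (q ∷ B) d v (b ∷ bs) with q ≟ suc p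
... | yes refl with h (suc p) ≟ h p
...   | yes e = let _ , _ , r = pass-exists n B (valid-here v) (valid-tail v) bs in _ , _ , turn e r
...   | no ≢ = let k = λ _ → ≤∧≢⇒< (d b) ≢
                   _ , _ , r = pass-exists n B (dominant-keep d (valid-here (valid-tail v)) k) (valid-cong (λ j _ → bump-comm h p q j) (valid-tail v)) bs
               in _ , _ , keep k r
pass-exists n {h} {p} (q ∷ B) d v (b ∷ bs) | no q≢ =
  let k = λ e → contradiction e q≢
      _ , _ , r = pass-exists n B (dominant-keep d (valid-here (valid-tail v)) k) (valid-cong (λ j _ → bump-comm h p q j) (valid-tail v)) bs
  in _ , _ , keep k r

pass-count : ∀ {h p B B' p'} → Pass h p B B' p' → ∀ j → is j p + count j B ≡ count j B' + is j p'
pass-count {p = p} done j = +-identityʳ (is j p)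
pass-count {p = p} (turn e r) j = trans (cong (is j p +_) (pass-count r j)) (sym (+-assoc (is j p) _ _))
pass-count {p = p} {p' = p'} (keep {q = q} {B = B} {B' = B'} k r) j = begin
  is j p + (is j q + count j B)    ≡⟨ x∙yz≈y∙xz (is j p) (is j q) (count j B) ⟩
  is j q + (is j p + count j B)    ≡⟨ cong (is j q +_) (pass-count r j) ⟩
  is j q + (count j B' + is j p')  ≡⟨ +-assoc (is j q) _ _ ⟨
  is j q + count j B' + is j p'    ∎
  where
  open ≡-Reasoning
  open import Algebra.Properties.CommutativeSemigroup +-commutativeSemigroup using (x∙yz≈y∙xz)

pass-length : ∀ {h p B B' p'} → Pass h p B B' p' → length B' ≡ length B
pass-length done       = refl
pass-length (turn e r) = cong suc (pass-length r)
pass-length (keep k r) = cong suc (pass-length r)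

pass-≤ : ∀ {h p B B' p'} → Pass h p B B' p' → p ≤ p'
pass-≤ done       = ≤-refl
pass-≤ (turn e r) = <⇒≤ (pass-≤ r)
pass-≤ (keep k r) = pass-≤ r

pass-hole : ∀ {n h p B B' p'} → Pass h p B B' p' → p ≤ n → All (_≤ n) B → p' ≤ n
pass-hole done       b bs       = b
pass-hole (turn e r) b (c ∷ bs) = pass-hole r c bs
pass-hole (keep k r) b (c ∷ bs) = pass-hole r b bs

pass-bound : ∀ {n h p B B' p'} → Pass h p B B' p' → All (_≤ n) B → All (_≤ n) B'
pass-bound done       []       = []
pass-bound (turn e r) (c ∷ bs) = ≤-trans (n≤1+n _) c ∷ pass-bound r bs
pass-bound (keep k r) (c ∷ bs) = c ∷ pass-bound r bs

-- Before the slide the hole's cell stands at the beginning of the path, as `bump h p`; afterwards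
-- the vacated cell stands at its end, as the letter p'.
pass-valid : ∀ {n h p B B' p'} → Pass h p B B' p' → Dominant n h → Valid n (bump h p) B → Valid n h (B' ++ [ p' ])
pass-valid done       d v = valid-∷ d v
pass-valid (turn e r) d v = valid-∷ d (pass-valid r (valid-here v) (valid-tail v))
pass-valid {h = h} {p} (keep {q = q} k r) d v = valid-∷ d
  (pass-valid r (dominant-keep d (valid-here (valid-tail v)) k) (valid-cong (λ j _ → bump-comm h p q j) (valid-tail v)))

-- The letters i still waiting after `A` fit into the gap between rows i and i+1 of h. When the gap
-- closes the queue is empty, as an edge demands of `A`.
Covers : ℕ → Weight → Word → Set
Covers n h A = ∀ {i} → i < n → h (suc i) + end i 0 A ≤ h i

covers-∷ʳ : ∀ {n h q A} → Covers n h A → Dominant n (bump h q) → Covers n (bump h q) (A ++ [ q ])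
covers-∷ʳ {n} {h} {q} {A} c d {i} i<n = subst (λ e → bump h q (suc i) + e ≤ bump h q i) (sym (end-++ i 0 A [ q ]))
  (go (view i (end i 0 A) q) (c i<n) (d i<n))
  where
  open ≤-Reasoning
  go : ∀ {e o e'} → View i e q o e' → h (suc i) + e ≤ h i → bump h q (suc i) ≤ bump h q i → bump h q (suc i) + e' ≤ bump h q i
  go (low {e}) c d = begin
    bump h q (suc i) + suc e   ≡⟨ cong (_+ suc e) (bump-off h (>⇒≢ (n<1+n i))) ⟩
    h (suc i) + suc e          ≡⟨ +-suc (h (suc i)) e ⟩
    suc (h (suc i) + e)        ≤⟨ s≤s c ⟩
    suc (h i)                  ≡⟨ bump-at h i ⟨
    bump h q i                 ∎
  go (high {e}) c d = begin
    bump h q (suc i) + e       ≡⟨ cong (_+ e) (bump-at h (suc i)) ⟩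
    suc (h (suc i) + e)        ≡⟨ +-suc (h (suc i)) e ⟨
    h (suc i) + suc e          ≤⟨ c ⟩
    h i                        ≤⟨ m≤m+n (h i) _ ⟩
    bump h q i                 ∎
  go turn c d = ≤-trans (≤-reflexive (+-identityʳ _)) d
  go (other {e} a b) c d = subst₂ _≤_ (cong (_+ e) (sym (trans (cong (h (suc i) +_) b) (+-identityʳ _)))) (sym (trans (cong (h i +_) a) (+-identityʳ _))) c

-- Every `turn` of the hole is one crystal edge, and `keep` leaves the word alone.
pass-steps : ∀ {n h p B B' p'} → Pass h p B B' p' → ∀ A → Covers n h A → Dominant n h → Valid n (bump h p) B → All (_≤ n) B →
  Steps n (A ++ B) (A ++ B')
pass-steps done A c d v bs = ε
pass-steps {n} {h} {p} (turn {B = B} {B' = B'} e r) A c d v (b ∷ bs) =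
  (p , b , edge A e0 fix) ◅ subst₂ (Steps n) (++-assoc A [ p ] B) (++-assoc A [ p ] B')
    (pass-steps r (A ++ [ p ]) (covers-∷ʳ {A = A} c (valid-here v)) (valid-here v) (valid-tail v) bs)
  where
  e0 : end p 0 A ≡ 0
  e0 = n≤0⇒n≡0 (+-cancelˡ-≤ (h (suc p)) _ 0 (≤-trans (c b) (≤-reflexive (trans (sym e) (sym (+-identityʳ _))))))
  h2 = bump (bump h p) (suc p)
  eq : h2 (suc p) ≡ h2 p
  eq = trans (bump-at (bump h p) (suc p)) (trans (cong suc (trans (bump-off h (>⇒≢ (n<1+n p))) e))
       (sym (trans (bump-off (bump h p) (<⇒≢ (n<1+n p))) (bump-at h p))))
  -- With a cell added to each, rows p and p+1 are again equally long, so the remaining lattice path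
  -- obeys the prefix criterion without a head start.
  fix : P p 0 B ≡ B
  fix = count⇒P-fix p 0 B λ y z B≡ → ≤-trans (+-cancelˡ-≤ (h2 p) _ _ (subst (λ k → k + count (suc p) y ≤ h2 p + count p y) eq (valid-tail v y z B≡ b))) (m≤m+n _ 0)
pass-steps {n} {h} {p} (keep {q = q} {B = B} {B' = B'} k r) A c d v (b ∷ bs) =
  subst₂ (Steps n) (++-assoc A [ q ] B) (++-assoc A [ q ] B')
    (pass-steps r (A ++ [ q ]) (covers-∷ʳ {A = A} c d') d' (valid-cong (λ j _ → bump-comm h p q j) (valid-tail v)) bs)
  where
  d' = dominant-keep d (valid-here (valid-tail v)) k

pass-cong : ∀ {n g h p B B' p'} → (∀ j → j ≤ n → g j ≡ h j) → All (_≤ n) B → Pass g p B B' p' → Pass h p B B' p'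
pass-cong e bs done = done
pass-cong e (b ∷ bs) (turn {p = p} x r) =
  turn (trans (sym (e _ b)) (trans x (e _ (<⇒≤ b)))) (pass-cong (λ j j≤ → cong (_+ is j p) (e j j≤)) bs r)
pass-cong e (b ∷ bs) (keep {q = q} k r) =
  keep (λ { refl → subst₂ _<_ (e _ b) (e _ (<⇒≤ b)) (k refl) }) (pass-cong (λ j j≤ → cong (_+ is j q) (e j j≤)) bs r)

pass-++ : ∀ {n g h p B B' p₁ D D' p₂} → Pass h p B B' p₁ → All (_≤ n) D →
  (∀ j → j ≤ n → g j ≡ h j + count j B') → Pass g p₁ D D' p₂ → Pass h p (B ++ D) (B' ++ D') p₂
pass-++ done bs e r = pass-cong (λ j j≤ → trans (e j j≤) (+-identityʳ _)) bs r
pass-++ {h = h} (turn {p = p} x s) bs e r = turn x (pass-++ s bs (λ j j≤ → trans (e j j≤) (sym (+-assoc (h j) (is j p) _))) r)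
pass-++ {h = h} (keep {q = q} k s) bs e r = keep k (pass-++ s bs (λ j j≤ → trans (e j j≤) (sym (+-assoc (h j) (is j q) _))) r)

-- The hypothesis makes g the rotated complement, in a rectangle of width c, of the shape after the
-- slide including the vacated cell. `pass-count` carries the complementarity back to the start of
-- the slide.
rotated-total : ∀ {n h p B B' p' c j} (g : Weight) → j ≤ n → All (_≤ n) B → Pass h p B B' p' →
  g j + (h (n ∸ j) + count (n ∸ j) B' + is (n ∸ j) p') ≡ c →
  g j + count j (star n B) + bump h p (n ∸ j) ≡ c
rotated-total {n} {h} {p} {B} {B'} {p'} {c} {j} g j≤n bs r e = begin
  g j + count j (star n B) + (h k + is k p)    ≡⟨ cong (λ u → g j + u + (h k + is k p)) (count-star n j≤n bs) ⟩
  g j + count k B + (h k + is k p)             ≡⟨ +-assoc (g j) _ _ ⟩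
  g j + (count k B + (h k + is k p))           ≡⟨ cong (g j +_) (x∙yz≈y∙zx (count k B) (h k) (is k p)) ⟩
  g j + (h k + (is k p + count k B))           ≡⟨ cong (λ u → g j + (h k + u)) (pass-count r k) ⟩
  g j + (h k + (count k B' + is k p'))         ≡⟨ cong (g j +_) (+-assoc (h k) _ _) ⟨
  g j + (h k + count k B' + is k p')           ≡⟨ e ⟩
  c                                            ∎
  where
  open ≡-Reasoning
  open import Algebra.Properties.CommutativeSemigroup +-commutativeSemigroup using (x∙yz≈y∙zx)
  k = n ∸ j

-- Rotating the whole picture by 180 degrees reverses the slide.
pass-star : ∀ {n h p B B' p' c g} → Pass h p B B' p' → p ≤ n → All (_≤ n) B → Valid n (bump h p) B →
  (∀ j → j ≤ n → g j + (h (n ∸ j) + count (n ∸ j) B' + is (n ∸ j) p') ≡ c) →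
  Pass g (n ∸ p') (star n B') (star n B) (n ∸ p)
pass-star done p≤n [] v e = done
pass-star {n} {h} {p} {_} {_} {p'} {c} {g} (turn {B = B} {B' = B'} x r) p≤n (b ∷ bs) v e =
  subst₂ (λ u w → Pass g (n ∸ p') u w (n ∸ p)) (sym (star-∷ n p B')) (sym (star-∷ n (suc p) B))
    (pass-++ (pass-star {g = g} r b bs (valid-tail v) e₁) (m∸n≤m n p ∷ []) (λ j _ → refl) last)
  where
  e₁ : ∀ j → j ≤ n → g j + (bump h p (n ∸ j) + count (n ∸ j) B' + is (n ∸ j) p') ≡ c
  e₁ j j≤n = trans (cong (λ k → g j + (k + is (n ∸ j) p')) (+-assoc (h (n ∸ j)) _ _)) (e j j≤n)
  g₂ : Weight
  g₂ j = g j + count j (star n B)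
  h₂ = bump (bump h p) (suc p)
  e₂ : ∀ j i → j ≤ n → n ∸ j ≡ i → g₂ j + h₂ i ≡ c
  e₂ j _ j≤n refl = rotated-total g j≤n bs r (e₁ j j≤n)
  eq : h₂ (suc p) ≡ h₂ p
  eq = trans (bump-at (bump h p) (suc p)) (trans (cong suc (trans (bump-off h (>⇒≢ (n<1+n p))) x))
       (sym (trans (bump-off (bump h p) (<⇒≢ (n<1+n p))) (bump-at h p))))
  last : Pass g₂ (n ∸ suc p) [ n ∸ p ] [ n ∸ suc p ] (n ∸ p)
  last = subst (λ k → Pass g₂ (n ∸ suc p) [ k ] [ n ∸ suc p ] k) (suc-∸-suc b) (turn
    (+-cancelʳ-≡ (h₂ p) _ _ (trans (e₂ (suc (n ∸ suc p)) p (∸suc< b) (trans (cong (n ∸_) (suc-∸-suc b)) (m∸[m∸n]≡n p≤n)))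
      (trans (sym (e₂ (n ∸ suc p) (suc p) (m∸n≤m n (suc p)) (m∸[m∸n]≡n b))) (cong (g₂ (n ∸ suc p) +_) eq)))) done)
pass-star {n} {h} {p} {_} {_} {p'} {c} {g} (keep {q = q} {B = B} {B' = B'} k r) p≤n (b ∷ bs) v e =
  subst₂ (λ u w → Pass g (n ∸ p') u w (n ∸ p)) (sym (star-∷ n q B')) (sym (star-∷ n q B))
    (pass-++ (pass-star {g = g} r p≤n bs (valid-cong (λ j _ → bump-comm h p q j) (valid-tail v)) e₁) (m∸n≤m n q ∷ []) (λ j _ → refl)
      (keep lt done))
  where
  e₁ : ∀ j → j ≤ n → g j + (bump h q (n ∸ j) + count (n ∸ j) B' + is (n ∸ j) p') ≡ c
  e₁ j j≤n = trans (cong (λ k → g j + (k + is (n ∸ j) p')) (+-assoc (h (n ∸ j)) _ _)) (e j j≤n)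
  g₂ : Weight
  g₂ j = g j + count j (star n B)
  h₂ = bump (bump h q) p
  e₂ : ∀ j i → j ≤ n → n ∸ j ≡ i → g₂ j + h₂ i ≡ c
  e₂ j _ j≤n refl = rotated-total g j≤n bs r (e₁ j j≤n)
  -- Here q is the row just above the hole. Strictness comes from dominance of `bump h p`, the shape
  -- in which the hole's cell is filled.
  lt : n ∸ q ≡ suc (n ∸ p) → g₂ (suc (n ∸ p)) < g₂ (n ∸ p)
  lt q≡ = +-cancelʳ-< (h₂ p) _ _ (subst (g₂ (suc (n ∸ p)) + h₂ p <_)
      (trans (e₂ (suc (n ∸ p)) q (≤-trans (≤-reflexive (sym q≡)) (m∸n≤m n q)) (trans (cong (n ∸_) (sym q≡)) (m∸[m∸n]≡n b)))
        (sym (e₂ (n ∸ p) p (m∸n≤m n p) (m∸[m∸n]≡n p≤n))))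
      (+-monoʳ-< (g₂ (suc (n ∸ p))) h₂<))
    where
    p≡ : suc q ≡ p
    p≡ = trans (cong suc (trans (sym (m∸[m∸n]≡n b)) (cong (n ∸_) q≡)))
         (trans (suc-∸-suc (≤-trans (≤-reflexive (sym q≡)) (m∸n≤m n q))) (m∸[m∸n]≡n p≤n))
    q≢p : q ≢ p
    q≢p = <⇒≢ (≤-reflexive p≡)
    h₂< : h₂ p < h₂ q
    h₂< = subst₂ _<_ (sym (trans (bump-at (bump h q) p) (cong suc (bump-off h (≢-sym q≢p)))))
                 (sym (trans (bump-off (bump h q) q≢p) (bump-at h q)))
      (s≤s (subst₂ _≤_ (trans (cong (bump h p) p≡) (bump-at h p)) (bump-off h q≢p) (valid-here v (≤-trans (≤-reflexive p≡) p≤n))))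

-- Tableaux from words: entry s + t lies in the row named by the t-th letter

mark : ℕ → ℕ → List ℕ → List ℕ
mark zero    t l = l
mark (suc _) t l = t ∷ l

pos : ℕ → ℕ → Word → List ℕ
pos t j []      = []
pos t j (q ∷ x) = mark (is j q) t (pos (suc t) j x)

at : List ℕ → Weight
at []       j       = 0
at (o ∷ os) zero    = o
at (o ∷ os) (suc j) = at os j

tab : ℕ → ℕ → List ℕ → Word → SkewTab
tab s j []       x = []
tab s j (o ∷ os) x = (o , pos s j x) ∷ tab s (suc j) os x

when : ℕ → List ℕ → List ℕ
when zero    l = []
when (suc _) l = l

tabWith : List ℕ → ℕ → ℕ → ℕ → List ℕ → Word → SkewTab
tabWith ex p s j []       x = []
tabWith ex p s j (o ∷ os) x = (o , pos s j x ++ when (is j p) ex) ∷ tabWith ex p s (suc j) os x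

pos-hit : ∀ t j x → pos t j (j ∷ x) ≡ t ∷ pos (suc t) j x
pos-hit t j x = cong (λ k → mark k t (pos (suc t) j x)) (is-refl j)

pos-miss : ∀ t {j q} x → j ≢ q → pos t j (q ∷ x) ≡ pos (suc t) j x
pos-miss t {j} x j≢q = cong (λ k → mark k t (pos (suc t) j x)) (is-≢ j≢q)

mark-++ : ∀ k t l l' → mark k t (l ++ l') ≡ mark k t l ++ l'
mark-++ zero    t l l' = refl
mark-++ (suc k) t l l' = refl

pos-++ : ∀ t j x y → pos t j (x ++ y) ≡ pos t j x ++ pos (t + length x) j y
pos-++ t j []      y = cong (λ t → pos t j y) (sym (+-identityʳ t))
pos-++ t j (q ∷ x) y = trans (cong (mark (is j q) t) (trans (pos-++ (suc t) j x y) (cong (λ k → pos (suc t) j x ++ pos k j y) (sym (+-suc t (length x))))))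
  (mark-++ (is j q) t _ _)

length-mark : ∀ k t l → k ≤ 1 → length (mark k t l) ≡ k + length l
length-mark zero          t l k≤1 = refl
length-mark (suc zero)    t l k≤1 = refl
length-mark (suc (suc k)) t l (s≤s ())

length-pos : ∀ t j x → length (pos t j x) ≡ count j x
length-pos t j []      = refl
length-pos t j (q ∷ x) = trans (length-mark (is j q) t _ (is-≤1 j q)) (cong (is j q +_) (length-pos (suc t) j x))

pos-≥ : ∀ t j x → All (t ≤_) (pos t j x)
pos-≥ t j []      = []
pos-≥ t j (q ∷ x) with is j q
... | zero  = All.map <⇒≤ (pos-≥ (suc t) j x)
... | suc _ = ≤-refl ∷ All.map <⇒≤ (pos-≥ (suc t) j x)

tab-cong : ∀ {s s' x x'} j os → (∀ i → i < length os → pos s (j + i) x ≡ pos s' (j + i) x') → tab s j os x ≡ tab s' j os x'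
tab-cong j []       h = refl
tab-cong {s} {s'} {x} {x'} j (o ∷ os) h = cong₂ _∷_ (cong (o ,_) (subst (λ k → pos s k x ≡ pos s' k x') (+-identityʳ j) (h 0 (s≤s z≤n))))
  (tab-cong (suc j) os λ i i< → subst (λ k → pos s k x ≡ pos s' k x') (+-suc j i) (h (suc i) (s≤s i<)))

-- The sliding of a hole

slide-right : ∀ ex o pre t post row rest → (∀ d → entryAt row (o + length pre) ≡ just d → t ≤ d) →
  slide ex o pre (t ∷ post) (row ∷ rest) ≡ slide ex o (pre ++ t ∷ []) post (row ∷ rest)
slide-right ex o pre t post row rest h with entryAt row (o + length pre)
... | nothing = refl
... | just d with d <? t
...   | yes d<t = contradiction (h d refl) (<⇒≱ d<t)
...   | no  _   = refl

slide-stop : ∀ ex o pre row rest → entryAt row (o + length pre) ≡ nothing →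
  slide ex o pre [] (row ∷ rest) ≡ (o , pre ++ ex) ∷ row ∷ rest
slide-stop ex o pre row rest h with entryAt row (o + length pre)
... | nothing = refl

slide-down : ∀ ex o pre post o' es rest {d} → entryAt (o' , es) (o + length pre) ≡ just d → All (d <_) post →
  slide ex o pre post ((o' , es) ∷ rest) ≡
    (o , pre ++ d ∷ post) ∷ slide ex o' (take (o + length pre ∸ o') es) (drop (suc (o + length pre ∸ o')) es) rest
slide-down ex o pre [] o' es rest h a with entryAt (o' , es) (o + length pre)
slide-down ex o pre [] o' es rest refl a | just _ = refl
slide-down ex o pre (t ∷ post) o' es rest h a with entryAt (o' , es) (o + length pre)
slide-down ex o pre (t ∷ post) o' es rest {d} refl (d<t ∷ a) | just _ with d <? t
... | yes _  = refl
... | no d≮t = contradiction d<t d≮t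

entryAt-+ : ∀ o es d → entryAt (o , es) (o + d) ≡ lookupL es d
entryAt-+ zero    es d = refl
entryAt-+ (suc o) es d = trans (cong (λ b → if b then lookupL es (o + d ∸ o) else nothing) (le o d)) (cong (lookupL es) (m+n∸m≡n o d))
  where
  le : ∀ o d → (o <ᵇ suc (o + d)) ≡ true
  le zero    d = refl
  le (suc o) d = le o d

lookupL-++ : ∀ l {l'} e → lookupL (l ++ l') (length l + e) ≡ lookupL l' e
lookupL-++ []      e = refl
lookupL-++ (_ ∷ l) e = lookupL-++ l e

lookupL-All : ∀ {Q : ℕ → Set} {l} e {d} → All Q l → lookupL l e ≡ just d → Q d
lookupL-All zero    (a ∷ as) refl = a
lookupL-All (suc e) (a ∷ as) h    = lookupL-All e as h

drop-suc-length : ∀ (l : List ℕ) {t l'} → drop (suc (length l)) (l ++ t ∷ l') ≡ l'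
drop-suc-length []      = refl
drop-suc-length (_ ∷ l) = drop-suc-length l

pass-pos-< : ∀ {h p B B' p'} → Pass h p B B' p' → ∀ t j → j < p → pos t j B' ≡ pos t j B
pass-pos-< done t j j<p = refl
pass-pos-< (turn {p = p} {B} {B'} e r) t j j<p = trans (pos-miss t B' (<⇒≢ j<p))
  (trans (pass-pos-< r (suc t) j (m<n⇒m<1+n j<p)) (sym (pos-miss t B (<⇒≢ (m<n⇒m<1+n j<p)))))
pass-pos-< (keep {q = q} k r) t j j<p = cong (mark (is j q) t) (pass-pos-< r (suc t) j j<p)

when-refl : ∀ p ex → when (is p p) ex ≡ ex
when-refl p ex = cong (λ k → when k ex) (is-refl p)

when-≢ : ∀ {j p} ex → j ≢ p → when (is j p) ex ≡ []
when-≢ ex j≢p = cong (λ k → when k ex) (is-≢ j≢p)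

tabWith-above : ∀ ex p s j os x → p < j → tabWith ex p s j os x ≡ tab s j os x
tabWith-above ex p s j []       x p<j = refl
tabWith-above ex p s j (o ∷ os) x p<j = cong₂ _∷_
  (cong (o ,_) (trans (cong (pos s j x ++_) (when-≢ ex (>⇒≢ p<j))) (++-identityʳ _)))
  (tabWith-above ex p s (suc j) os x (m<n⇒m<1+n p<j))

pass-last : ∀ {n h B B' p'} → Pass h n B B' p' → All (_≤ n) B → B' ≡ B × p' ≡ n
pass-last done       bs       = refl , refl
pass-last (turn e r) (b ∷ bs) = ⊥-elim (1+n≰n b)
pass-last (keep {q = q} k r) (b ∷ bs) = let a , c = pass-last r bs in cong (q ∷_) a , c

entry-below : ∀ {c} s j o A B e → c ≡ o + count j A + e →
  entryAt (o , pos s j (A ++ B)) c ≡ lookupL (pos (s + length A) j B) e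
entry-below s j o A B e refl = begin
  entryAt (o , pos s j (A ++ B)) (o + count j A + e)                     ≡⟨ cong (entryAt (o , pos s j (A ++ B))) (+-assoc o _ e) ⟩
  entryAt (o , pos s j (A ++ B)) (o + (count j A + e))                   ≡⟨ entryAt-+ o (pos s j (A ++ B)) _ ⟩
  lookupL (pos s j (A ++ B)) (count j A + e)                             ≡⟨ cong₂ lookupL (pos-++ s j A B) (cong (_+ e) (sym (length-pos s j A))) ⟩
  lookupL (pos s j A ++ pos (s + length A) j B) (length (pos s j A) + e) ≡⟨ lookupL-++ (pos s j A) e ⟩
  lookupL (pos (s + length A) j B) e                                     ∎
  where open ≡-Reasoning

pos-∷ʳ-miss : ∀ t {j q} A B → j ≢ q → pos t j (A ++ q ∷ B) ≡ pos t j A ++ pos (suc (t + length A)) j B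
pos-∷ʳ-miss t {j} {q} A B j≢q = trans (pos-++ t j A (q ∷ B)) (cong (pos t j A ++_) (pos-miss (t + length A) B j≢q))

length-∷ʳ-+ : ∀ s A (q : ℕ) → s + length (A ++ [ q ]) ≡ suc (s + length A)
length-∷ʳ-+ s A q = trans (cong (s +_) (trans (length-++ A) (+-comm (length A) 1))) (+-suc s (length A))

-- Here h is the shape whose row p + i has the length at os i + count (p + i) A
-- and A is the part of the row word that the slide has already passed.
slide-tab : ∀ {n h p B B' p'} → Pass h p B B' p' → ∀ ex s o pre os A → All (_≤ n) B → p + length os ≡ n →
  Dominant n h → Valid n (bump h p) B → h p ≡ o + length pre →
  (∀ i → i < length os → h (suc p + i) ≡ at os i + count (suc p + i) A) →
  slide ex o pre (pos (s + length A) p B) (tab s (suc p) os (A ++ B)) ≡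
    (o , pre ++ pos (s + length A) p B' ++ when (is p p') ex) ∷ tabWith ex p' s (suc p) os (A ++ B')
slide-tab {p = p} {B} r ex s o pre [] A bs n≡ d v hp hb rewrite sym n≡ | +-identityʳ p with pass-last r bs
... | refl , refl = cong (λ z → (o , pre ++ pos (s + length A) p B ++ z) ∷ []) (sym (when-refl p ex))
slide-tab {n} {h} {p} r₀ ex s o pre (o' ∷ os) A bs₀ n≡ d v hp hb = go r₀ bs₀ v
  where
  p<n : p < n
  p<n = ≤-trans (≤-trans (m≤m+n (suc p) (length os)) (≤-reflexive (sym (+-suc p _)))) (≤-reflexive n≡)
  t = s + length A
  hb₀ : h (suc p) ≡ o' + count (suc p) A
  hb₀ = subst (λ k → h (suc k) ≡ o' + count (suc k) A) (+-identityʳ p) (hb 0 (s≤s z≤n))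
  -- The overhang of the passed part of row p over that of row p+1. The cell below the hole holds,
  -- counting from 0, the e-th entry of row p+1 not yet passed, if it exists.
  e : ℕ
  e = h p ∸ h (suc p)
  column : o + length pre ≡ o' + count (suc p) A + e
  column = trans (sym hp) (trans (sym (m+[n∸m]≡n (d p<n))) (cong (_+ e) hb₀))
  step : ∀ {q B B' p'} → Pass (bump h q) p B B' p' → All (_≤ n) B → Dominant n (bump h q) → Valid n (bump (bump h q) p) B →
    ∀ pre' → bump h q p ≡ o + length pre' → slide ex o pre' (pos (suc t) p B) (tab s (suc p) (o' ∷ os) (A ++ q ∷ B)) ≡
    (o , pre' ++ pos (suc t) p B' ++ when (is p p') ex) ∷ tabWith ex p' s (suc p) (o' ∷ os) (A ++ q ∷ B')
  step {q} {B} {B'} {p'} r bs d v pre' hp' = begin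
    slide ex o pre' (pos (suc t) p B) (tab s (suc p) (o' ∷ os) (A ++ q ∷ B))
      ≡⟨ cong₂ (λ u w → slide ex o pre' (pos u p B) (tab s (suc p) (o' ∷ os) w)) (sym (length-∷ʳ-+ s A q)) (sym (++-assoc A [ q ] B)) ⟩
    slide ex o pre' (pos (s + length (A ++ [ q ])) p B) (tab s (suc p) (o' ∷ os) ((A ++ [ q ]) ++ B))
      ≡⟨ slide-tab r ex s o pre' (o' ∷ os) (A ++ [ q ]) bs n≡ d v hp' (λ i i< → trans (cong (_+ is (suc p + i) q) (hb i i<))
           (trans (+-assoc (at (o' ∷ os) i) _ _) (cong (at (o' ∷ os) i +_) (sym (trans (count-++ _ A [ q ]) (cong (count (suc p + i) A +_) (+-identityʳ _))))))) ⟩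
    (o , pre' ++ pos (s + length (A ++ [ q ])) p B' ++ when (is p p') ex) ∷ tabWith ex p' s (suc p) (o' ∷ os) ((A ++ [ q ]) ++ B')
      ≡⟨ cong₂ (λ u w → (o , pre' ++ pos u p B' ++ when (is p p') ex) ∷ tabWith ex p' s (suc p) (o' ∷ os) w) (length-∷ʳ-+ s A q) (++-assoc A [ q ] B') ⟩
    (o , pre' ++ pos (suc t) p B' ++ when (is p p') ex) ∷ tabWith ex p' s (suc p) (o' ∷ os) (A ++ q ∷ B')
      ∎
    where open ≡-Reasoning
  go : ∀ {B B' p'} → Pass h p B B' p' → All (_≤ n) B → Valid n (bump h p) B →
    slide ex o pre (pos t p B) (tab s (suc p) (o' ∷ os) (A ++ B)) ≡
    (o , pre ++ pos t p B' ++ when (is p p') ex) ∷ tabWith ex p' s (suc p) (o' ∷ os) (A ++ B')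
  go done bs v = trans (slide-stop ex o pre (o' , pos s (suc p) (A ++ [])) (tab s (suc (suc p)) os (A ++ [])) (entry-below s (suc p) o' A [] e column))
    (cong₂ _∷_ (cong (λ z → o , pre ++ z) (sym (when-refl p ex))) (sym (tabWith-above ex p s (suc p) (o' ∷ os) (A ++ []) (n<1+n p))))
  go {p' = p'} (turn {B = B} {B'} x r) (b ∷ bs) v = begin
    slide ex o pre (pos t p (suc p ∷ B)) (tab s (suc p) (o' ∷ os) (A ++ suc p ∷ B))
      ≡⟨ cong (λ z → slide ex o pre z (tab s (suc p) (o' ∷ os) (A ++ suc p ∷ B))) (pos-miss t B (<⇒≢ (n<1+n p))) ⟩
    slide ex o pre (pos (suc t) p B) ((o' , es) ∷ rest)
      ≡⟨ slide-down ex o pre (pos (suc t) p B) o' es rest here (pos-≥ (suc t) p B) ⟩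
    (o , pre ++ t ∷ pos (suc t) p B) ∷ slide ex o' (take k es) (drop (suc k) es) rest
      ≡⟨ cong₂ _∷_ (cong (λ z → o , pre ++ z) row) (trans slide≡ (trans ih tail≡)) ⟩
    (o , pre ++ pos t p (p ∷ B') ++ when (is p p') ex) ∷ tabWith ex p' s (suc p) (o' ∷ os) (A ++ p ∷ B')
      ∎
    where
    open ≡-Reasoning
    es = pos s (suc p) (A ++ suc p ∷ B)
    rest = tab s (suc (suc p)) os (A ++ suc p ∷ B)
    k = o + length pre ∸ o'
    e≡0 : e ≡ 0
    e≡0 = trans (cong (h p ∸_) x) (n∸n≡0 (h p))
    here : entryAt (o' , es) (o + length pre) ≡ just t
    here = trans (entry-below s (suc p) o' A (suc p ∷ B) e column) (cong₂ lookupL (pos-hit t (suc p) B) e≡0)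
    k≡ : k ≡ length (pos s (suc p) A)
    k≡ = trans (cong (_∸ o') (trans column (trans (cong (o' + count (suc p) A +_) e≡0) (+-identityʳ _)))) (trans (m+n∸m≡n o' _) (sym (length-pos s (suc p) A)))
    es≡ : es ≡ pos s (suc p) A ++ t ∷ pos (suc t) (suc p) B
    es≡ = trans (pos-++ s (suc p) A (suc p ∷ B)) (cong (pos s (suc p) A ++_) (pos-hit t (suc p) B))
    A' = A ++ [ p ]
    t≡ : s + length A' ≡ suc t
    t≡ = length-∷ʳ-+ s A p
    A'B≡ : ∀ i → i < length os → pos s (suc (suc p) + i) (A ++ suc p ∷ B) ≡ pos s (suc (suc p) + i) (A' ++ B)
    A'B≡ i _ = trans (pos-∷ʳ-miss s A B (>⇒≢ (s≤s (s≤s (m≤m+n p i)))))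
      (sym (trans (cong (pos s (suc (suc p) + i)) (++-assoc A [ p ] B)) (pos-∷ʳ-miss s A B (>⇒≢ (s≤s (m≤n⇒m≤1+n (m≤m+n p i)))))))
    slide≡ : slide ex o' (take k es) (drop (suc k) es) rest ≡
             slide ex o' (pos s (suc p) A) (pos (s + length A') (suc p) B) (tab s (suc (suc p)) os (A' ++ B))
    slide≡ = trans (cong₂ (λ u w → slide ex o' u w rest)
        (trans (cong₂ take k≡ es≡) (take-length-++ (pos s (suc p) A)))
        (trans (cong₂ (λ k z → drop (suc k) z) k≡ es≡) (trans (drop-suc-length (pos s (suc p) A)) (cong (λ u → pos u (suc p) B) (sym t≡)))))
      (cong (slide ex o' (pos s (suc p) A) (pos (s + length A') (suc p) B)) (tab-cong (suc (suc p)) os A'B≡))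
    ih = slide-tab r ex s o' (pos s (suc p) A) os A' bs (trans (sym (+-suc p _)) n≡) (valid-here v) (valid-tail v)
      (trans (bump-off h (>⇒≢ (n<1+n p))) (trans hb₀ (cong (o' +_) (sym (length-pos s (suc p) A)))))
      λ i i< → trans (bump-off h (>⇒≢ (s≤s (m≤n⇒m≤1+n (m≤m+n p i)))))
        (trans (cong h (sym (+-suc (suc p) i))) (trans (hb (suc i) (s≤s i<)) (cong (at os i +_)
          (trans (cong (λ j → count j A) (+-suc (suc p) i)) (sym (trans (count-++ _ A [ p ])
            (trans (cong (λ z → count (suc (suc p) + i) A + (z + 0)) (is-≢ (>⇒≢ (s≤s (m≤n⇒m≤1+n (m≤m+n p i)))))) (+-identityʳ _))))))))
    row : t ∷ pos (suc t) p B ≡ pos t p (p ∷ B') ++ when (is p p') ex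
    row = sym (trans (cong₂ _++_ (trans (pos-hit t p B') (cong (t ∷_) (pass-pos-< r (suc t) p (n<1+n p)))) (when-≢ ex (<⇒≢ (pass-≤ r)))) (++-identityʳ _))
    tail≡ : (o' , pos s (suc p) A ++ pos (s + length A') (suc p) B' ++ when (is (suc p) p') ex) ∷ tabWith ex p' s (suc (suc p)) os (A' ++ B')
            ≡ tabWith ex p' s (suc p) (o' ∷ os) (A ++ p ∷ B')
    tail≡ = cong₂ _∷_ (cong (o' ,_) (trans (sym (++-assoc (pos s (suc p) A) _ _)) (cong (_++ when (is (suc p) p') ex)
        (trans (cong (λ u → pos s (suc p) A ++ pos u (suc p) B') t≡) (sym (pos-∷ʳ-miss s A B' (>⇒≢ (n<1+n p))))))))
      (cong (tabWith ex p' s (suc (suc p)) os) (++-assoc A [ p ] B'))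
  go {p' = p'} (keep {q = q} {B} {B'} k r) (b ∷ bs) v with q ≟ p
  ... | yes refl = begin
    slide ex o pre (pos t p (p ∷ B)) S                    ≡⟨ cong (λ z → slide ex o pre z S) (pos-hit t p B) ⟩
    slide ex o pre (t ∷ pos (suc t) p B) S                ≡⟨ slide-right ex o pre t _ (o' , pos s (suc p) (A ++ p ∷ B)) _ later ⟩
    slide ex o (pre ++ t ∷ []) (pos (suc t) p B) S        ≡⟨ step r bs d' v' (pre ++ t ∷ []) hp′ ⟩
    (o , (pre ++ t ∷ []) ++ pos (suc t) p B' ++ when (is p p') ex) ∷ S'  ≡⟨ cong (λ z → (o , z) ∷ S') (trans (++-assoc pre (t ∷ []) _)
                                                                             (cong (λ z → pre ++ z ++ when (is p p') ex) (sym (pos-hit t p B')))) ⟩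
    (o , pre ++ pos t p (p ∷ B') ++ when (is p p') ex) ∷ S'  ∎
    where
    open ≡-Reasoning
    S = tab s (suc p) (o' ∷ os) (A ++ p ∷ B)
    S' = tabWith ex p' s (suc p) (o' ∷ os) (A ++ p ∷ B')
    -- All entries below t have been passed, and the cell below the hole is not among their cells.
    later : ∀ d → entryAt (o' , pos s (suc p) (A ++ p ∷ B)) (o + length pre) ≡ just d → t ≤ d
    later d eq = lookupL-All e (pos-≥ t (suc p) (p ∷ B)) (trans (sym (entry-below s (suc p) o' A (p ∷ B) e column)) eq)
    hp′ : bump h p p ≡ o + length (pre ++ t ∷ [])
    hp′ = trans (bump-at h p) (trans (cong suc hp) (sym (length-∷ʳ-+ o pre t)))
    d' = dominant-keep d (valid-here (valid-tail v)) k
    v' = valid-cong (λ j _ → bump-comm h p p j) (valid-tail v)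
  ... | no q≢p = trans (cong (λ z → slide ex o pre z (tab s (suc p) (o' ∷ os) (A ++ q ∷ B))) (pos-miss t B (≢-sym q≢p)))
    (trans (step r bs (dominant-keep d (valid-here (valid-tail v)) k) (valid-cong (λ j _ → bump-comm h p q j) (valid-tail v)) pre
        (trans (bump-off h (≢-sym q≢p)) hp))
      (cong (λ z → (o , pre ++ z ++ when (is p p') ex) ∷ tabWith ex p' s (suc p) (o' ∷ os) (A ++ q ∷ B')) (sym (pos-miss t B' (≢-sym q≢p)))))

-- Rectification

tabWith-[] : ∀ p s j os x → tabWith [] p s j os x ≡ tab s j os x
tabWith-[] p s j []       x = refl
tabWith-[] p s j (o ∷ os) x = cong₂ _∷_ (cong (o ,_) (trans (cong (pos s j x ++_) (w (is j p))) (++-identityʳ _))) (tabWith-[] p s (suc j) os x)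
  where
  w : ∀ k → when k [] ≡ []
  w zero    = refl
  w (suc k) = refl

tabWith-∷ʳ : ∀ p s j os x → tabWith [ s + length x ] p s j os x ≡ tab s j os (x ++ [ p ])
tabWith-∷ʳ p s j []       x = refl
tabWith-∷ʳ p s j (o ∷ os) x = cong₂ _∷_ (cong (o ,_) (sym (trans (pos-++ s j x [ p ]) (cong (pos s j x ++_) (w (is j p)))))) (tabWith-∷ʳ p s (suc j) os x)
  where
  w : ∀ k → mark k (s + length x) [] ≡ when k [ s + length x ]
  w zero    = refl
  w (suc k) = refl

positive : List ℕ → Bool
positive []       = false
positive (o ∷ os) = (0 <ᵇ o) ∨ positive os

lastPositive : List ℕ → ℕ
lastPositive []       = 0
lastPositive (o ∷ os) = if positive os then suc (lastPositive os) else 0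

decrement : List ℕ → List ℕ
decrement []       = []
decrement (o ∷ os) = if positive os then o ∷ decrement os else pred o ∷ os

hasPos-tab : ∀ s j os x → hasPos (tab s j os x) ≡ positive os
hasPos-tab s j []       x = refl
hasPos-tab s j (o ∷ os) x = cong ((0 <ᵇ o) ∨_) (hasPos-tab s (suc j) os x)

¬positive⇒0 : ∀ os → positive os ≡ false → ∀ j → at os j ≡ 0
¬positive⇒0 []          e j       = refl
¬positive⇒0 (zero ∷ os) e zero    = refl
¬positive⇒0 (zero ∷ os) e (suc j) = ¬positive⇒0 os e j

¬positive⇒sum : ∀ os → positive os ≡ false → sum os ≡ 0
¬positive⇒sum []          e = refl
¬positive⇒sum (zero ∷ os) e = ¬positive⇒sum os e

length-decrement : ∀ os → length (decrement os) ≡ length os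
length-decrement [] = refl
length-decrement (o ∷ os) with positive os
... | true  = cong suc (length-decrement os)
... | false = refl

sum-decrement : ∀ os → positive os ≡ true → sum os ≡ suc (sum (decrement os))
sum-decrement (o ∷ os) e with positive os in eq
sum-decrement (o ∷ os)     e | true  = trans (cong (o +_) (sum-decrement os eq)) (+-suc o _)
sum-decrement (suc o ∷ os) e | false = refl

at-decrement : ∀ os → positive os ≡ true → ∀ j → bump (at (decrement os)) (lastPositive os) j ≡ at os j
at-decrement (o ∷ os) e j with positive os in eq
at-decrement (o ∷ os)     e zero    | true  = +-identityʳ o
at-decrement (o ∷ os)     e (suc j) | true  = at-decrement os eq j
at-decrement (suc o ∷ os) e zero    | false = +-comm o 1
at-decrement (suc o ∷ os) e (suc j) | false = +-identityʳ _

at-last : ∀ os → positive os ≡ true → ∀ j → lastPositive os < j → at os j ≡ 0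
at-last (o ∷ os) e j l with positive os in eq
at-last (o ∷ os) e (suc j) (s≤s l) | true  = at-last os eq j l
at-last (o ∷ os) e (suc j) l       | false = ¬positive⇒0 os eq j

-- Below the last positive offset all offsets vanish, so a cell may be removed there; elsewhere an
-- offset has only lost against the one above it.
decrement-dominant : ∀ n os → positive os ≡ true → Dominant n (at os) → Dominant n (at (decrement os))
decrement-dominant n os e d {i} i<n with i ≟ lastPositive os
... | yes refl = ≤-trans (m≤m+n _ _) (≤-trans (≤-reflexive (trans (at-decrement os e (suc i)) (at-last os e (suc i) (n<1+n i)))) z≤n)
... | no ≢ = ≤-trans (m≤m+n _ _) (≤-trans (≤-reflexive (at-decrement os e (suc i))) (≤-trans (d i<n)
             (≤-reflexive (trans (sym (at-decrement os e i)) (bump-off (at (decrement os)) ≢)))))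

jdtStep-tab : ∀ {n h x x' p'} j os → positive os ≡ true → Pass h (j + lastPositive os) x x' p' →
  (∀ i → i < length os → h (j + i) ≡ at (decrement os) i) → All (_≤ n) x → j + length os ≡ suc n →
  Dominant n h → Valid n (bump h (j + lastPositive os)) x →
  jdtStep (tab 1 j os x) ≡ tab 1 j (decrement os) x'
jdtStep-tab {n} {h} {x} {x'} {p'} j (o ∷ os) pos? r hh bs n≡ d v with hasPos (tab 1 (suc j) os x) in eq | positive os in eq'
... | true | false = contradiction (trans (sym eq) (trans (hasPos-tab 1 (suc j) os x) eq')) λ ()
... | false | true = contradiction (trans (sym eq) (trans (hasPos-tab 1 (suc j) os x) eq')) λ ()
... | true | true = cong₂ _∷_ (cong (o ,_) (sym (pass-pos-< r 1 j (≤-trans (s≤s (m≤m+n j _)) (≤-reflexive (sym (+-suc j _)))))))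
  (jdtStep-tab (suc j) os eq' (subst (λ k → Pass h k x x' p') (+-suc j _) r)
    (λ i i< → trans (cong h (sym (+-suc j i))) (hh (suc i) (s≤s i<))) bs (trans (sym (+-suc j _)) n≡) d
    (subst (λ k → Valid n (bump h k) x) (+-suc j _) v))
jdtStep-tab {n} {h} {x} {x'} {p'} j (suc o ∷ os) pos? r hh bs n≡ d v | false | false =
  trans (slide-tab r' [] 1 o [] os [] bs (suc-injective (trans (sym (+-suc j _)) n≡)) d v' (trans (trans (cong h (sym (+-identityʳ j))) (hh 0 (s≤s z≤n))) (sym (+-identityʳ o)))
      λ i i< → trans (cong h (sym (+-suc j i))) (trans (hh (suc i) (s≤s i<)) (sym (+-identityʳ _))))
    (tabWith-[] p' 1 j (o ∷ os) x')
  where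
  r' = subst (λ k → Pass h k x x' p') (+-identityʳ j) r
  v' = subst (λ k → Valid n (bump h k) x) (+-identityʳ j) v

zeros : ℕ → List ℕ
zeros b = replicate b 0

sum-0 : ∀ os → sum os ≡ 0 → os ≡ zeros (length os)
sum-0 []          e = refl
sum-0 (zero ∷ os) e = cong (0 ∷_) (sum-0 os e)

at-zeros : ∀ b j → at (zeros b) j ≡ 0
at-zeros zero    j       = refl
at-zeros (suc b) zero    = refl
at-zeros (suc b) (suc j) = at-zeros b j

iter-shift : ∀ {A : Set} n (f : A → A) x → iter n f (f x) ≡ f (iter n f x)
iter-shift zero    f x = refl
iter-shift (suc n) f x = cong f (iter-shift n f x)

-- Besides the outcome it is recorded that no slide moves the right end of the top row to the right;
-- this later bounds the stable shape from above.
rectify : ∀ {n} N os x → sum os ≡ N → length os ≡ suc n → All (_≤ n) x → Valid n (at os) x →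
  ∃[ x' ] (iter N jdtStep (tab 1 0 os x) ≡ tab 1 0 (zeros (suc n)) x') × Steps n x x' × Valid n Empty x' × (count 0 x' ≤ count 0 x + at os 0)
rectify {n} zero os x s l bs v =
  x , cong (λ os → tab 1 0 os x) (trans (sum-0 os s) (cong zeros l)) , ε ,
  valid-cong (λ j _ → trans (cong (λ os → at os j) (sum-0 os s)) (at-zeros (length os) j)) v , m≤m+n _ _
rectify {n} (suc N) os x s l bs v with positive os in eq
... | false = contradiction (trans (sym s) (¬positive⇒sum os eq)) λ ()
... | true with pass-exists n x d' v' bs
  where
  d' = decrement-dominant n os eq (valid-here v)
  v' : Valid n (bump (at (decrement os)) (lastPositive os)) x
  v' = valid-cong (λ j _ → sym (at-decrement os eq j)) v
... | x₁ , p' , r with rectify N (decrement os) x₁ (suc-injective (trans (sym (sum-decrement os eq)) s)) (trans (length-decrement os) l)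
                        (pass-bound r bs) (valid-prefix x₁ (pass-valid r (decrement-dominant n os eq (valid-here v)) (valid-cong (λ j _ → sym (at-decrement os eq j)) v)))
... | x' , e , st , v₂ , c = x' ,
  trans (sym (iter-shift N jdtStep _)) (trans (cong (iter N jdtStep) (jdtStep-tab 0 os eq r (λ i _ → refl) bs l d' v')) e) ,
  pass-steps r [] (λ i<n → ≤-trans (≤-reflexive (+-identityʳ _)) (d' i<n)) d' v' bs ◅◅ st , v₂ ,
  (begin
    count 0 x'                                               ≤⟨ c ⟩
    count 0 x₁ + at (decrement os) 0                         ≤⟨ +-monoˡ-≤ _ (≤-trans (m≤m+n _ _) (≤-reflexive (sym (pass-count r 0)))) ⟩
    is 0 p + count 0 x + at (decrement os) 0                 ≡⟨ xy∙z≈y∙zx (is 0 p) _ _ ⟩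
    count 0 x + (at (decrement os) 0 + is 0 p)               ≡⟨ cong (count 0 x +_) (at-decrement os eq 0) ⟩
    count 0 x + at os 0                                      ∎)
  where
  open ≤-Reasoning
  open import Algebra.Properties.CommutativeSemigroup +-commutativeSemigroup using (xy∙z≈y∙zx)
  p = lastPositive os
  d' = decrement-dominant n os eq (valid-here v)
  v' : Valid n (bump (at (decrement os)) (lastPositive os)) x
  v' = valid-cong (λ j _ → sym (at-decrement os eq j)) v

sum-offsets : ∀ s j os x → sum (map proj₁ (tab s j os x)) ≡ sum os
sum-offsets s j []       x = refl
sum-offsets s j (o ∷ os) x = cong (o +_) (sum-offsets s (suc j) os x)

-- `E` is constant along the steps and fixes a highest weight word, so the order in which the slides
-- were made is irrelevant.
steps-valid⇒E : ∀ {n x y} → Steps n x y → Valid n Empty y → y ≡ E n x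
steps-valid⇒E {n} st v = sym (trans (E-steps st) (E-fix n (valid⇒highest v)))

Rect-tab : ∀ {n} os x → length os ≡ suc n → All (_≤ n) x → Valid n (at os) x → Rect (tab 1 0 os x) ≡ tab 1 0 (zeros (suc n)) (E n x)
Rect-tab os x l bs v with rectify _ os x refl l bs v
... | x' , e , st , v' , c = trans (cong (λ N → iter N jdtStep (tab 1 0 os x)) (sum-offsets 1 0 os x))
  (trans e (cong (tab 1 0 (zeros _)) (steps-valid⇒E st v')))

-- Any inner shape from which x is a lattice path may serve as `os`, not only the one of the given
-- tableau; `shape-≤` uses a smaller one.
count-0-E : ∀ {n} os x → length os ≡ suc n → All (_≤ n) x → Valid n (at os) x → count 0 (E n x) ≤ count 0 x + at os 0
count-0-E os x l bs v with rectify _ os x refl l bs v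
... | x' , e , st , v' , c = subst (λ y → count 0 y ≤ count 0 x + at os 0) (steps-valid⇒E st v') c

-- Promotion

rowsFrom : ℕ → ℕ → ℕ → Word → List (List ℕ)
rowsFrom s j zero    x = []
rowsFrom s j (suc b) x = pos s j x ∷ rowsFrom s (suc j) b x

rowSum : ℕ → ℕ → Weight → ℕ
rowSum j zero    f = 0
rowSum j (suc b) f = f j + rowSum (suc j) b f

rowSum-cong : ∀ j b {f g} → (∀ i → j ≤ i → i < j + b → f i ≡ g i) → rowSum j b f ≡ rowSum j b g
rowSum-cong j zero    h = refl
rowSum-cong j (suc b) h = cong₂ _+_ (h j ≤-refl (≤-trans (s≤s (m≤m+n j b)) (≤-reflexive (sym (+-suc j b)))))
  (rowSum-cong (suc j) b λ i j<i i< → h i (<⇒≤ j<i) (≤-trans i< (≤-reflexive (sym (+-suc j b)))))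

rowSum-+ : ∀ j b f g → rowSum j b (λ i → f i + g i) ≡ rowSum j b f + rowSum j b g
rowSum-+ j zero    f g = refl
rowSum-+ j (suc b) f g = trans (cong (f j + g j +_) (rowSum-+ (suc j) b f g)) (interchange (f j) (g j) _ _)
  where open import Algebra.Properties.CommutativeSemigroup +-commutativeSemigroup using (interchange)

rowSum-0 : ∀ j b → rowSum j b Empty ≡ 0
rowSum-0 j zero    = refl
rowSum-0 j (suc b) = rowSum-0 (suc j) b

rowSum-is : ∀ j b q → j ≤ q → q < j + b → rowSum j b (λ i → is i q) ≡ 1
rowSum-is j zero    q j≤q q< = ⊥-elim (<⇒≱ q< (≤-trans (≤-reflexive (+-identityʳ j)) j≤q))
rowSum-is j (suc b) q j≤q q< with m≤n⇒m<n∨m≡n j≤q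
... | inj₁ j<q  = trans (cong (_+ rowSum (suc j) b (λ i → is i q)) (is-≢ (<⇒≢ j<q))) (rowSum-is (suc j) b q j<q (≤-trans q< (≤-reflexive (+-suc j b))))
... | inj₂ refl = cong₂ _+_ (is-refl j) (trans (rowSum-cong (suc j) b (λ i j<i _ → is-≢ (>⇒≢ j<i))) (rowSum-0 (suc j) b))

rowSum-count : ∀ n {x} → All (_≤ n) x → rowSum 0 (suc n) (λ j → count j x) ≡ length x
rowSum-count n []       = rowSum-0 0 (suc n)
rowSum-count n {q ∷ x} (b ∷ bs) = trans (rowSum-+ 0 (suc n) (λ j → is j q) (λ j → count j x)) (cong₂ _+_ (rowSum-is 0 (suc n) q z≤n (s≤s b)) (rowSum-count n bs))

sum-rows : ∀ s j b x → sum (map length (rowsFrom s j b x)) ≡ rowSum j b (λ i → count i x)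
sum-rows s j zero    x = refl
sum-rows s j (suc b) x = cong₂ _+_ (length-pos s j x) (sum-rows s (suc j) b x)

map-rows : ∀ s j b x → map (λ row → (0 , row)) (rowsFrom s j b x) ≡ tab s j (zeros b) x
map-rows s j zero    x = refl
map-rows s j (suc b) x = cong (_ ∷_) (map-rows s (suc j) b x)

rows-tab : ∀ s j os x → rows (tab s j os x) ≡ rowsFrom s j (length os) x
rows-tab s j []       x = refl
rows-tab s j (o ∷ os) x = cong (_ ∷_) (rows-tab s (suc j) os x)

pos-∸1 : ∀ s j x → map (_∸ 1) (pos (suc s) j x) ≡ pos s j x
pos-∸1 s j [] = refl
pos-∸1 s j (q ∷ x) with is j q
... | zero  = pos-∸1 (suc s) j x
... | suc _ = cong (s ∷_) (pos-∸1 (suc s) j x)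

rows-∸1 : ∀ s j os x → map (λ row → map (_∸ 1) (proj₂ row)) (tab (suc s) j os x) ≡ rowsFrom s j (length os) x
rows-∸1 s j []       x = refl
rows-∸1 s j (o ∷ os) x = cong₂ _∷_ (pos-∸1 s j x) (rows-∸1 s (suc j) os x)

-- Without 1 the entries start at 2, so the inserted maximum `2 + length v'` directly continues the
-- numbering of v' and appends the hole's last row as a letter.
pr-rows : ∀ {n v v' p'} → Pass Empty 0 v v' p' → All (_≤ n) v → Valid n (bump Empty 0) v →
  pr (rowsFrom 1 0 (suc n) (0 ∷ v)) ≡ rowsFrom 1 0 (suc n) (v' ++ [ p' ])
pr-rows {n} {v} {v'} {p'} r bs vl = begin
  map dec (slide [ suc N ] 0 [] (pos 2 0 v) (map (λ row → (0 , row)) (rowsFrom 1 1 n (0 ∷ v))))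
    ≡⟨ cong₂ (λ N rest → map dec (slide [ suc N ] 0 [] (pos 2 0 v) rest)) N≡ (trans (map-rows 1 1 n (0 ∷ v)) (tab-cong 1 (zeros n) λ i _ → refl)) ⟩
  map dec (slide [ 2 + length v' ] 0 [] (pos 2 0 v) (tab 2 1 (zeros n) v))
    ≡⟨ cong (map dec) (slide-tab r [ 2 + length v' ] 2 0 [] (zeros n) [] bs (length-replicate n) (λ _ → ≤-refl) vl refl
        (λ i _ → sym (trans (+-identityʳ _) (at-zeros n i)))) ⟩
  map dec (tabWith [ 2 + length v' ] p' 2 0 (zeros (suc n)) v')
    ≡⟨ cong (map dec) (tabWith-∷ʳ p' 2 0 (zeros (suc n)) v') ⟩
  map dec (tab 2 0 (zeros (suc n)) (v' ++ [ p' ]))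
    ≡⟨ rows-∸1 1 0 (zeros (suc n)) (v' ++ [ p' ]) ⟩
  rowsFrom 1 0 (length (zeros (suc n))) (v' ++ [ p' ])
    ≡⟨ cong (λ b → rowsFrom 1 0 b (v' ++ [ p' ])) (length-replicate (suc n)) ⟩
  rowsFrom 1 0 (suc n) (v' ++ [ p' ])
    ∎
  where
  open ≡-Reasoning
  dec : Row → List ℕ
  dec row = map (_∸ 1) (proj₂ row)
  N = sum (map length (rowsFrom 1 0 (suc n) (0 ∷ v)))
  N≡ : N ≡ suc (length v')
  N≡ = trans (sum-rows 1 0 (suc n) (0 ∷ v)) (trans (rowSum-count n (z≤n ∷ bs)) (cong suc (sym (pass-length r))))

-- Balanced words and the shape of their stable rectification

Balanced : ℕ → ℕ → Word → Set
Balanced n r w = ∀ j → j ≤ n → count j w ≡ r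

-- The least head start that row i needs over row i+1. Reading from the front, a first letter
-- changes the surplus of every longer prefix; truncated subtraction accounts for the empty prefix,
-- whose surplus is 0.
tight : ∀ i x → ∃[ e ] (∀ y z → x ≡ y ++ z → count (suc i) y ≤ count i y + e) ×
  ∃₂ λ y z → x ≡ y ++ z × count (suc i) y ≡ count i y + e
tight i [] = 0 , (λ { [] z e → z≤n }) , [] , [] , refl , refl
tight i (q ∷ x) with tight i x
... | e , bound , y , z , x≡ , y≡ = e' , bound' , attained (≤-total a (b + e))
  where
  open ≤-Reasoning
  open import Algebra.Properties.CommutativeSemigroup +-commutativeSemigroup using (x∙yz≈y∙xz)
  a = is i q
  b = is (suc i) q
  e' = b + e ∸ a
  shuffle : ∀ c → b + (c + e) ≡ c + (b + e)
  shuffle c = x∙yz≈y∙xz b c e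
  shuffle' : ∀ c → c + (a + e') ≡ a + c + e'
  shuffle' c = trans (x∙yz≈y∙xz c a e') (sym (+-assoc a c e'))
  bound' : ∀ y z → q ∷ x ≡ y ++ z → count (suc i) y ≤ count i y + e'
  bound' []      z eq = z≤n
  bound' (_ ∷ y) z eq with ∷-injective eq
  ... | refl , eq′ = begin
    b + count (suc i) y       ≤⟨ +-monoʳ-≤ b (bound y z eq′) ⟩
    b + (count i y + e)       ≡⟨ shuffle (count i y) ⟩
    count i y + (b + e)       ≤⟨ +-monoʳ-≤ (count i y) (m≤n+m∸n (b + e) a) ⟩
    count i y + (a + e')      ≡⟨ shuffle' (count i y) ⟩
    a + count i y + e'        ∎
  attained : a ≤ b + e ⊎ b + e ≤ a → ∃₂ λ y z → q ∷ x ≡ y ++ z × count (suc i) y ≡ count i y + e'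
  attained (inj₁ a≤) = q ∷ y , z , cong (q ∷_) x≡ , trans (cong (b +_) y≡)
    (trans (shuffle (count i y)) (trans (cong (count i y +_) (sym (m+[n∸m]≡n a≤))) (shuffle' (count i y))))
  attained (inj₂ ≤a) = [] , q ∷ x , refl , sym (m≤n⇒m∸n≡0 ≤a)

E-prefix : ∀ n a b {c y} → E n (a ++ b ++ c) ≡ y ++ b ++ c → length y ≡ length a → E n (a ++ b) ≡ y ++ b
E-prefix n a b {c} {y} e l = begin
  E n (a ++ b)                                  ≡⟨ cong (E n) (trans (cong (take k) (sym (++-assoc a b c))) (take-length-++ (a ++ b))) ⟨
  E n (take k (a ++ b ++ c))                    ≡⟨ take-E n k (a ++ b ++ c) ⟨
  take k (E n (a ++ b ++ c))                    ≡⟨ cong (take k) (trans e (sym (++-assoc y b c))) ⟩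
  take k ((y ++ b) ++ c)                        ≡⟨ cong (λ k → take k ((y ++ b) ++ c)) (trans (length-++ a) (trans (cong (_+ length b) (sym l)) (sym (length-++ y)))) ⟩
  take (length (y ++ b)) ((y ++ b) ++ c)        ≡⟨ take-length-++ (y ++ b) ⟩
  y ++ b                                        ∎
  where
  open ≡-Reasoning
  k = length (a ++ b)

-- Under star, prepending z becomes appending star z, a prefix of the stable
-- block star w.
count-suffix : ∀ n w k {r} → All (_≤ n) w → Balanced n r w → Stable n w k → ∀ y z → w ≡ y ++ z → ∀ j → j ≤ n →
  count j (E n (z ++ w ^^ k)) ≡ count j (E n (w ^^ k)) + count (n ∸ j) z
count-suffix n w k bw bal st y z w≡ j j≤n = begin
  count j (E n (z ++ w ^^ k))                             ≡⟨ count-E-star n (All.++⁺ bz (^^-bound k bw)) j≤n ⟨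
  count j (E n (star n (z ++ w ^^ k)))                    ≡⟨ cong (λ v → count j (E n v)) (trans (star-++ n z (w ^^ k)) (cong (_++ star n z) (star-^^ n w k))) ⟩
  count j (E n (star n w ^^ k ++ star n z))               ≡⟨ cong (count j) (E-prefix n (star n w ^^ k) (star n z) {star n y} {E n (star n w ^^ k)} st* (length-E n (star n w ^^ k))) ⟩
  count j (E n (star n w ^^ k) ++ star n z)               ≡⟨ count-++ j (E n (star n w ^^ k)) _ ⟩
  count j (E n (star n w ^^ k)) + count j (star n z)      ≡⟨ cong₂ _+_ (trans (cong (λ v → count j (E n v)) (sym (star-^^ n w k))) (count-E-star n (^^-bound k bw) j≤n)) (count-star n j≤n bz) ⟩
  count j (E n (w ^^ k)) + count (n ∸ j) z                ∎
  where
  open ≡-Reasoning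
  bz = All.++⁻ʳ y (subst (All (_≤ n)) w≡ bw)
  st* : E n (star n w ^^ k ++ star n z ++ star n y) ≡ E n (star n w ^^ k) ++ star n z ++ star n y
  st* = subst (λ v → E n (star n w ^^ k ++ v) ≡ E n (star n w ^^ k) ++ v) (trans (cong (star n) w≡) (star-++ n y z)) (stable-star n w k bw bal st)

valid-shift : ∀ {n h x} r → Valid n h x → Valid n (λ j → h j + r) x
valid-shift {n} {h} r v y z e {i} i<n = subst₂ _≤_ (sw (suc i)) (sw i) (+-monoˡ-≤ r (v y z e i<n))
  where
  sw : ∀ j → h j + count j y + r ≡ h j + r + count j y
  sw j = trans (+-assoc (h j) _ r) (trans (cong (h j +_) (+-comm (count j y) r)) (sym (+-assoc (h j) r _)))

-- A balanced block lengthens all rows by r and so leaves their differences as they were.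
valid-^^ : ∀ {n h w r} k → Balanced n r w → Valid n h w → Valid n h (w ^^ k)
valid-^^ zero    bal v = valid-[] (valid-here v)
valid-^^ {n} {h} {w} {r} (suc k) bal v = valid-++ w v
  (valid-cong (λ j j≤n → cong (h j +_) (sym (bal j j≤n))) (valid-shift r (valid-^^ k bal v)))

rowSum-≤ : ∀ j b {f g} → (∀ i → j ≤ i → i < j + b → f i ≤ g i) → rowSum j b f ≤ rowSum j b g
rowSum-≤ j zero    h = z≤n
rowSum-≤ j (suc b) h = +-mono-≤ (h j ≤-refl (≤-trans (s≤s (m≤m+n j b)) (≤-reflexive (sym (+-suc j b)))))
  (rowSum-≤ (suc j) b λ i j<i i< → h i (<⇒≤ j<i) (≤-trans i< (≤-reflexive (sym (+-suc j b)))))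

rowSum-≡ : ∀ j b {f g} → (∀ i → j ≤ i → i < j + b → f i ≤ g i) → rowSum j b f ≡ rowSum j b g → ∀ i → j ≤ i → i < j + b → f i ≡ g i
rowSum-≡ j zero h e i j≤i i< = ⊥-elim (<⇒≱ i< (≤-trans (≤-reflexive (+-identityʳ j)) j≤i))
rowSum-≡ j (suc b) {f} {g} h e i j≤i i< = go (m≤n⇒m<n∨m≡n j≤i)
  where
  h' : ∀ i → suc j ≤ i → i < suc j + b → f i ≤ g i
  h' i j<i i< = h i (<⇒≤ j<i) (≤-trans i< (≤-reflexive (sym (+-suc j b))))
  f≡g : f j ≡ g j
  f≡g = ≤-antisym (h j ≤-refl (≤-trans (s≤s (m≤m+n j b)) (≤-reflexive (sym (+-suc j b)))))
    (+-cancelʳ-≤ (rowSum (suc j) b f) _ _ (≤-trans (+-monoʳ-≤ (g j) (rowSum-≤ (suc j) b h')) (≤-reflexive (sym e))))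
  go : j < i ⊎ j ≡ i → f i ≡ g i
  go (inj₁ j<i)  = rowSum-≡ (suc j) b h' (+-cancelˡ-≡ (f j) _ _ (trans e (cong (_+ rowSum (suc j) b g) (sym f≡g)))) i j<i (≤-trans i< (≤-reflexive (+-suc j b)))
  go (inj₂ refl) = f≡g

module _ (n : ℕ) (w : Word) (k r : ℕ) (bw : All (_≤ n) w) (bal : Balanced n r w) (st : Stable n w k) where

  private
    u = E n (w ^^ k)
    e : ℕ → ℕ
    e i = proj₁ (tight i w)

  -- Before the powers of w stands the suffix s left by a prefix of w with maximal surplus of n-i
  -- over n-1-i; after them stands a prefix with maximal surplus of i+1 over i. The latter survives
  -- rectification by `sandwich`, the former contributes its reversed counts by `count-suffix`.
  -- Dominance of the resulting shape in rows i and i+1 contains both surpluses.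
  shape-gap : ∀ {i} → i < n → count (suc i) u + e i + e (n ∸ suc i) ≤ count i u
  shape-gap {i} i<n with tight i w | tight (n ∸ suc i) w
  ... | e₁ , _ , v₁ , z₁ , w≡₁ , v₁≡ | e₂ , _ , v₂ , s , w≡₂ , v₂≡ =
    +-cancelʳ-≤ (count m s) _ _ (+-cancelʳ-≤ (count i v₁) _ _ (begin
      count (suc i) u + e₁ + e₂ + count m s + count i v₁                ≡⟨ shuffle (count (suc i) u) e₁ e₂ (count m s) (count i v₁) ⟩
      count (suc i) u + (count m s + e₂) + (count i v₁ + e₁)            ≡⟨ cong₂ (λ a b → count (suc i) u + a + b) s≡ (sym v₁≡) ⟩
      count (suc i) u + count (n ∸ suc i) s + count (suc i) v₁          ≡⟨ cong (_+ count (suc i) v₁) (count-suffix n w k bw bal st v₂ s w≡₂ (suc i) i<n) ⟨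
      count (suc i) (E n (s ++ w ^^ k)) + count (suc i) v₁              ≡⟨ count-++ (suc i) (E n (s ++ w ^^ k)) v₁ ⟨
      count (suc i) (E n (s ++ w ^^ k) ++ v₁)                           ≤⟨ highest⇒valid (E-highest n (s ++ w ^^ k ++ w)) (E n (s ++ w ^^ k) ++ v₁) z₁ split i<n ⟩
      count i (E n (s ++ w ^^ k) ++ v₁)                                 ≡⟨ count-++ i (E n (s ++ w ^^ k)) v₁ ⟩
      count i (E n (s ++ w ^^ k)) + count i v₁                          ≡⟨ cong (_+ count i v₁) (count-suffix n w k bw bal st v₂ s w≡₂ i (<⇒≤ i<n)) ⟩
      count i u + count (n ∸ i) s + count i v₁                          ≡⟨ cong (λ m → count i u + count m s + count i v₁) (suc-∸-suc i<n) ⟨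
      count i u + count m s + count i v₁                                ∎))
    where
    open ≤-Reasoning
    open import Data.Nat.Tactic.RingSolver using (solve-∀)
    shuffle : ∀ a b c d f → a + b + c + d + f ≡ a + (d + c) + (f + b)
    shuffle = solve-∀
    m = suc (n ∸ suc i)
    split : E n (s ++ w ^^ k ++ w) ≡ (E n (s ++ w ^^ k) ++ v₁) ++ z₁
    split = trans (sandwich n s st) (trans (cong (E n (s ++ w ^^ k) ++_) w≡₁) (sym (++-assoc (E n (s ++ w ^^ k)) v₁ z₁)))
    total : ∀ j → j ≤ n → count j v₂ + count j s ≡ r
    total j j≤n = trans (sym (count-++ j v₂ s)) (trans (cong (count j) (sym w≡₂)) (bal j j≤n))
    s≡ : count m s + e₂ ≡ count (n ∸ suc i) s
    s≡ = +-cancelˡ-≡ (count (n ∸ suc i) v₂) _ _ (trans (cong (count (n ∸ suc i) v₂ +_) (+-comm (count m s) e₂))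
      (trans (sym (+-assoc (count (n ∸ suc i) v₂) e₂ _)) (trans (cong (_+ count m s) (sym v₂≡))
        (trans (total m (∸suc< i<n)) (sym (total (n ∸ suc i) (m∸n≤m n (suc i))))))))

  -- Partial sums of the e i: z (n ∸ j) is the length of row j of the
  -- smallest shape at which w is a lattice path.
  private
    z : ℕ → ℕ
    z zero    = 0
    z (suc m) = e (n ∸ suc m) + z m

    zs : ℕ → List ℕ
    zs zero    = [ 0 ]
    zs (suc m) = z (suc m) ∷ zs m

    length-zs : ∀ m → length (zs m) ≡ suc m
    length-zs zero    = refl
    length-zs (suc m) = cong suc (length-zs m)

    at-zs : ∀ m j → j ≤ m → at (zs m) j ≡ z (m ∸ j)
    at-zs zero    zero    j≤m       = refl
    at-zs (suc m) zero    j≤m       = refl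
    at-zs (suc m) (suc j) (s≤s j≤m) = at-zs m j j≤m

    z-suc : ∀ {i} → i < n → z (n ∸ i) ≡ e i + z (n ∸ suc i)
    z-suc {i} i<n = trans (cong z (sym (suc-∸-suc i<n))) (cong (λ k → e k + z (n ∸ suc i)) (trans (cong (n ∸_) (suc-∸-suc i<n)) (m∸[m∸n]≡n (<⇒≤ i<n))))

  valid-at-zs : Valid n (at (zs n)) w
  valid-at-zs y x w≡ {i} i<n = begin
    at (zs n) (suc i) + count (suc i) y         ≡⟨ cong (_+ count (suc i) y) (at-zs n (suc i) i<n) ⟩
    z (n ∸ suc i) + count (suc i) y             ≤⟨ +-monoʳ-≤ (z (n ∸ suc i)) (proj₁ (proj₂ (tight i w)) y x w≡) ⟩
    z (n ∸ suc i) + (count i y + e i)           ≡⟨ x∙yz≈zx∙y (z (n ∸ suc i)) (count i y) (e i) ⟩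
    e i + z (n ∸ suc i) + count i y             ≡⟨ cong (_+ count i y) (trans (at-zs n i (<⇒≤ i<n)) (z-suc i<n)) ⟨
    at (zs n) i + count i y                     ∎
    where
    open ≤-Reasoning
    open import Algebra.Properties.CommutativeSemigroup +-commutativeSemigroup using (x∙yz≈zx∙y)

  -- The top row is bounded by rectifying the powers of w from the inner shape `zs n`, and
  -- `shape-gap` carries the bound down row by row.
  shape-≤ : ∀ j → j ≤ n → count j u + z j ≤ k * r + z (n ∸ j)
  shape-≤ zero j≤n = ≤-trans (≤-reflexive (+-identityʳ _)) (≤-trans (count-0-E (zs n) (w ^^ k) (length-zs n) (^^-bound k bw) (valid-^^ k bal valid-at-zs))
    (≤-reflexive (cong₂ _+_ (trans (count-^^ 0 w k) (cong (k *_) (bal 0 z≤n))) (at-zs n 0 z≤n))))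
  shape-≤ (suc j) j<n = +-cancelʳ-≤ (e j) _ _ (begin
    count (suc j) u + (e (n ∸ suc j) + z j) + e j   ≡⟨ shuffle (count (suc j) u) (e (n ∸ suc j)) (z j) (e j) ⟩
    count (suc j) u + e j + e (n ∸ suc j) + z j     ≤⟨ +-monoˡ-≤ (z j) (shape-gap j<n) ⟩
    count j u + z j                                 ≤⟨ shape-≤ j (<⇒≤ j<n) ⟩
    k * r + z (n ∸ j)                               ≡⟨ cong (k * r +_) (trans (z-suc j<n) (+-comm (e j) _)) ⟩
    k * r + (z (n ∸ suc j) + e j)                   ≡⟨ +-assoc (k * r) _ _ ⟨
    k * r + z (n ∸ suc j) + e j                     ∎)
    where
    open ≤-Reasoning
    open import Data.Nat.Tactic.RingSolver using (solve-∀)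
    shuffle : ∀ a b c d → a + (b + c) + d ≡ a + d + b + c
    shuffle = solve-∀

  -- Summed over j, shape-≤ is an equality, hence so is each instance; adding
  -- the instances for j and n ∸ j removes the partial sums.
  shape-self-dual : ∀ j → j ≤ n → count j u + count (n ∸ j) u ≡ k * r + k * r
  shape-self-dual j j≤n = rowSum-≡ 0 (suc n) pair total j z≤n (s≤s j≤n)
    where
    open import Data.Nat.Tactic.RingSolver using (solve-∀)
    bu = E-bound n (^^-bound k bw)
    pair : ∀ i → 0 ≤ i → i < suc n → count i u + count (n ∸ i) u ≤ k * r + k * r
    pair i _ (s≤s i≤n) = +-cancelʳ-≤ (z i + z (n ∸ i)) _ _ (subst₂ _≤_ (l (count i u) (z i) (count (n ∸ i) u) (z (n ∸ i))) (r' (k * r) (z (n ∸ i)) (z i))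
      (+-mono-≤ (shape-≤ i i≤n) (subst (λ m → count (n ∸ i) u + z (n ∸ i) ≤ k * r + z m) (m∸[m∸n]≡n i≤n) (shape-≤ (n ∸ i) (m∸n≤m n i)))))
      where
      l : ∀ a b c d → a + b + (c + d) ≡ a + c + (b + d)
      l = solve-∀
      r' : ∀ a b c → a + b + (a + c) ≡ a + a + (c + b)
      r' = solve-∀
    lu : length u ≡ rowSum 0 (suc n) (λ _ → k * r)
    lu = trans (length-E n (w ^^ k)) (trans (sym (rowSum-count n (^^-bound k bw)))
      (rowSum-cong 0 (suc n) λ { i _ (s≤s i≤n) → trans (count-^^ i w k) (cong (k *_) (bal i i≤n)) }))
    total : rowSum 0 (suc n) (λ i → count i u + count (n ∸ i) u) ≡ rowSum 0 (suc n) (λ _ → k * r + k * r)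
    total = trans (rowSum-+ 0 (suc n) (λ i → count i u) (λ i → count (n ∸ i) u)) (trans
      (cong₂ _+_ (trans (rowSum-count n bu) lu)
        (trans (rowSum-cong 0 (suc n) λ { i _ (s≤s i≤n) → sym (count-star n i≤n bu) }) (trans (rowSum-count n (star-bound n u)) (trans (length-star n u) lu))))
      (sym (rowSum-+ 0 (suc n) (λ _ → k * r) (λ _ → k * r))))

-- Promotion of the glued word

highest-head : ∀ {n q x} → q ≤ n → Highest n (q ∷ x) → q ≡ 0
highest-head {q = zero}      q≤n h = refl
highest-head {q = suc q} {x} q<n h = ⊥-elim (1+n≰n (subst₂ _≤_ (trans (+-identityʳ _) (is-refl q)) (trans (+-identityʳ _) (is-suc q)) (highest⇒valid h [ suc q ] x refl q<n)))

-- Removing the first entry of a rectified word and rectifying again.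
record Removal (n q : ℕ) (x : Word) : Set where
  constructor removal
  field
    rest  : Word
    hole  : ℕ
    word≡ : E n (q ∷ x) ≡ 0 ∷ rest
    pass  : Pass Empty 0 rest (E n x) hole
    bound : All (_≤ n) rest
    valid : Valid n (bump Empty 0) rest
    hole≤ : hole ≤ n

  count-hole : ∀ j → count j (E n (q ∷ x)) ≡ count j (E n x) + is j hole
  count-hole j = trans (cong (count j) word≡) (pass-count pass j)

-- A highest weight word begins with 0. Sliding into that cell leads to a highest weight word by
-- crystal edges, and `E-drop-E` identifies it with `E n x`.
remove : ∀ n q x → All (_≤ n) (q ∷ x) → Removal n q x
remove n q x bs = go (E n (q ∷ x)) refl (length-E n (q ∷ x)) (E-bound n bs) (E-highest n (q ∷ x)) (E-drop-E n 1 (q ∷ x))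
  where
  go : ∀ z → E n (q ∷ x) ≡ z → length z ≡ suc (length x) → All (_≤ n) z → Highest n z → E n (drop 1 z) ≡ E n x → Removal n q x
  go (a ∷ v) z≡ _ (b ∷ bv) h dr with highest-head b h
  ... | refl with pass-exists n {Empty} {0} v (λ _ → z≤n) (valid-tail (highest⇒valid h)) bv
  ...   | v' , p' , r = removal v p' z≡ (subst (λ z → Pass Empty 0 v z p') v'≡ r) bv vl (pass-hole r z≤n bv)
    where
    vl = valid-tail (highest⇒valid h)
    v'≡ : v' ≡ E n x
    v'≡ = trans (steps-valid⇒E (pass-steps r [] (λ _ → z≤n) (λ _ → z≤n) vl bv) (valid-prefix v' (pass-valid r (λ _ → z≤n) vl))) dr

-- The shapes before and after the removal differ by the hole's cell, while `count-suffix` says that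
-- they differ by a cell in row n-q.
hole-of : ∀ {n w} k {r} → All (_≤ n) w → Balanced n r w → Stable n w k → ∀ y q z → w ≡ y ++ q ∷ z →
  (R : Removal n q (z ++ w ^^ k)) → Removal.hole R ≡ n ∸ q
hole-of {n} {w} k bw bal st y q z w≡ R = is-1 (trans (is-∸ n hole≤ q≤n) (trans (sym (is-hole hole hole≤)) (is-refl hole)))
  where
  open Removal R
  open ≡-Reasoning
  q≤n : q ≤ n
  q≤n = All.head (All.++⁻ʳ y (subst (All (_≤ n)) w≡ bw))
  is-hole : ∀ j → j ≤ n → is j hole ≡ is (n ∸ j) q
  is-hole j j≤n = +-cancelˡ-≡ (count j u + count (n ∸ j) z) _ _ (begin
    count j u + count (n ∸ j) z + is j hole             ≡⟨ cong (_+ is j hole) (count-suffix n w k bw bal st (y ++ [ q ]) z (trans w≡ (sym (++-assoc y [ q ] z))) j j≤n) ⟨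
    count j (E n (z ++ w ^^ k)) + is j hole             ≡⟨ count-hole j ⟨
    count j (E n (q ∷ z ++ w ^^ k))                     ≡⟨ count-suffix n w k bw bal st y (q ∷ z) w≡ j j≤n ⟩
    count j u + (is (n ∸ j) q + count (n ∸ j) z)        ≡⟨ cong (count j u +_) (+-comm (is (n ∸ j) q) _) ⟩
    count j u + (count (n ∸ j) z + is (n ∸ j) q)        ≡⟨ +-assoc (count j u) _ _ ⟨
    count j u + count (n ∸ j) z + is (n ∸ j) q          ∎)
    where u = E n (w ^^ k)

module Glued (n : ℕ) (w : Word) (k c r : ℕ) (bw : All (_≤ n) w) (bal : Balanced n r w) (st : Stable n w k) where

  w* : Word
  w* = star n w

  bw* : All (_≤ n) w*
  bw* = star-bound n w

  bal* : Balanced n r w*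
  bal* j j≤n = trans (count-star n j≤n bw) (bal (n ∸ j) (m∸n≤m n j))

  st* : Stable n w* (c + k)
  st* = stable-+ n w* k c (stable-star n w k bw bal st)

  -- After |y| promotions, where w = y z, the glued word is left z ++ right y.
  left right : Word → Word
  left z  = E n (z ++ w ^^ k)
  right y = star n (E n (star n y ++ w* ^^ (c + k)))

  total : ℕ
  total = k * r + k * r + c * r + r

  left-bound : ∀ y z → w ≡ y ++ z → All (_≤ n) (left z)
  left-bound y z w≡ = E-bound n (All.++⁺ (All.++⁻ʳ y (subst (All (_≤ n)) w≡ bw)) (^^-bound k bw))

  inner-bound : ∀ y → All (_≤ n) (E n (star n y ++ w* ^^ (c + k)))
  inner-bound y = E-bound n (All.++⁺ (star-bound n y) (^^-bound (c + k) bw*))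

  -- This is the complementarity that `pass-star` asks for at each stage. The contributions of y and
  -- z make up one copy of w, and `shape-self-dual` balances what the powers contribute on the two
  -- sides.
  count-total : ∀ y z → w ≡ y ++ z → ∀ j → j ≤ n → count j (left z) + count j (right y) ≡ total
  count-total y z w≡ j j≤n = begin
    count j (left z) + count j (right y)
      ≡⟨ cong₂ _+_ (count-suffix n w k bw bal st y z w≡ j j≤n) (trans (count-star n j≤n (inner-bound y))
           (count-suffix n w* (c + k) bw* bal* st* (star n z) (star n y) (trans (cong (star n) w≡) (star-++ n y z)) (n ∸ j) j'≤n)) ⟩
    count j u + count j' z + (count j' (E n (w* ^^ (c + k))) + count (n ∸ j') (star n y))
      ≡⟨ cong₂ (λ a b → count j u + count j' z + (a + b))
           (trans (cong (λ v → count j' (E n v)) (sym (star-^^ n w (c + k)))) (trans (count-E-star n (^^-bound (c + k) bw) j'≤n) u≡))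
           (trans (cong (λ i → count i (star n y)) (m∸[m∸n]≡n j≤n)) (count-star n j≤n by)) ⟩
    count j u + count j' z + (count j' u + c * r + count j' y)
      ≡⟨ shuffle (count j u) (count j' z) (count j' u) (c * r) (count j' y) ⟩
    count j u + count j' u + c * r + (count j' y + count j' z)
      ≡⟨ cong₂ (λ a b → a + c * r + b) (shape-self-dual n w k r bw bal st j j≤n)
           (trans (sym (count-++ j' y z)) (trans (cong (count j') (sym w≡)) (bal j' j'≤n))) ⟩
    total ∎
    where
    open ≡-Reasoning
    open import Data.Nat.Tactic.RingSolver using (solve-∀)
    u = E n (w ^^ k)
    j' = n ∸ j
    j'≤n = m∸n≤m n j
    by = All.++⁻ˡ y (subst (All (_≤ n)) w≡ bw)
    shuffle : ∀ a b d e f → a + b + (d + e + f) ≡ a + d + e + (f + b)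
    shuffle = solve-∀
    u≡ : count j' (E n (w ^^ (c + k))) ≡ count j' u + c * r
    u≡ = trans (cong (λ m → count j' (E n (w ^^ m))) (+-comm c k)) (trans (cong (count j') (E-stable n w k c st))
      (trans (count-++ j' u (w ^^ c)) (cong (count j' u +_) (trans (count-^^ j' w c) (cong (c *_) (bal j' j'≤n))))))

  right-∷ʳ : ∀ y q → right (y ++ [ q ]) ≡ star n (E n ((n ∸ q) ∷ star n y ++ w* ^^ (c + k)))
  right-∷ʳ y q = cong (λ v → star n (E n (v ++ w* ^^ (c + k)))) (star-++ n y [ q ])

  -- The hole leaves the left part in row n-q. For the right part, removal of the first entry on the
  -- star side is run backwards by `pass-star`: its hole enters in row n-q and leaves in row n, and
  -- the letter n so appended is the complement of the 0 removed there.
  pr-step : ∀ y q z → w ≡ y ++ q ∷ z → Valid n Empty (left (q ∷ z) ++ right y) →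
    (pr (rowsFrom 1 0 (suc n) (left (q ∷ z) ++ right y)) ≡ rowsFrom 1 0 (suc n) (left z ++ right (y ++ [ q ]))) ×
    Valid n Empty (left z ++ right (y ++ [ q ]))
  pr-step y q z w≡ v =
    trans (cong (pr ∘ rowsFrom 1 0 (suc n)) X≡) (trans (pr-rows pAB (All.++⁺ (bound A) (star-bound n D)) v') (cong (rowsFrom 1 0 (suc n)) X'≡)) ,
    subst (Valid n Empty) X'≡ (pass-valid pAB (λ _ → z≤n) v')
    where
    open Removal
    open ≡-Reasoning
    bq = All.++⁻ʳ y (subst (All (_≤ n)) w≡ bw)
    q≤n = All.head bq
    A = remove n q (z ++ w ^^ k) (All.++⁺ bq (^^-bound k bw))
    B = remove n (n ∸ q) (star n y ++ w* ^^ (c + k)) (m∸n≤m n q ∷ All.++⁺ (star-bound n y) (^^-bound (c + k) bw*))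
    D = E n (star n y ++ w* ^^ (c + k))
    w*≡ : w* ≡ star n z ++ (n ∸ q) ∷ star n y
    w*≡ = trans (cong (star n) w≡) (trans (star-++ n y (q ∷ z)) (trans (cong (_++ star n y) (star-∷ n q z)) (++-assoc (star n z) _ _)))
    holeA : hole A ≡ n ∸ q
    holeA = hole-of k bw bal st y q z w≡ A
    holeB : hole B ≡ q
    holeB = trans (hole-of (c + k) bw* bal* st* (star n z) (n ∸ q) (star n y) w*≡ B) (m∸[m∸n]≡n q≤n)
    count-right : ∀ j → j ≤ n → count j (right (y ++ [ q ])) ≡ count (n ∸ j) D + is (n ∸ j) (hole B)
    count-right j j≤n = trans (cong (count j) (right-∷ʳ y q)) (trans (count-star n j≤n (subst (All (_≤ n)) (sym (word≡ B)) (z≤n ∷ bound B)))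
      (count-hole B (n ∸ j)))
    pB : Pass (λ j → count j (left z)) (n ∸ hole B) (star n D) (star n (rest B)) n
    pB = pass-star (pass B) z≤n (bound B) (valid B) λ j j≤n →
      trans (cong (count j (left z) +_) (sym (count-right j j≤n))) (count-total (y ++ [ q ]) z (trans w≡ (sym (++-assoc y [ q ] z))) j j≤n)
    pAB = pass-++ (pass A) (star-bound n D) (λ j _ → refl)
      (subst (λ p → Pass (λ j → count j (left z)) p (star n D) (star n (rest B)) n) (trans (cong (n ∸_) holeB) (sym holeA)) pB)
    X≡ : left (q ∷ z) ++ right y ≡ 0 ∷ rest A ++ star n D
    X≡ = cong (_++ star n D) (word≡ A)
    X'≡ : (left z ++ star n (rest B)) ++ [ n ] ≡ left z ++ right (y ++ [ q ])
    X'≡ = trans (++-assoc (left z) _ _) (cong (left z ++_) (sym (trans (right-∷ʳ y q) (trans (cong (star n) (word≡ B)) (star-∷ n 0 (rest B))))))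
    v' : Valid n (bump Empty 0) (rest A ++ star n D)
    v' = valid-tail (subst (Valid n Empty) X≡ v)

  pr-run : ∀ y z → w ≡ y ++ z → Valid n Empty (left z ++ right y) →
    iter (length z) pr (rowsFrom 1 0 (suc n) (left z ++ right y)) ≡ rowsFrom 1 0 (suc n) (left [] ++ right w)
  pr-run y [] w≡ v = cong (λ v → rowsFrom 1 0 (suc n) (left [] ++ right v)) (sym (trans w≡ (++-identityʳ y)))
  pr-run y (q ∷ z) w≡ v with pr-step y q z w≡ v
  ... | e , v' = trans (sym (iter-shift (length z) pr _)) (trans (cong (iter (length z) pr) e) (pr-run (y ++ [ q ]) z (trans w≡ (sym (++-assoc y [ q ] z))) v'))

  glued : Word
  glued = E n (w ^^ k) ++ w ^^ suc c ++ star n (E n (w* ^^ k))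

  right-w : ∀ i → star n (E n (w* ^^ (k + i))) ≡ w ^^ i ++ star n (E n (w* ^^ k))
  right-w i = begin
    star n (E n (w* ^^ (k + i)))                      ≡⟨ cong (star n) (E-stable n w* k i (stable-star n w k bw bal st)) ⟩
    star n (E n (w* ^^ k) ++ w* ^^ i)                 ≡⟨ star-++ n (E n (w* ^^ k)) (w* ^^ i) ⟩
    star n (w* ^^ i) ++ star n (E n (w* ^^ k))        ≡⟨ cong (_++ star n (E n (w* ^^ k))) (trans (star-^^ n w* i) (cong (_^^ i) (star-involutive n bw))) ⟩
    w ^^ i ++ star n (E n (w* ^^ k))                  ∎
    where open ≡-Reasoning

  glued-start : left w ++ right [] ≡ glued
  glued-start = begin
    E n (w ++ w ^^ k) ++ star n (E n (w* ^^ (c + k)))      ≡⟨ cong₂ (λ a b → E n a ++ star n (E n (w* ^^ b))) (^^-snoc w k) (+-comm c k) ⟩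
    E n (w ^^ k ++ w) ++ star n (E n (w* ^^ (k + c)))      ≡⟨ cong₂ _++_ st (right-w c) ⟩
    (E n (w ^^ k) ++ w) ++ w ^^ c ++ l                     ≡⟨ ++-assoc (E n (w ^^ k)) w _ ⟩
    E n (w ^^ k) ++ w ++ w ^^ c ++ l                       ≡⟨ cong (E n (w ^^ k) ++_) (++-assoc w (w ^^ c) l) ⟨
    glued                                                  ∎
    where
    open ≡-Reasoning
    l = star n (E n (w* ^^ k))

  glued-end : left [] ++ right w ≡ glued
  glued-end = cong (E n (w ^^ k) ++_) (trans (cong (λ m → star n (E n (w* ^^ m))) (trans (cong suc (+-comm c k)) (sym (+-suc k c)))) (right-w (suc c)))

  count-glued : ∀ j → j ≤ n → count j glued ≡ total
  count-glued j j≤n = trans (cong (count j) (sym glued-start)) (trans (count-++ j (left w) (right [])) (count-total [] w refl j j≤n))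

  glued-bound : All (_≤ n) glued
  glued-bound = subst (All (_≤ n)) glued-start (All.++⁺ (left-bound [] w refl) (star-bound n (E n (w* ^^ (c + k)))))

  -- The right part is a lowest weight word, which only gives a condition on suffixes. Since all
  -- rows of the glued word are equally long, it translates into the condition on prefixes.
  glued-valid : Valid n Empty glued
  glued-valid = subst (Valid n Empty) glued-start (valid-++ (left w) (highest⇒valid (E-highest n (w ++ w ^^ k))) λ y z e {i} i<n →
    +-cancelʳ-≤ (count (suc i) z) _ _ (≤-trans (≤-reflexive (trans (split (suc i) i<n y z e) (sym (split i (<⇒≤ i<n) y z e))))
      (+-monoʳ-≤ _ (end⇒count i y z (trans (cong (end i 0) (sym e)) (star-lowest n (inner-bound []) (E-highest n (w* ^^ (c + k))) i<n))))))
    where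
    split : ∀ j → j ≤ n → ∀ y z → right [] ≡ y ++ z → count j (left w) + count j y + count j z ≡ total
    split j j≤n y z e = trans (+-assoc (count j (left w)) _ _) (trans (cong (count j (left w) +_) (trans (sym (count-++ j y z)) (cong (count j) (sym e))))
      (count-total [] w refl j j≤n))

  pr-glued : iter (length w) pr (rowsFrom 1 0 (suc n) glued) ≡ rowsFrom 1 0 (suc n) glued
  pr-glued = begin
    iter (length w) pr (rowsFrom 1 0 (suc n) glued)                        ≡⟨ cong (iter (length w) pr ∘ rowsFrom 1 0 (suc n)) glued-start ⟨
    iter (length w) pr (rowsFrom 1 0 (suc n) (left w ++ right []))         ≡⟨ pr-run [] w refl (subst (Valid n Empty) (sym glued-start) glued-valid) ⟩
    rowsFrom 1 0 (suc n) (left [] ++ right w)                              ≡⟨ cong (rowsFrom 1 0 (suc n)) glued-end ⟩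
    rowsFrom 1 0 (suc n) glued                                             ∎
    where open ≡-Reasoning

-- Standard skew tableaux are given by words

ups : ℕ → ℕ → List ℕ
ups s zero    = []
ups s (suc N) = s ∷ ups (suc s) N

length-ups : ∀ s N → length (ups s N) ≡ N
length-ups s zero    = refl
length-ups s (suc N) = cong suc (length-ups (suc s) N)

map-suc-ups : ∀ s N → map suc (ups s N) ≡ ups (suc s) N
map-suc-ups s zero    = refl
map-suc-ups s (suc N) = cong (suc s ∷_) (map-suc-ups (suc s) N)

upTo-ups : ∀ N → upTo N ≡ ups 0 N
upTo-ups zero    = refl
upTo-ups (suc N) = cong (0 ∷_) (trans (sym (map-upTo suc N)) (trans (cong (map suc) (upTo-ups N)) (map-suc-ups 0 N)))

entries-ups : ∀ N → map suc (upTo N) ≡ ups 1 N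
entries-ups N = trans (cong (map suc) (upTo-ups N)) (map-suc-ups 0 N)

count-↭ : ∀ t {x y} → x ↭ y → count t x ≡ count t y
count-↭ t ↭.refl          = refl
count-↭ t (↭.prep a p)    = cong (is t a +_) (count-↭ t p)
count-↭ t (↭.swap a b p)  = trans (cong (λ k → is t a + (is t b + k)) (count-↭ t p)) (x∙yz≈y∙xz (is t a) (is t b) _)
  where open import Algebra.Properties.CommutativeSemigroup +-commutativeSemigroup using (x∙yz≈y∙xz)
count-↭ t (↭.trans p p')  = trans (count-↭ t p) (count-↭ t p')

count-ups-< : ∀ s N {t} → t < s → count t (ups s N) ≡ 0
count-ups-< s zero    t<s = refl
count-ups-< s (suc N) t<s = cong₂ _+_ (is-≢ (<⇒≢ t<s)) (count-ups-< (suc s) N (m<n⇒m<1+n t<s))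

count-ups-≥ : ∀ s N {t} → s + N ≤ t → count t (ups s N) ≡ 0
count-ups-≥ s zero    ≤t = refl
count-ups-≥ s (suc N) ≤t = cong₂ _+_ (is-≢ (>⇒≢ (≤-trans (s≤s (m≤m+n s N)) ≤t′))) (count-ups-≥ (suc s) N ≤t′)
  where ≤t′ = ≤-trans (≤-reflexive (sym (+-suc s N))) ≤t

count-ups : ∀ s N {t} → s ≤ t → t < s + N → count t (ups s N) ≡ 1
count-ups s zero    s≤t t< = ⊥-elim (<⇒≱ t< (≤-trans (≤-reflexive (+-identityʳ s)) s≤t))
count-ups s (suc N) s≤t t< with m≤n⇒m<n∨m≡n s≤t
... | inj₁ s<t  = cong₂ _+_ (is-≢ (>⇒≢ s<t)) (count-ups (suc s) N s<t (≤-trans t< (≤-reflexive (+-suc s N))))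
... | inj₂ refl = cong₂ _+_ (is-refl s) (count-ups-< (suc s) N (n<1+n s))

All-count : ∀ {Q : ℕ → Set} l → (∀ t → count t l ≢ 0 → Q t) → All Q l
All-count []      h = []
All-count (a ∷ l) h = h a (λ e → 1+n≢0 (trans (cong (_+ count a l) (sym (is-refl a))) e)) ∷
  All-count l λ t ≢0 → h t λ e → ≢0 (m+n≡0⇒n≡0 (is t a) e)

count-All-< : ∀ {t l} → All (t <_) l → count t l ≡ 0
count-All-< []       = refl
count-All-< (a ∷ as) = cong₂ _+_ (is-≢ (<⇒≢ a)) (count-All-< as)

firstRow : ℕ → ℕ → ℕ
firstRow zero    k = k
firstRow (suc _) k = 0

rowIndex : SkewTab → ℕ → ℕ
rowIndex []              t = 0
rowIndex ((o , es) ∷ T') t = firstRow (count t es) (suc (rowIndex T' t))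

rowIndex-< : ∀ T' t → count t (concatMap proj₂ T') ≢ 0 → rowIndex T' t < length T'
rowIndex-< []              t ≢0 = contradiction refl ≢0
rowIndex-< ((o , es) ∷ T') t ≢0 with count t es in eq
... | suc _ = s≤s z≤n
... | zero  = s≤s (rowIndex-< T' t λ e → ≢0 (trans (count-++ t es _) (cong₂ _+_ eq e)))

pos-sorted : ∀ s N f j es → AllPairs _<_ es → All (s ≤_) es → All (_< s + N) es →
  (∀ t → s ≤ t → t < s + N → (count t es ≡ 0 → f t ≢ j) × (count t es ≢ 0 → f t ≡ j)) →
  pos s j (map f (ups s N)) ≡ es
pos-sorted s zero    f j []       ap ≥s <N h = refl
pos-sorted s zero    f j (e ∷ es) ap (s≤e ∷ _) (e< ∷ _) h = ⊥-elim (<⇒≱ e< (≤-trans (≤-reflexive (+-identityʳ s)) s≤e))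
pos-sorted s (suc N) f j []       ap ≥s <N h = trans (pos-miss s (map f (ups (suc s) N)) (≢-sym (proj₁ (h s ≤-refl (m<m+n s (s≤s z≤n))) refl)))
  (pos-sorted (suc s) N f j [] [] [] [] λ t s<t t< → h t (<⇒≤ s<t) (≤-trans t< (≤-reflexive (sym (+-suc s N)))))
pos-sorted s (suc N) f j (e ∷ es) (a ∷ ap) (s≤e ∷ ≥s) (e< ∷ <N) h with m≤n⇒m<n∨m≡n s≤e
... | inj₁ s<e = trans (pos-miss s (map f (ups (suc s) N)) (≢-sym (proj₁ (h s ≤-refl (m<m+n s (s≤s z≤n))) (count-All-< (s<e ∷ All.map (<-trans s<e) a)))))
  (pos-sorted (suc s) N f j (e ∷ es) (a ∷ ap) (s<e ∷ All.map (<-trans s<e) a) (All.map (λ {x} → subst (x <_) (+-suc s N)) (e< ∷ <N))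
    λ t s<t t< → h t (<⇒≤ s<t) (≤-trans t< (≤-reflexive (sym (+-suc s N)))))
... | inj₂ refl = begin
  pos s j (f s ∷ map f (ups (suc s) N))  ≡⟨ cong (λ q → pos s j (q ∷ map f (ups (suc s) N))) fs≡j ⟩
  pos s j (j ∷ map f (ups (suc s) N))    ≡⟨ pos-hit s j (map f (ups (suc s) N)) ⟩
  s ∷ pos (suc s) j (map f (ups (suc s) N))  ≡⟨ cong (s ∷_) (pos-sorted (suc s) N f j es ap a (All.map (λ {x} → subst (x <_) (+-suc s N)) <N) h') ⟩
  s ∷ es ∎
  where
  open ≡-Reasoning
  fs≡j : f s ≡ j
  fs≡j = proj₂ (h s ≤-refl e<) λ e → 1+n≢0 (trans (cong (_+ count s es) (sym (is-refl s))) e)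
  h' : ∀ t → suc s ≤ t → t < suc s + N → (count t es ≡ 0 → f t ≢ j) × (count t es ≢ 0 → f t ≡ j)
  h' t s<t t< = subst (λ c → (c ≡ 0 → f t ≢ j) × (c ≢ 0 → f t ≡ j)) (cong (_+ count t es) (is-≢ (>⇒≢ s<t)))
    (h t (<⇒≤ s<t) (≤-trans t< (≤-reflexive (sym (+-suc s N)))))

-- Invariant of the walk down the rows: an entry was either listed above row j, and then f t < j, or
-- occurs exactly once in the remaining rows, where f gives its place.
tab-of-rows : ∀ N f j T' → All (λ row → Linked _<_ (proj₂ row)) T' →
  (∀ t → count t (concatMap proj₂ T') ≢ 0 → 1 ≤ t × t < 1 + N) →
  (∀ t → 1 ≤ t → t < 1 + N → (count t (concatMap proj₂ T') ≡ 0 × f t < j) ⊎ (count t (concatMap proj₂ T') ≡ 1 × f t ≡ j + rowIndex T' t)) →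
  tab 1 j (map proj₁ T') (map f (ups 1 N)) ≡ T'
tab-of-rows N f j [] ls range h = refl
tab-of-rows N f j ((o , es) ∷ T') (l ∷ ls) range h = cong₂ _∷_ (cong (o ,_) row) (tab-of-rows N f (suc j) T' ls range' h')
  where
  rangeʳ : ∀ t → count t es ≢ 0 → 1 ≤ t × t < 1 + N
  rangeʳ t ≢0 = range t λ e → ≢0 (m+n≡0⇒m≡0 _ (trans (sym (count-++ t es _)) e))
  range' : ∀ t → count t (concatMap proj₂ T') ≢ 0 → 1 ≤ t × t < 1 + N
  range' t ≢0 = range t λ e → ≢0 (m+n≡0⇒n≡0 (count t es) (trans (sym (count-++ t es _)) e))
  h″ : ∀ t → 1 ≤ t → t < 1 + N → ((count t es ≡ 0 → f t ≢ j) × (count t es ≢ 0 → f t ≡ j)) ×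
    ((count t (concatMap proj₂ T') ≡ 0 × f t < suc j) ⊎ (count t (concatMap proj₂ T') ≡ 1 × f t ≡ suc j + rowIndex T' t))
  h″ t 1≤t t< with count t es | h t 1≤t t< | count-++ t es (concatMap proj₂ T')
  ... | c | inj₁ (c0 , ft<) | c≡ = ((λ _ → <⇒≢ ft<) , λ ≢0 → contradiction (m+n≡0⇒m≡0 c (trans (sym c≡) c0)) ≢0) ,
                                   inj₁ (m+n≡0⇒n≡0 c (trans (sym c≡) c0) , m<n⇒m<1+n ft<)
  ... | zero | inj₂ (c1 , ft≡) | c≡ = ((λ _ e → <⇒≢ (≤-trans (s≤s (m≤m+n j _)) (≤-reflexive (sym (+-suc j _)))) (trans (sym e) ft≡)) , λ ≢0 → contradiction refl ≢0) ,
                                       inj₂ (trans (sym c≡) c1 , trans ft≡ (+-suc j _))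
  ... | suc c | inj₂ (c1 , ft≡) | c≡ = ((λ ()) , λ _ → trans ft≡ (+-identityʳ j)) ,
                                       inj₁ (m+n≡0⇒n≡0 c (suc-injective (trans (sym c≡) c1)) , s≤s (≤-reflexive (trans ft≡ (+-identityʳ j))))
  h' = λ t 1≤t t< → proj₂ (h″ t 1≤t t<)
  row : pos 1 j (map f (ups 1 N)) ≡ es
  row = pos-sorted 1 N f j es (Linked.Linked⇒AllPairs <-trans l) (All-count es λ t ≢0 → proj₁ (rangeʳ t ≢0)) (All-count es λ t ≢0 → proj₂ (rangeʳ t ≢0))
    λ t 1≤t t< → proj₁ (h″ t 1≤t t<)

standard-word : ∀ {n} S → length S ≡ suc n → IsStandardSkew S →
  ∃[ w ] S ≡ tab 1 0 (map proj₁ S) w × All (_≤ n) w × length w ≡ size S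
standard-word {n} S len (_ , rows< , _ , perm) = map (rowIndex S) (ups 1 N) ,
  sym (tab-of-rows N (rowIndex S) 0 S rows< range λ t 1≤t t< → inj₂ (one t 1≤t t< , refl)) ,
  All.map⁺ (All-count (ups 1 N) λ t ≢0 → let a , b = range t (λ e → ≢0 (trans (sym (c≡ t)) e)) in
    s≤s⁻¹ (≤-trans (rowIndex-< S t λ e → 1+n≢0 (trans (sym (one t a b)) e)) (≤-reflexive len))) ,
  trans (length-map (rowIndex S) (ups 1 N)) (length-ups 1 N)
  where
  N = size S
  c≡ : ∀ t → count t (concatMap proj₂ S) ≡ count t (ups 1 N)
  c≡ t = trans (count-↭ t perm) (cong (count t) (entries-ups N))
  one : ∀ t → 1 ≤ t → t < 1 + N → count t (concatMap proj₂ S) ≡ 1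
  one t 1≤t t< = trans (c≡ t) (count-ups 1 N 1≤t t<)
  range : ∀ t → count t (concatMap proj₂ S) ≢ 0 → 1 ≤ t × t < 1 + N
  range t ≢0 with 1 ≤? t | t <? 1 + N
  ... | yes a | yes b = a , b
  ... | no a  | _     = contradiction (trans (c≡ t) (count-ups-< 1 N (≰⇒> a))) ≢0
  ... | _     | no b  = contradiction (trans (c≡ t) (count-ups-≥ 1 N (≮⇒≥ b))) ≢0

-- Standardness as a lattice path condition

linked-tab : ∀ {R : Row → Row → Set} {s x} j os → Linked R (tab s j os x) → ∀ i → suc i < length os →
  R (at os i , pos s (j + i) x) (at os (suc i) , pos s (suc (j + i)) x)
linked-tab {R} {s} {x} j (o ∷ o' ∷ os) (r ∷ l) zero    i< =
  subst (λ k → R (o , pos s k x) (o' , pos s (suc k) x)) (sym (+-identityʳ j)) r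
linked-tab {R} {s} {x} j (o ∷ o' ∷ os) (r ∷ l) (suc i) (s≤s i<) =
  subst (λ k → R (at (o' ∷ os) i , pos s k x) (at os i , pos s (suc k) x)) (sym (+-suc j i)) (linked-tab {R} (suc j) (o' ∷ os) l i i<)
linked-tab j (o ∷ []) l i (s≤s ())

-- Suppose that the next entry lies in row i+1 while the filled parts of rows i and i+1 end in the
-- same column. Then the cell above it either holds a later entry, against the columns, or is
-- missing, against the shape.
standard⇒valid : ∀ {n} os w → length os ≡ suc n → IsStandardSkew (tab 1 0 os w) → Valid n (at os) w
standard⇒valid {n} os w len (shape , _ , col , _) y z w≡ {i} i<n =
  go [] w refl (subst₂ _≤_ (sym (+-identityʳ _)) (sym (+-identityʳ _)) (proj₁ ss)) y z w≡
  where
  i< : suc i < length os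
  i< = ≤-trans (s≤s i<n) (≤-reflexive (sym len))
  ss = linked-tab {ShapeStep} 0 os shape i i<
  cs = linked-tab {ColStep} 0 os col i i<
  o₀ = at os i
  o₁ = at os (suc i)
  go : ∀ A B → w ≡ A ++ B → o₁ + count (suc i) A ≤ o₀ + count i A → ∀ y z → B ≡ y ++ z → o₁ + count (suc i) (A ++ y) ≤ o₀ + count i (A ++ y)
  go A B w≡ inv [] z e = subst₂ _≤_ (cong (λ v → o₁ + count (suc i) v) (sym (++-identityʳ A))) (cong (λ v → o₀ + count i v) (sym (++-identityʳ A))) inv
  go A (q ∷ B) w≡ inv (_ ∷ y) z e with ∷-injective e
  ... | refl , e′ = subst₂ _≤_ (cong (λ v → o₁ + count (suc i) v) (++-assoc A [ q ] y)) (cong (λ v → o₀ + count i v) (++-assoc A [ q ] y))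
    (go (A ++ [ q ]) B (trans w≡ (sym (++-assoc A [ q ] B))) inv' y z e′)
    where
    snoc : ∀ j → count j (A ++ [ q ]) ≡ count j A + is j q
    snoc j = trans (count-++ j A [ q ]) (cong (count j A +_) (+-identityʳ _))
    strict : q ≡ suc i → o₁ + count (suc i) A ≢ o₀ + count i A
    strict refl eq = absurd (lookupL (pos t i (suc i ∷ B)) 0) refl
      where
      t = 1 + length A
      below : entryAt (o₁ , pos 1 (suc i) w) (o₁ + count (suc i) A) ≡ just t
      below = trans (cong (λ v → entryAt (o₁ , pos 1 (suc i) v) (o₁ + count (suc i) A)) w≡)
        (trans (entry-below 1 (suc i) o₁ A (suc i ∷ B) 0 (sym (+-identityʳ _))) (cong (λ l → lookupL l 0) (pos-hit t (suc i) B)))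
      above : entryAt (o₀ , pos 1 i w) (o₁ + count (suc i) A) ≡ lookupL (pos t i (suc i ∷ B)) 0
      above = trans (cong (λ v → entryAt (o₀ , pos 1 i v) (o₁ + count (suc i) A)) w≡) (entry-below 1 i o₀ A (suc i ∷ B) 0 (trans eq (sym (+-identityʳ _))))
      nil : ∀ l → lookupL l 0 ≡ nothing → l ≡ []
      nil [] _ = refl
      absurd : ∀ m → lookupL (pos t i (suc i ∷ B)) 0 ≡ m → ⊥
      absurd (just a) e = <⇒≱ (cs (o₁ + count (suc i) A) a t (trans above e) below) (lookupL-All 0 (pos-≥ t i (suc i ∷ B)) e)
      absurd nothing  e = 1+n≰n (begin
        suc (o₁ + count (suc i) A)                       ≡⟨ +-suc o₁ _ ⟨
        o₁ + suc (count (suc i) A)                       ≤⟨ +-monoʳ-≤ o₁ (≤-trans (≤-reflexive (sym (trans (+-suc _ _) (cong suc (+-identityʳ _)))))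
                                                              (+-monoʳ-≤ (count (suc i) A) (≤-trans (≤-reflexive (sym (is-refl i))) (m≤m+n (is i i) (count (suc i) B))))) ⟩
        o₁ + (count (suc i) A + count (suc i) (suc i ∷ B)) ≡⟨ cong (o₁ +_) (trans (length-pos 1 (suc i) w) (trans (cong (count (suc i)) w≡) (count-++ (suc i) A _))) ⟨
        o₁ + length (pos 1 (suc i) w)                    ≤⟨ proj₂ ss ⟩
        o₀ + length (pos 1 i w)                          ≡⟨ cong (o₀ +_) (trans (length-pos 1 i w) (trans (cong (count i) w≡) (count-++ i A _))) ⟩
        o₀ + (count i A + count i (suc i ∷ B))           ≡⟨ cong (λ c → o₀ + (count i A + c)) (trans (sym (length-pos t i (suc i ∷ B))) (cong length (nil (pos t i (suc i ∷ B)) e))) ⟩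
        o₀ + (count i A + 0)                             ≡⟨ cong (o₀ +_) (+-identityʳ _) ⟩
        o₀ + count i A                                   ≡⟨ eq ⟨
        o₁ + count (suc i) A                             ∎)
        where open ≤-Reasoning
    inv' : o₁ + count (suc i) (A ++ [ q ]) ≤ o₀ + count i (A ++ [ q ])
    inv' with q ≟ suc i
    ... | no q≢ = subst₂ _≤_ (cong (o₁ +_) (sym (trans (snoc (suc i)) (trans (cong (count (suc i) A +_) (is-≢ (≢-sym q≢))) (+-identityʳ _))))) (cong (o₀ +_) (sym (snoc i)))
                  (≤-trans inv (+-monoʳ-≤ o₀ (m≤m+n _ _)))
    ... | yes q≡ = subst₂ _≤_ (trans (sym (+-suc o₁ _)) (cong (o₁ +_) (sym (trans (snoc (suc i)) (trans (cong (λ q → count (suc i) A + is (suc i) q) q≡) (trans (cong (count (suc i) A +_) (is-refl i)) (+-comm _ 1)))))))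
                    (cong (o₀ +_) (sym (trans (snoc i) (trans (cong (λ q → count i A + is i q) q≡) (trans (cong (count i A +_) (is-suc i)) (+-identityʳ _))))))
                    (≤∧≢⇒< inv (strict q≡))

-- Concatenated powers

pos-shift : ∀ s d j x → pos (s + d) j x ≡ shift d (pos s j x)
pos-shift s d j [] = refl
pos-shift s d j (q ∷ x) with is j q
... | zero  = pos-shift (suc s) d j x
... | suc _ = cong (s + d ∷_) (pos-shift (suc s) d j x)

blocks : ∀ i w j → concatMap (λ t → shift (t * length w) (pos 1 i w)) (upTo j) ≡ pos 1 i (w ^^ j)
blocks i w zero    = refl
blocks i w (suc j) = begin
  concatMap g (upTo (suc j))                        ≡⟨ cong (concatMap g) (upTo-∷ʳ j) ⟨
  concatMap g (upTo j ++ [ j ])                     ≡⟨ concatMap-++ g (upTo j) [ j ] ⟩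
  concatMap g (upTo j) ++ g j ++ []                 ≡⟨ cong₂ _++_ (blocks i w j) (++-identityʳ (g j)) ⟩
  pos 1 i (w ^^ j) ++ g j                           ≡⟨ cong (pos 1 i (w ^^ j) ++_) (pos-shift 1 (j * length w) i w) ⟨
  pos 1 i (w ^^ j) ++ pos (1 + j * length w) i w    ≡⟨ cong (λ l → pos 1 i (w ^^ j) ++ pos (1 + l) i w) (length-^^ w j) ⟨
  pos 1 i (w ^^ j) ++ pos (1 + length (w ^^ j)) i w ≡⟨ pos-++ 1 i (w ^^ j) w ⟨
  pos 1 i (w ^^ j ++ w)                             ≡⟨ cong (pos 1 i) (^^-snoc w j) ⟨
  pos 1 i (w ^^ suc j)                              ∎
  where
  open ≡-Reasoning
  g : ℕ → List ℕ
  g t = shift (t * length w) (pos 1 i w)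

size-tab : ∀ {n} os x → length os ≡ suc n → All (_≤ n) x → size (tab 1 0 os x) ≡ length x
size-tab {n} os x len bs = trans (go 0 os) (trans (cong (λ b → rowSum 0 b (λ i → count i x)) len) (rowSum-count n bs))
  where
  go : ∀ j os → size (tab 1 j os x) ≡ rowSum j (length os) (λ i → count i x)
  go j []       = refl
  go j (o ∷ os) = cong₂ _+_ (length-pos 1 j x) (go (suc j) os)

pow-tab : ∀ {n} os w j → length os ≡ suc n → All (_≤ n) w → pow (tab 1 0 os w) j ≡ tab 1 0 os (w ^^ j)
pow-tab os w j len bs = trans (cong (λ m → map (power m) (tab 1 0 os w)) (size-tab os w len bs)) (go 0 os)
  where
  power : ℕ → Row → Row
  power m row = proj₁ row , concatMap (λ t → shift (t * m) (proj₂ row)) (upTo j)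
  go : ∀ i os → map (power (length w)) (tab 1 i os w) ≡ tab 1 i os (w ^^ j)
  go i []       = refl
  go i (o ∷ os) = cong₂ _∷_ (cong (o ,_) (blocks i w j)) (go (suc i) os)

-- Reading off the row of an entry

hit : ℕ → ℕ → Bool
hit x y = (y ≤ᵇ x) ∧ (x ≤ᵇ y)

≤ᵇ-true : ∀ {x y} → x ≤ y → (x ≤ᵇ y) ≡ true
≤ᵇ-true {x} {y} x≤y with x ≤ᵇ y in e
... | true  = refl
... | false = ⊥-elim (subst Data.Bool.T e (≤⇒≤ᵇ x≤y))
  where import Data.Bool

≤ᵇ-false : ∀ {x y} → y < x → (x ≤ᵇ y) ≡ false
≤ᵇ-false {x} {y} y<x with x ≤ᵇ y in e
... | false = refl
... | true  = contradiction y<x (≤⇒≯ (≤ᵇ⇒≤ x y (subst Data.Bool.T (sym e) tt)))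
  where import Data.Bool

hit-≡ : ∀ x → hit x x ≡ true
hit-≡ x = cong₂ _∧_ (≤ᵇ-true (≤-refl {x})) (≤ᵇ-true (≤-refl {x}))

hit-< : ∀ {x y} → y < x → hit x y ≡ false
hit-< y<x = cong₂ _∧_ (≤ᵇ-true (<⇒≤ y<x)) (≤ᵇ-false y<x)

hit-> : ∀ {x y} → x < y → hit x y ≡ false
hit-> {x} {y} x<y = cong (_∧ (x ≤ᵇ y)) (≤ᵇ-false x<y)

any-hit-> : ∀ {x l} → All (x <_) l → any (hit x) l ≡ false
any-hit-> []       = refl
any-hit-> (a ∷ as) = cong₂ _∨_ (hit-> a) (any-hit-> as)

any-pos : ∀ s j y q z → any (hit (s + length y)) (pos s j (y ++ q ∷ z)) ≡ any (hit (s + length y)) (pos (s + length y) j (q ∷ z))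
any-pos s j []      q z rewrite +-identityʳ s = refl
any-pos s j (a ∷ y) q z rewrite +-suc s (length y) with is j a
... | zero  = any-pos (suc s) j y q z
... | suc _ = trans (cong (_∨ any (hit (suc (s + length y))) (pos (suc s) j (y ++ q ∷ z))) (hit-< (s≤s (m≤m+n s (length y))))) (any-pos (suc s) j y q z)

any-pos-hit : ∀ s j y z → any (hit (s + length y)) (pos s j (y ++ j ∷ z)) ≡ true
any-pos-hit s j y z = trans (any-pos s j y j z) (trans (cong (any (hit t)) (pos-hit t j z)) (cong (_∨ any (hit t) (pos (suc t) j z)) (hit-≡ t)))
  where t = s + length y

any-pos-miss : ∀ s {j q} y z → j ≢ q → any (hit (s + length y)) (pos s j (y ++ q ∷ z)) ≡ false
any-pos-miss s {j} {q} y z j≢q = trans (any-pos s j y q z) (trans (cong (any (hit t)) (pos-miss t z j≢q)) (any-hit-> (pos-≥ (suc t) j z)))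
  where t = s + length y

rowOf-here : ∀ o es rest x → any (hit x) es ≡ true → rowOf ((o , es) ∷ rest) x ≡ just 0
rowOf-here o es rest x h with any (hit x) es
... | true = refl

rowOf-there : ∀ o es rest x {i} → any (hit x) es ≡ false → rowOf rest x ≡ just i → rowOf ((o , es) ∷ rest) x ≡ just (suc i)
rowOf-there o es rest x h e with any (hit x) es
... | false rewrite e = refl

rowOf-tab′ : ∀ s j os y z e → e < length os → rowOf (tab s j os (y ++ (j + e) ∷ z)) (s + length y) ≡ just e
rowOf-tab′ s j (o ∷ os) y z zero    e< = rowOf-here o (pos s j (y ++ (j + 0) ∷ z)) (tab s (suc j) os (y ++ (j + 0) ∷ z)) (s + length y)
  (trans (cong (λ q → any (hit (s + length y)) (pos s j (y ++ q ∷ z))) (+-identityʳ j)) (any-pos-hit s j y z))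
rowOf-tab′ s j (o ∷ os) y z (suc e) (s≤s e<) = rowOf-there o (pos s j (y ++ (j + suc e) ∷ z)) (tab s (suc j) os (y ++ (j + suc e) ∷ z)) (s + length y)
  (any-pos-miss s y z (<⇒≢ (≤-trans (s≤s (m≤m+n j e)) (≤-reflexive (sym (+-suc j e))))))
  (subst (λ q → rowOf (tab s (suc j) os (y ++ q ∷ z)) (s + length y) ≡ just e) (sym (+-suc j e)) (rowOf-tab′ s (suc j) os y z e e<))

rowOf-determines : ∀ {n} os os' A A' z w → length os ≡ suc n → length os' ≡ suc n → length A ≡ length A' → length z ≡ length w →
  All (_≤ n) z → All (_≤ n) w →
  (∀ x → length A < x → x ≤ length A + length z → rowOf (tab 1 0 os (A ++ z)) x ≡ rowOf (tab 1 0 os' (A' ++ w)) x) → z ≡ w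
rowOf-determines os os' A A' [] [] lo lo' lA lz bz bw h = refl
rowOf-determines {n} os os' A A' (q ∷ z) (q' ∷ w) lo lo' lA lz (b ∷ bz) (b' ∷ bw) h = cong₂ _∷_ q≡
  (rowOf-determines os os' (A ++ [ q ]) (A' ++ [ q' ]) z w lo lo' (trans (length-++ A) (trans (cong (_+ 1) lA) (sym (length-++ A')))) (suc-injective lz) bz bw
    λ x l u → subst₂ (λ v v' → rowOf (tab 1 0 os v) x ≡ rowOf (tab 1 0 os' v') x) (sym (++-assoc A [ q ] z)) (sym (++-assoc A' [ q' ] w))
      (h x (≤-trans (s≤s (≤-trans (m≤m+n (length A) 1) (≤-reflexive (sym (length-++ A))))) l)
        (≤-trans u (≤-reflexive (trans (cong (_+ length z) (length-++ A)) (+-assoc (length A) 1 _))))))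
  where
  q≡ : q ≡ q'
  q≡ = just-injective (begin
    just q                                                ≡⟨ rowOf-tab′ 1 0 os A z q (≤-trans (s≤s b) (≤-reflexive (sym lo))) ⟨
    rowOf (tab 1 0 os (A ++ q ∷ z)) (suc (length A))      ≡⟨ h (suc (length A)) ≤-refl (≤-trans (s≤s (m≤m+n (length A) (length z))) (≤-reflexive (sym (+-suc (length A) (length z))))) ⟩
    rowOf (tab 1 0 os' (A' ++ q' ∷ w)) (suc (length A))   ≡⟨ cong (λ l → rowOf (tab 1 0 os' (A' ++ q' ∷ w)) (suc l)) lA ⟩
    rowOf (tab 1 0 os' (A' ++ q' ∷ w)) (suc (length A'))  ≡⟨ rowOf-tab′ 1 0 os' A' w q' (≤-trans (s≤s b') (≤-reflexive (sym lo'))) ⟩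
    just q'                                               ∎)
    where open ≡-Reasoning

stabilizes⇒stable : ∀ {n r} os w k → length os ≡ suc n → All (_≤ n) w → Balanced n r w → Valid n (at os) w →
  StabilizesAt (tab 1 0 os w) (suc k) → Stable n w k
stabilizes⇒stable {n} os w k len bw bal v stab with E-++ n (w ^^ k) w
... | z , e , z⊑w = trans e (cong (E n (w ^^ k) ++_) (rowOf-determines (zeros (suc n)) os (E n (w ^^ k)) (w ^^ k) z w
  (length-replicate (suc n)) len (length-E n (w ^^ k)) (Pw.Pointwise-length z⊑w) (⊑-bound z⊑w bw) bw agree))
  where
  open ≡-Reasoning
  m≡ : size (tab 1 0 os w) ≡ length w
  m≡ = size-tab os w len bw
  lenE : length (E n (w ^^ k)) ≡ k * size (tab 1 0 os w)
  lenE = trans (length-E n (w ^^ k)) (trans (length-^^ w k) (cong (k *_) (sym m≡)))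
  agree : ∀ x → length (E n (w ^^ k)) < x → x ≤ length (E n (w ^^ k)) + length z →
    rowOf (tab 1 0 (zeros (suc n)) (E n (w ^^ k) ++ z)) x ≡ rowOf (tab 1 0 os (w ^^ k ++ w)) x
  agree x l u = begin
    rowOf (tab 1 0 (zeros (suc n)) (E n (w ^^ k) ++ z)) x     ≡⟨ cong (λ v → rowOf (tab 1 0 (zeros (suc n)) v) x) (trans (sym e) (cong (E n) (sym (^^-snoc w k)))) ⟩
    rowOf (tab 1 0 (zeros (suc n)) (E n (w ^^ suc k))) x      ≡⟨ cong (λ T' → rowOf T' x) (Rect-tab os (w ^^ suc k) len (^^-bound (suc k) bw) (valid-^^ (suc k) bal v)) ⟨
    rowOf (Rect (tab 1 0 os (w ^^ suc k))) x                  ≡⟨ cong (λ T' → rowOf (Rect T') x) (pow-tab os w (suc k) len bw) ⟨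
    rowOf (Rect (pow (tab 1 0 os w) (suc k))) x               ≡⟨ stab x (subst (_< x) lenE l) (≤-trans u (≤-reflexive (trans (cong₂ _+_ lenE (trans (Pw.Pointwise-length z⊑w) (sym m≡))) (+-comm _ (size (tab 1 0 os w)))))) ⟩
    rowOf (pow (tab 1 0 os w) (suc k)) x                      ≡⟨ cong (λ T' → rowOf T' x) (pow-tab os w (suc k) len bw) ⟩
    rowOf (tab 1 0 os (w ^^ suc k)) x                         ≡⟨ cong (λ v → rowOf (tab 1 0 os v) x) (^^-snoc w k) ⟩
    rowOf (tab 1 0 os (w ^^ k ++ w)) x                        ∎

-- Rotation

insert-row : ∀ s j b q x → j ≤ q → q < j + b → concatMap proj₂ (tab s j (zeros b) (q ∷ x)) ↭ s ∷ concatMap proj₂ (tab (suc s) j (zeros b) x)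
insert-row s j zero    q x j≤q q< = ⊥-elim (<⇒≱ q< (≤-trans (≤-reflexive (+-identityʳ j)) j≤q))
insert-row s j (suc b) q x j≤q q< with m≤n⇒m<n∨m≡n j≤q
... | inj₁ j<q  = ↭.trans (↭.↭-reflexive (cong (_++ concatMap proj₂ (tab s (suc j) (zeros b) (q ∷ x))) (pos-miss s x (<⇒≢ j<q))))
  (↭.trans (Perm.++⁺ˡ (pos (suc s) j x) (insert-row s (suc j) b q x j<q (≤-trans q< (≤-reflexive (+-suc j b)))))
    (Perm.shift s (pos (suc s) j x) _))
... | inj₂ refl = ↭.↭-reflexive (cong₂ _++_ (pos-hit s j x) (cong (concatMap proj₂) (tab-cong (suc j) (zeros b) λ i _ → pos-miss s x (>⇒≢ (s≤s (m≤m+n j i))))))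

entries-tab : ∀ s b x → All (_< b) x → concatMap proj₂ (tab s 0 (zeros b) x) ↭ ups s (length x)
entries-tab s b [] bs = ↭.↭-reflexive (go 0 b)
  where
  go : ∀ j b → concatMap proj₂ (tab s j (zeros b) []) ≡ []
  go j zero    = refl
  go j (suc b) = go (suc j) b
entries-tab s b (q ∷ x) (q< ∷ bs) = ↭.trans (insert-row s 0 b q x z≤n q<) (↭.prep s (entries-tab (suc s) b x bs))

concatMap-tab : ∀ s j os x → concatMap proj₂ (tab s j os x) ≡ concatMap proj₂ (tab s j (zeros (length os)) x)
concatMap-tab s j []       x = refl
concatMap-tab s j (o ∷ os) x = cong (pos s j x ++_) (concatMap-tab s (suc j) os x)

max : List ℕ → ℕ
max = foldr _⊔_ 0

max-↭ : ∀ {l l'} → l ↭ l' → max l ≡ max l'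
max-↭ ↭.refl         = refl
max-↭ (↭.prep a p)   = cong (a ⊔_) (max-↭ p)
max-↭ (↭.swap {xs = xs} {ys = ys} a b p) = trans (sym (⊔-assoc a b (max xs))) (trans (cong₂ _⊔_ (⊔-comm a b) (max-↭ p)) (⊔-assoc b a (max ys)))
max-↭ (↭.trans p p') = trans (max-↭ p) (max-↭ p')

max-ups : ∀ s N → max (ups (suc s) (suc N)) ≡ suc s + N
max-ups s zero    = trans (⊔-identityʳ (suc s)) (sym (+-identityʳ (suc s)))
max-ups s (suc N) = trans (cong (suc s ⊔_) (max-ups (suc s) N)) (trans (m≤n⇒m⊔n≡n (≤-trans (n≤1+n _) (m≤m+n (2 + s) N))) (sym (+-suc (suc s) N)))

max-ups-1 : ∀ N → max (ups 1 N) ≡ N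
max-ups-1 zero    = refl
max-ups-1 (suc N) = max-ups 0 N

-- Thereby the constant in `RectStar` is the length plus 1, and complementing the entries is
-- reversal of positions in the word.
max-entries : ∀ {n} os x → length os ≡ suc n → All (_≤ n) x → max (concatMap proj₂ (tab 1 0 os x)) ≡ length x
max-entries {n} os x len bs = trans (cong max (trans (concatMap-tab 1 0 os x) (cong (λ b → concatMap proj₂ (tab 1 0 (zeros b) x)) len)))
  (trans (max-↭ (entries-tab 1 (suc n) x (All.map s≤s bs))) (max-ups-1 (length x)))

map-∸-pos : ∀ N s j x → map (suc N ∸_) (pos (suc s) j x) ≡ map (N ∸_) (pos s j x)
map-∸-pos N s j [] = refl
map-∸-pos N s j (q ∷ x) with is j q
... | zero  = map-∸-pos N (suc s) j x
... | suc _ = cong (N ∸ s ∷_) (map-∸-pos N (suc s) j x)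

rot-pos : ∀ n {j x} → j ≤ n → All (_≤ n) x → reverse (map (suc (length x) ∸_) (pos 1 j x)) ≡ pos 1 (n ∸ j) (star n x)
rot-pos n j≤n [] = refl
rot-pos n {j} {q ∷ x} j≤n (b ∷ bs) = begin
  reverse (map (suc N ∸_) (mark (is j q) 1 (pos 2 j x)))    ≡⟨ head-mark (is j q) ⟩
  reverse (map (suc N ∸_) (pos 2 j x)) ++ mark (is j q) N []  ≡⟨ cong₂ _++_ (trans (cong reverse (map-∸-pos N 1 j x)) (rot-pos n j≤n bs)) (cong₂ (λ k t → mark k t []) is≡ (cong suc (sym (length-star n x)))) ⟩
  pos 1 k (star n x) ++ pos (1 + length (star n x)) k [ n ∸ q ]  ≡⟨ pos-++ 1 k (star n x) [ n ∸ q ] ⟨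
  pos 1 k (star n x ++ [ n ∸ q ])                           ≡⟨ cong (pos 1 k) (star-∷ n q x) ⟨
  pos 1 k (star n (q ∷ x))                                  ∎
  where
  open ≡-Reasoning
  N = suc (length x)
  k = n ∸ j
  is≡ : is j q ≡ is k (n ∸ q)
  is≡ = sym (trans (is-∸ n (m∸n≤m n j) b) (cong (λ i → is i q) (m∸[m∸n]≡n j≤n)))
  head-mark : ∀ i → reverse (map (suc N ∸_) (mark i 1 (pos 2 j x))) ≡ reverse (map (suc N ∸_) (pos 2 j x)) ++ mark i N []
  head-mark zero    = sym (++-identityʳ _)
  head-mark (suc i) = unfold-reverse N (map (suc N ∸_) (pos 2 j x))

tab-∷ʳ : ∀ s j os o x → tab s j (os ++ [ o ]) x ≡ tab s j os x ++ [ (o , pos s (j + length os) x) ]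
tab-∷ʳ s j []       o x = cong (λ k → [ (o , pos s k x) ]) (sym (+-identityʳ j))
tab-∷ʳ s j (a ∷ os) o x = cong ((a , pos s j x) ∷_) (trans (tab-∷ʳ s (suc j) os o x) (cong (λ k → tab s (suc j) os x ++ [ (o , pos s k x) ]) (sym (+-suc j (length os)))))

rotatedOffsets : ℕ → ℕ → List ℕ → Word → List ℕ
rotatedOffsets W j []       x = []
rotatedOffsets W j (o ∷ os) x = (W ∸ (o + count j x)) ∷ rotatedOffsets W (suc j) os x

length-rotatedOffsets : ∀ W j os x → length (rotatedOffsets W j os x) ≡ length os
length-rotatedOffsets W j []       x = refl
length-rotatedOffsets W j (o ∷ os) x = cong suc (length-rotatedOffsets W (suc j) os x)

at-rotatedOffsets : ∀ W j os x i → i < length os → at (rotatedOffsets W j os x) i ≡ W ∸ (at os i + count (j + i) x)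
at-rotatedOffsets W j (o ∷ os) x zero    i< = cong (λ k → W ∸ (o + count k x)) (sym (+-identityʳ j))
at-rotatedOffsets W j (o ∷ os) x (suc i) (s≤s i<) = trans (at-rotatedOffsets W (suc j) os x i i<) (cong (λ k → W ∸ (at os i + count k x)) (sym (+-suc j i)))

rot-tab : ∀ {n} W os x → length os ≡ suc n → All (_≤ n) x →
  rot W (suc (length x)) (tab 1 0 os x) ≡ tab 1 0 (reverse (rotatedOffsets W 0 os x)) (star n x)
rot-tab {n} W os x len bs = go 0 os len
  where
  turn-row : Row → Row
  turn-row row = W ∸ (proj₁ row + length (proj₂ row)) , reverse (map (suc (length x) ∸_) (proj₂ row))
  go : ∀ j os → j + length os ≡ suc n → reverse (map turn-row (tab 1 j os x)) ≡ tab 1 0 (reverse (rotatedOffsets W j os x)) (star n x)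
  go j []       e = refl
  go j (o ∷ os) e = begin
    reverse (turn-row (o , pos 1 j x) ∷ map turn-row (tab 1 (suc j) os x))    ≡⟨ unfold-reverse _ (map turn-row (tab 1 (suc j) os x)) ⟩
    reverse (map turn-row (tab 1 (suc j) os x)) ++ [ turn-row (o , pos 1 j x) ]  ≡⟨ cong₂ (λ a b → a ++ [ b ]) (go (suc j) os (trans (sym (+-suc j _)) e))
                                                                           (cong₂ _,_ (cong (λ k → W ∸ (o + k)) (length-pos 1 j x)) (trans (rot-pos n j≤n bs) (cong (λ k → pos 1 k (star n x)) l≡))) ⟩
    tab 1 0 ω (star n x) ++ [ (W ∸ (o + count j x) , pos 1 (length ω) (star n x)) ]  ≡⟨ tab-∷ʳ 1 0 ω _ (star n x) ⟨
    tab 1 0 (ω ++ [ W ∸ (o + count j x) ]) (star n x)                        ≡⟨ cong (λ l → tab 1 0 l (star n x)) (unfold-reverse _ (rotatedOffsets W (suc j) os x)) ⟨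
    tab 1 0 (reverse (rotatedOffsets W j (o ∷ os) x)) (star n x)              ∎
    where
    open ≡-Reasoning
    ω = reverse (rotatedOffsets W (suc j) os x)
    e′ : j + length os ≡ n
    e′ = suc-injective (trans (sym (+-suc j _)) e)
    j≤n : j ≤ n
    j≤n = ≤-trans (m≤m+n j _) (≤-reflexive e′)
    l≡ : n ∸ j ≡ length ω
    l≡ = trans (cong (_∸ j) (sym e′)) (trans (m+n∸m≡n j _) (sym (trans (length-reverse (rotatedOffsets W (suc j) os x)) (length-rotatedOffsets W (suc j) os x))))

at-++ˡ : ∀ l {l'} j → j < length l → at (l ++ l') j ≡ at l j
at-++ˡ (a ∷ l) zero    j< = refl
at-++ˡ (a ∷ l) (suc j) j< = at-++ˡ l j (s≤s⁻¹ j<)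

at-∷ʳ : ∀ l a → at (l ++ [ a ]) (length l) ≡ a
at-∷ʳ []      a = refl
at-∷ʳ (_ ∷ l) a = at-∷ʳ l a

at-reverse : ∀ l j i → suc (j + i) ≡ length l → at (reverse l) j ≡ at l i
at-reverse (a ∷ l) j zero e = trans (cong₂ at (unfold-reverse a l) (trans (sym (+-identityʳ j)) (trans (suc-injective e) (sym (length-reverse l))))) (at-∷ʳ (reverse l) a)
at-reverse (a ∷ l) j (suc i) e = trans (cong (λ z → at z j) (unfold-reverse a l))
  (trans (at-++ˡ (reverse l) j (≤-trans (s≤s (m≤m+n j i)) (≤-reflexive (trans e′ (sym (length-reverse l)))))) (at-reverse l j i e′))
  where
  e′ : suc (j + i) ≡ length l
  e′ = trans (sym (+-suc j i)) (suc-injective e)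

-- It suffices that W reaches past every row end, for then the truncated subtractions are exact and
-- rotation turns suffix shapes of x into complements of prefix shapes.
rotated-valid : ∀ {n} W os x → length os ≡ suc n → All (_≤ n) x → (∀ i → i ≤ n → at os i + count i x ≤ W) → Valid n (at os) x →
  Valid n (at (reverse (rotatedOffsets W 0 os x))) (star n x)
rotated-valid {n} W os x len bs W≥ v y z e {i} i<n = subst₂ _≤_ (sym (eq (suc i) i<n)) (sym (eq i (<⇒≤ i<n)))
  (∸-monoʳ-≤ W (subst (λ m → at os m + count m (star n z) ≤ at os k + count k (star n z)) (suc-∸-suc i<n) (v (star n z) (star n y) x≡ (∸suc< i<n))))
  where
  k = n ∸ suc i
  x≡ : x ≡ star n z ++ star n y
  x≡ = star-split n bs y z e
  by : All (_≤ n) y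
  by = All.++⁻ˡ y (subst (All (_≤ n)) e (star-bound n x))
  eq : ∀ j → j ≤ n → at (reverse (rotatedOffsets W 0 os x)) j + count j y ≡ W ∸ (at os (n ∸ j) + count (n ∸ j) (star n z))
  eq j j≤n = begin
    at (reverse (rotatedOffsets W 0 os x)) j + count j y    ≡⟨ cong (_+ count j y) (trans (at-reverse (rotatedOffsets W 0 os x) j j' (trans (cong suc (m+[n∸m]≡n j≤n)) (sym (trans (length-rotatedOffsets W 0 os x) len))))
                                                                  (at-rotatedOffsets W 0 os x j' (≤-trans (s≤s (m∸n≤m n j)) (≤-reflexive (sym len))))) ⟩
    W ∸ (at os j' + count j' x) + count j y                 ≡⟨ cong (λ c → W ∸ c + count j y) total ⟩
    W ∸ (a + count j y) + count j y                         ≡⟨ cong (_+ count j y) (∸-+-assoc W a (count j y)) ⟨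
    W ∸ a ∸ count j y + count j y                           ≡⟨ m∸n+n≡m (m+n≤o⇒m≤o∸n (count j y) (≤-trans (≤-reflexive (trans (+-comm (count j y) a) (sym total))) (W≥ j' (m∸n≤m n j)))) ⟩
    W ∸ a                                                   ∎
    where
    open ≡-Reasoning
    j' = n ∸ j
    a = at os j' + count j' (star n z)
    total : at os j' + count j' x ≡ a + count j y
    total = trans (cong (at os j' +_) (trans (cong (count j') x≡) (trans (count-++ j' (star n z) (star n y)) (cong (count j' (star n z) +_)
      (trans (count-star n (m∸n≤m n j) by) (cong (λ i → count i y) (m∸[m∸n]≡n j≤n))))))) (sym (+-assoc (at os j') _ _))

≤-max : ∀ j os x i → i < length os → at os i + count (j + i) x ≤ max (map (λ row → proj₁ row + length (proj₂ row)) (tab 1 j os x))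
≤-max j (o ∷ os) x zero    i< = ≤-trans (≤-reflexive (cong (o +_) (trans (cong (λ k → count k x) (+-identityʳ j)) (sym (length-pos 1 j x))))) (m≤m⊔n _ _)
≤-max j (o ∷ os) x (suc i) (s≤s i<) = ≤-trans (≤-reflexive (cong (λ k → at os i + count k x) (+-suc j i))) (≤-trans (≤-max (suc j) os x i i<) (m≤n⊔m (o + length (pos 1 j x)) _))

-- Both rotations act on row words as `star`. The second one also moves the rows horizontally, which
-- `rows` forgets.
rows-RectStar : ∀ {n} os x → length os ≡ suc n → All (_≤ n) x → Valid n (at os) x →
  rows (RectStar (tab 1 0 os x)) ≡ rowsFrom 1 0 (suc n) (star n (E n (star n x)))
rows-RectStar {n} os x len bs v = begin
  rows (rot W (suc (max (concatMap proj₂ (tab 1 0 os x)))) (Rect (rot W (suc (max (concatMap proj₂ (tab 1 0 os x)))) (tab 1 0 os x))))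
    ≡⟨ cong (λ c → rows (rot W (suc c) (Rect (rot W (suc c) (tab 1 0 os x))))) (max-entries os x len bs) ⟩
  rows (rot W (suc (length x)) (Rect (rot W (suc (length x)) (tab 1 0 os x))))
    ≡⟨ cong (λ t → rows (rot W (suc (length x)) (Rect t))) (rot-tab W os x len bs) ⟩
  rows (rot W (suc (length x)) (Rect (tab 1 0 ω (star n x))))
    ≡⟨ cong (λ t → rows (rot W (suc (length x)) t)) (Rect-tab ω (star n x) lenω (star-bound n x)
         (rotated-valid W os x len bs (λ i i≤n → ≤-max 0 os x i (≤-trans (s≤s i≤n) (≤-reflexive (sym len)))) v)) ⟩
  rows (rot W (suc (length x)) (tab 1 0 (zeros (suc n)) y))
    ≡⟨ cong (λ l → rows (rot W (suc l) (tab 1 0 (zeros (suc n)) y))) (trans (sym (length-star n x)) (sym (length-E n (star n x)))) ⟩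
  rows (rot W (suc (length y)) (tab 1 0 (zeros (suc n)) y))
    ≡⟨ cong rows (rot-tab W (zeros (suc n)) y (length-replicate (suc n)) (E-bound n (star-bound n x))) ⟩
  rows (tab 1 0 (reverse (rotatedOffsets W 0 (zeros (suc n)) y)) (star n y))
    ≡⟨ rows-tab 1 0 (reverse (rotatedOffsets W 0 (zeros (suc n)) y)) (star n y) ⟩
  rowsFrom 1 0 (length (reverse (rotatedOffsets W 0 (zeros (suc n)) y))) (star n y)
    ≡⟨ cong (λ b → rowsFrom 1 0 b (star n y)) (trans (length-reverse (rotatedOffsets W 0 (zeros (suc n)) y))
         (trans (length-rotatedOffsets W 0 (zeros (suc n)) y) (length-replicate (suc n)))) ⟩
  rowsFrom 1 0 (suc n) (star n y) ∎
  where
  open ≡-Reasoning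
  W = max (map (λ row → proj₁ row + length (proj₂ row)) (tab 1 0 os x))
  ω = reverse (rotatedOffsets W 0 os x)
  lenω : length ω ≡ suc n
  lenω = trans (length-reverse (rotatedOffsets W 0 os x)) (trans (length-rotatedOffsets W 0 os x) len)
  y = E n (star n x)

-- Rectangular standard tableaux

linked-∷ : ∀ {s l} → All (s <_) l → Linked _<_ l → Linked _<_ (s ∷ l)
linked-∷ []      []      = [-]
linked-∷ (a ∷ _) [-]     = a ∷ [-]
linked-∷ (a ∷ _) (r ∷ l) = a ∷ r ∷ l

pos-linked : ∀ s j x → Linked _<_ (pos s j x)
pos-linked s j [] = []
pos-linked s j (q ∷ x) with is j q
... | zero  = pos-linked (suc s) j x
... | suc _ = linked-∷ (pos-≥ (suc s) j x) (pos-linked (suc s) j x)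

-- Here d is the lead of row i over row i+1 in the part already read, so the entries with remaining
-- indices c and c + d stand in one column. A letter i raises the lead, and a letter i+1 consumes
-- it.
columns-increase : ∀ s i x d c {a b} → (∀ y z → x ≡ y ++ z → count (suc i) y ≤ count i y + d) →
  lookupL (pos s i x) c ≡ just a → lookupL (pos s (suc i) x) (c + d) ≡ just b → a < b
columns-increase s i (q ∷ x) d c {a} {b} h ea eb with q ≟ i | q ≟ suc i
... | yes refl | yes ()
... | yes refl | no _ = go c (subst (λ l → lookupL l c ≡ just a) (pos-hit s i x) ea) (subst (λ l → lookupL l (c + d) ≡ just b) (pos-miss s x (>⇒≢ (n<1+n i))) eb)
  where
  h' : ∀ y z → x ≡ y ++ z → count (suc i) y ≤ count i y + suc d
  h' y z e = subst₂ _≤_ (cong (_+ count (suc i) y) (is-pred i)) (trans (cong (λ k → k + count i y + d) (is-refl i)) (sym (+-suc (count i y) d))) (h (i ∷ y) z (cong (i ∷_) e))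
  go : ∀ c → lookupL (s ∷ pos (suc s) i x) c ≡ just a → lookupL (pos (suc s) (suc i) x) (c + d) ≡ just b → a < b
  go zero    refl eb = lookupL-All d (pos-≥ (suc s) (suc i) x) eb
  go (suc c) ea   eb = columns-increase (suc s) i x (suc d) c h' ea (subst (λ m → lookupL (pos (suc s) (suc i) x) m ≡ just b) (sym (+-suc c d)) eb)
... | no _ | yes refl = go d h (subst (λ l → lookupL l c ≡ just a) (pos-miss s x (<⇒≢ (n<1+n i))) ea) (subst (λ l → lookupL l (c + d) ≡ just b) (pos-hit s (suc i) x) eb)
  where
  go : ∀ d → (∀ y z → suc i ∷ x ≡ y ++ z → count (suc i) y ≤ count i y + d) → lookupL (pos (suc s) i x) c ≡ just a →
    lookupL (s ∷ pos (suc s) (suc i) x) (c + d) ≡ just b → a < b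
  go zero    h ea eb = ⊥-elim (1+n≰n (subst₂ _≤_ (trans (+-identityʳ _) (is-refl i)) (trans (+-identityʳ _) (trans (+-identityʳ _) (is-suc i))) (h [ suc i ] x refl)))
  go (suc d) h ea eb = columns-increase (suc s) i x d c (λ y z e → s≤s⁻¹ (subst₂ _≤_ (cong (_+ count (suc i) y) (is-refl i))
      (trans (cong (λ k → k + count i y + suc d) (is-suc i)) (+-suc (count i y) d)) (h (suc i ∷ y) z (cong (suc i ∷_) e))))
    ea (subst (λ m → lookupL (s ∷ pos (suc s) (suc i) x) m ≡ just b) (+-suc c d) eb)
... | no q≢i | no q≢1+i = columns-increase (suc s) i x d c
  (λ y z e → subst₂ _≤_ (cong (_+ count (suc i) y) (is-≢ (≢-sym q≢1+i))) (cong (λ k → k + count i y + d) (is-≢ (≢-sym q≢i))) (h (q ∷ y) z (cong (q ∷_) e)))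
  (subst (λ l → lookupL l c ≡ just a) (pos-miss s x (≢-sym q≢i)) ea) (subst (λ l → lookupL l (c + d) ≡ just b) (pos-miss s x (≢-sym q≢1+i)) eb)

linked-zeros : ∀ {R : Row → Row → Set} {s x} j b → (∀ i → j ≤ i → suc i < j + b → R (0 , pos s i x) (0 , pos s (suc i) x)) →
  Linked R (tab s j (zeros b) x)
linked-zeros j zero          h = []
linked-zeros j (suc zero)    h = [-]
linked-zeros {R} j (suc (suc b)) h = h j ≤-refl (≤-trans (s≤s (s≤s (m≤m+n j b))) (≤-reflexive (sym (trans (+-suc j (suc b)) (cong suc (+-suc j b)))))) ∷
  linked-zeros {R} (suc j) (suc b) λ i j<i i< → h i (<⇒≤ j<i) (≤-trans i< (≤-reflexive (sym (+-suc j (suc b)))))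

rows-length : ∀ {L} s j b x → (∀ i → j ≤ i → i < j + b → count i x ≡ L) → All (λ row → length row ≡ L) (rowsFrom s j b x)
rows-length s j zero    x h = []
rows-length s j (suc b) x h = trans (length-pos s j x) (h j ≤-refl (≤-trans (s≤s (m≤m+n j b)) (≤-reflexive (sym (+-suc j b))))) ∷
  rows-length s (suc j) b x λ i j<i i< → h i (<⇒≤ j<i) (≤-trans i< (≤-reflexive (sym (+-suc j b))))

length-rowsFrom : ∀ s j b x → length (rowsFrom s j b x) ≡ b
length-rowsFrom s j zero    x = refl
length-rowsFrom s j (suc b) x = cong suc (length-rowsFrom s (suc j) b x)

rows-linked : ∀ s j os x → All (λ row → Linked _<_ (proj₂ row)) (tab s j os x)
rows-linked s j []       x = []
rows-linked s j (o ∷ os) x = pos-linked s j x ∷ rows-linked s (suc j) os x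

isRectSYT : ∀ {n L x} → All (_≤ n) x → Balanced n L x → Valid n Empty x → IsRectSYT L (suc n) (rowsFrom 1 0 (suc n) x)
isRectSYT {n} {L} {x} bs bal v = length-rowsFrom 1 0 (suc n) x , rows-length 1 0 (suc n) x (λ i _ i< → bal i (s≤s⁻¹ i<)) ,
  subst IsStandardSkew (sym (map-rows 1 0 (suc n) x))
    ( linked-zeros {ShapeStep} 0 (suc n) (λ i _ i< → z≤n , ≤-reflexive (trans (length-pos 1 (suc i) x)
        (trans (bal (suc i) (s≤s⁻¹ i<)) (sym (trans (length-pos 1 i x) (bal i (<⇒≤ (s≤s⁻¹ i<))))))))
    , rows-linked 1 0 (zeros (suc n)) x
    , linked-zeros {ColStep} 0 (suc n) (λ i _ i< c a b ea eb → columns-increase 1 i x 0 c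
        (λ y z e → ≤-trans (v y z e (s≤s⁻¹ i<)) (≤-reflexive (sym (+-identityʳ _)))) ea
        (subst (λ m → lookupL (pos 1 (suc i) x) m ≡ just b) (sym (+-identityʳ c)) eb))
    , ↭.trans (entries-tab 1 (suc n) x (All.map s≤s bs)) (↭.↭-reflexive (sym
        (trans (entries-ups _) (cong (ups 1) (size-tab (zeros (suc n)) x (length-replicate (suc n)) bs))))) )

-- Assembly of the concatenated tableau

zip3++-rows : ∀ j b x y z → zip3++ (rowsFrom 1 j b x) (map (shift (length x)) (rowsFrom 1 j b y)) (map (shift (length x + length y)) (rowsFrom 1 j b z))
  ≡ rowsFrom 1 j b (x ++ y ++ z)
zip3++-rows j zero    x y z = refl
zip3++-rows j (suc b) x y z = cong₂ _∷_ (sym (begin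
  pos 1 j (x ++ y ++ z)                                                        ≡⟨ pos-++ 1 j x (y ++ z) ⟩
  pos 1 j x ++ pos (1 + length x) j (y ++ z)                                   ≡⟨ cong (pos 1 j x ++_) (pos-++ (1 + length x) j y z) ⟩
  pos 1 j x ++ pos (1 + length x) j y ++ pos (1 + length x + length y) j z     ≡⟨ cong₂ (λ u w → pos 1 j x ++ u ++ w) (pos-shift 1 (length x) j y) (pos-shift 1 (length x + length y) j z) ⟩
  pos 1 j x ++ shift (length x) (pos 1 j y) ++ shift (length x + length y) (pos 1 j z)  ∎))
  (zip3++-rows (suc j) b x y z)
  where open ≡-Reasoning

balanced-rows : ∀ {r} j os w → All (λ row → length (proj₂ row) ≡ r) (tab 1 j os w) → ∀ i → i < length os → count (j + i) w ≡ r
balanced-rows j (o ∷ os) w (e ∷ es) zero    i< = trans (cong (λ k → count k w) (+-identityʳ j)) (trans (sym (length-pos 1 j w)) e)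
balanced-rows j (o ∷ os) w (e ∷ es) (suc i) (s≤s i<) = trans (cong (λ k → count k w) (+-suc j i)) (balanced-rows (suc j) os w es i i<)

rowSum-const : ∀ j b r → rowSum j b (λ _ → r) ≡ b * r
rowSum-const j zero    r = refl
rowSum-const j (suc b) r = cong (r +_) (rowSum-const (suc j) b r)

length-balanced : ∀ {n r w} → All (_≤ n) w → Balanced n r w → length w ≡ suc n * r
length-balanced {n} {r} bw bal = trans (sym (rowSum-count n bw)) (trans (rowSum-cong 0 (suc n) λ i _ i< → bal i (s≤s⁻¹ i<)) (rowSum-const 0 (suc n) r))

-- With stabilization index k + 1 and a = 2k + 1 + c, the subtractions in `Ra` become k outer blocks
-- on each side, c + 1 middle blocks, and a last shift by k + (c + 1) blocks.
Ra-glued : ∀ {n r} os w k c → length os ≡ suc n → (bw : All (_≤ n) w) (bal : Balanced n r w) → Valid n (at os) w → (st : Stable n w k) →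
  Ra (suc n) r (tab 1 0 os w) (suc k) (suc (k + k + c)) ≡ rowsFrom 1 0 (suc n) (Glued.glued n w k c r bw bal st)
Ra-glued {n} {r} os w k c len bw bal v st = trans (cong₃ zip3++ left middle right) (zip3++-rows 0 (suc n) u (w ^^ suc c) l)
  where
  open ≡-Reasoning
  cong₃ : ∀ {A B C D : Set} (f : A → B → C → D) {a a' b b' c c'} → a ≡ a' → b ≡ b' → c ≡ c' → f a b c ≡ f a' b' c'
  cong₃ f refl refl refl = refl
  S = tab 1 0 os w
  u = E n (w ^^ k)
  l = star n (E n (star n w ^^ k))
  m≡ : length w ≡ suc n * r
  m≡ = length-balanced bw bal
  lenu : length u ≡ k * (suc n * r)
  lenu = trans (length-E n (w ^^ k)) (trans (length-^^ w k) (cong (k *_) m≡))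
  blocks≡ : suc (k + k + c) + 2 ∸ 2 * suc k ≡ suc c
  blocks≡ = trans (cong (_∸ 2 * suc k) (arith k c)) (m+n∸m≡n (2 * suc k) (suc c))
    where
    open import Data.Nat.Tactic.RingSolver using (solve-∀)
    arith : ∀ k c → suc (k + k + c) + 2 ≡ 2 * suc k + suc c
    arith = solve-∀
  last≡ : suc (k + k + c) + 1 ∸ suc k ≡ k + suc c
  last≡ = trans (cong (_∸ suc k) (arith k c)) (m+n∸m≡n (suc k) (k + suc c))
    where
    open import Data.Nat.Tactic.RingSolver using (solve-∀)
    arith : ∀ k c → suc (k + k + c) + 1 ≡ suc k + (k + suc c)
    arith = solve-∀
  left : rows (Rect (pow S k)) ≡ rowsFrom 1 0 (suc n) u
  left = begin
    rows (Rect (pow S k))                      ≡⟨ cong (rows ∘ Rect) (pow-tab os w k len bw) ⟩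
    rows (Rect (tab 1 0 os (w ^^ k)))          ≡⟨ cong rows (Rect-tab os (w ^^ k) len (^^-bound k bw) (valid-^^ k bal v)) ⟩
    rows (tab 1 0 (zeros (suc n)) u)           ≡⟨ rows-tab 1 0 (zeros (suc n)) u ⟩
    rowsFrom 1 0 (length (zeros (suc n))) u    ≡⟨ cong (λ b → rowsFrom 1 0 b u) (length-replicate (suc n)) ⟩
    rowsFrom 1 0 (suc n) u                     ∎
  middle : map (shift (k * (suc n * r))) (rows (pow S (suc (k + k + c) + 2 ∸ 2 * suc k))) ≡ map (shift (length u)) (rowsFrom 1 0 (suc n) (w ^^ suc c))
  middle = cong₂ (λ d R → map (shift d) R) (sym lenu) (begin
    rows (pow S (suc (k + k + c) + 2 ∸ 2 * suc k))  ≡⟨ cong (λ j → rows (pow S j)) blocks≡ ⟩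
    rows (pow S (suc c))                            ≡⟨ cong rows (pow-tab os w (suc c) len bw) ⟩
    rows (tab 1 0 os (w ^^ suc c))                  ≡⟨ rows-tab 1 0 os (w ^^ suc c) ⟩
    rowsFrom 1 0 (length os) (w ^^ suc c)           ≡⟨ cong (λ b → rowsFrom 1 0 b (w ^^ suc c)) len ⟩
    rowsFrom 1 0 (suc n) (w ^^ suc c)               ∎)
  right : map (shift ((suc (k + k + c) + 1 ∸ suc k) * (suc n * r))) (rows (RectStar (pow S k))) ≡
          map (shift (length u + length (w ^^ suc c))) (rowsFrom 1 0 (suc n) l)
  right = cong₂ (λ d R → map (shift d) R)
    (trans (cong (_* (suc n * r)) last≡) (trans (*-distribʳ-+ (suc n * r) k (suc c)) (sym (cong₂ _+_ lenu (trans (length-^^ w (suc c)) (cong (suc c *_) m≡))))))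
    (begin
      rows (RectStar (pow S k))                            ≡⟨ cong (rows ∘ RectStar) (pow-tab os w k len bw) ⟩
      rows (RectStar (tab 1 0 os (w ^^ k)))                ≡⟨ rows-RectStar os (w ^^ k) len (^^-bound k bw) (valid-^^ k bal v) ⟩
      rowsFrom 1 0 (suc n) (star n (E n (star n (w ^^ k))))  ≡⟨ cong (λ x → rowsFrom 1 0 (suc n) (star n (E n x))) (star-^^ n w k) ⟩
      rowsFrom 1 0 (suc n) l                               ∎)

promotion-fixes : ∀ {n r} os w k c → length os ≡ suc n → All (_≤ n) w → Balanced n r w → Valid n (at os) w → Stable n w k →
  let a = suc (k + k + c) ; X = Ra (suc n) r (tab 1 0 os w) (suc k) a in
  IsRectSYT (a * r) (suc n) X × iter (suc n * r) pr X ≡ X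
promotion-fixes {n} {r} os w k c len bw bal v st =
  subst₂ (λ L X → IsRectSYT L (suc n) X × iter (suc n * r) pr X ≡ X) (arith k c r) (sym (Ra-glued os w k c len bw bal v st))
    (isRectSYT glued-bound count-glued glued-valid ,
     subst (λ m → iter m pr (rowsFrom 1 0 (suc n) glued) ≡ rowsFrom 1 0 (suc n) glued) (length-balanced bw bal) pr-glued)
  where
  open Glued n w k c r bw bal st
  open import Data.Nat.Tactic.RingSolver using (solve-∀)
  arith : ∀ k c r → k * r + k * r + c * r + r ≡ suc (k + k + c) * r
  arith = solve-∀

theorem6p4 : (b r : ℕ) → 1 ≤ b → 1 ≤ r →
    (S : SkewTab) → length S ≡ b → All (λ row → length (proj₂ row) ≡ r) S → IsStandardSkew S →
    (k : ℕ) → IsStab S k → (a : ℕ) → 2 * k ≤ a + 1 →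
    IsRectSYT (a * r) b (Ra b r S k a) × iter (b * r) pr (Ra b r S k a) ≡ Ra b r S k a
theorem6p4 (suc n) r _ _ S len rows≡ std (suc k) (_ , stab , _) a 2k≤ with standard-word S len std | m≤n⇒∃[o]m+o≡n 2k≤
... | w , S≡ , bw , _ | c , c≡ = subst₂ (λ S a → IsRectSYT (a * r) (suc n) (Ra (suc n) r S (suc k) a) × iter (suc n * r) pr (Ra (suc n) r S (suc k) a) ≡ Ra (suc n) r S (suc k) a)
  (sym S≡) a≡ (promotion-fixes os w k c lenos bw bal v (stabilizes⇒stable os w k lenos bw bal v (subst (λ S → StabilizesAt S (suc k)) S≡ stab)))
  where
  os = map proj₁ S
  lenos : length os ≡ suc n
  lenos = trans (length-map proj₁ S) len
  bal : Balanced n r w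
  bal j j≤n = balanced-rows 0 os w (subst (All (λ row → length (proj₂ row) ≡ r)) S≡ rows≡) j (≤-trans (s≤s j≤n) (≤-reflexive (sym lenos)))
  v : Valid n (at os) w
  v = standard⇒valid os w lenos (subst IsStandardSkew S≡ std)
  a≡ : suc (k + k + c) ≡ a
  a≡ = +-cancelʳ-≡ 1 _ _ (trans (arith k c) c≡)
    where
    open import Data.Nat.Tactic.RingSolver using (solve-∀)
    arith : ∀ k c → suc (k + k + c) + 1 ≡ 2 * suc k + c
    arith = solve-∀
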